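{- Let $N\ge0$ be an integer, $R=abcdef$, and for $\mu\in\{0,1,2\}$ let $S^3_{3N+\mu}(a,b,c,d,e,f)=\sum_{\pi\in\mathcal{S}^3_{3N+\mu,\infty}}\omega^3_\pi(a,b,c,d,e,f)$ and $DS^3_{3N+\mu}(a,b,c,d,e,f)=\sum_{\pi\in\mathcal{DS}^3_{3N+\mu,\infty}}\omega^3_\pi(a,b,c,d,e,f)$. For $T=(t_1,t_2,t_3,t_4)\in\mathbb{N}^4$ put $$F(T)=\frac{(a+ab)^{t_1}(abcd+abcde)^{t_2}(abc)^{t_3}}{(R;R)_{t_1}(R;R)_{t_2}(R;R)_{t_3}(R;R)_{t_4}}.$$ Then, with all sums over $T\in\mathbb{N}^4$ with $t_1+t_2+t_3+t_4=N$, $$S^3_{3N}=\sum_T R^{\binom{t_1}{2}+\binom{t_2}{2}}F(T),\qquad S^3_{3N+2}=(1+a+ab)\sum_T R^{\binom{t_1+1}{2}+\binom{t_2}{2}}F(T),$$ $$S^3_{3N+1}(a,b,c,d,e,f)=S^3_{3N}(a,b,c,d,e,f)+a(abc)^N S^3_{3N}(d,e,f,a,b,c),$$ and $DS^3_{3N+\mu}=(R;R)_N\,S^3_{3N+\mu}$ for $\mu\in\{0,1,2\}$.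
   Context: $\mathcal{S}^3$ is the set of 3-strict partitions: partitions in which for no $l\ge0$ do $3l+1$ and $3l+2$ both appear, and no part $\not\equiv0\pmod3$ is repeated. $\mathcal{DS}^3$ is the set of 3-strict partitions into distinct parts. $\mathcal{F}_{N,\infty}$ denotes the subset of $\mathcal{F}$ of partitions with largest part $\le N$ (empty partition included). The weight $\omega^3_\pi(a,b,c,d,e,f)$ is the product of labels when cells of each odd-indexed row of the Ferrers diagram of $\pi$ (top row indexed 1) are labelled left to right cyclically $a,b,c$ and cells of each even-indexed row cyclically $d,e,f$. $(x;q)_n=\prod_{i=1}^n(1-xq^{i-1})$, $(x;q)_0=1$. -}

module Defs where

open import Data.Nat as ℕ using (ℕ; zero; suc; _+_; _*_; _∸_; _≡ᵇ_; _≤ᵇ_; _%_)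
open import Data.Nat.DivMod using (_mod_)
open import Data.Nat.Combinatorics using (_C_)
open import Data.Integer as ℤ using (ℤ; +_)
open import Data.Fin as Fin using (Fin; _↑ˡ_; _↑ʳ_; toℕ)
open import Data.Nat.ListAction as LA using ()
open import Data.Bool using (Bool; true; false; _∧_; _∨_; not; if_then_else_)
open import Data.List as List using (List; []; _∷_; _++_; upTo; concatMap)
open import Data.Vec as Vec using (Vec; []; _∷_)

count : {A : Set} → (A → Bool) → List A → ℕ
count p []       = 0
count p (x ∷ xs) = (if p x then 1 else 0) + count p xs

allL : {A : Set} → (A → Bool) → List A → Bool
allL p []       = true
allL p (x ∷ xs) = p x ∧ allL p xs

anyL : {A : Set} → (A → Bool) → List A → Bool
anyL p []       = false
anyL p (x ∷ xs) = p x ∨ anyL p xs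

below : {n : ℕ} → Vec ℕ n → List (Vec ℕ n)
below []       = [] ∷ []
below (x ∷ xs) = concatMap (λ i → List.map (i ∷_) (below xs)) (upTo (suc x))

eqVec : {n : ℕ} → Vec ℕ n → Vec ℕ n → Bool
eqVec []       []       = true
eqVec (x ∷ xs) (y ∷ ys) = (x ≡ᵇ y) ∧ eqVec xs ys

vsum : {n : ℕ} → Vec ℕ n → ℕ
vsum = Vec.foldr _ _+_ 0

-- Partitions (as weakly decreasing lists of positive parts; first entry
-- = largest part = top row of the Ferrers diagram)

-- multiplicity vector (m₁,…,m_M) of parts k+1,…,k+M ↦ decreasing list
multToParts : {M : ℕ} → ℕ → Vec ℕ M → List ℕ
multToParts k []       = []
multToParts k (x ∷ xs) = multToParts (suc k) xs ++ List.replicate x (suc k)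

partitionsUpTo : ℕ → ℕ → List (List ℕ)
partitionsUpTo M n =
  List.map (multToParts 0)
    (List.filterᵇ (λ v → vsum (Vec.zipWith _*_ (Vec.tabulate (λ i → suc (toℕ i))) v) ≡ᵇ n)
                  (below (Vec.replicate M n)))

occurs : ℕ → List ℕ → Bool
occurs p π = anyL (p ≡ᵇ_) π

mult : ℕ → List ℕ → ℕ
mult p π = count (p ≡ᵇ_) π

-- 3-strict: for no l do 3l+1 and 3l+2 both appear (parts are ≤ |π|, so
-- l ranging below |π|+1 covers all relevant l), and no part ≢ 0 (mod 3)
-- is repeated
is3Strict : List ℕ → Bool
is3Strict π =
  allL (λ l → not (occurs (3 * l + 1) π ∧ occurs (3 * l + 2) π)) (upTo (suc (LA.sum π)))
  ∧ allL (λ p → (p % 3 ≡ᵇ 0) ∨ (mult p π ≤ᵇ 1)) π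

isDistinct : List ℕ → Bool
isDistinct π = allL (λ p → mult p π ≤ᵇ 1) π

-- Weight ω³_π as an exponent vector over (a,b,c,d,e,f)

unitV : Fin 6 → Vec ℕ 6
unitV i = Vec.tabulate (λ j → if toℕ i ≡ᵇ toℕ j then 1 else 0)

vadd : {n : ℕ} → Vec ℕ n → Vec ℕ n → Vec ℕ n
vadd = Vec.zipWith _+_

-- label of the cell in position k (0-based, left to right) of an
-- odd-indexed row (a,b,c cyclically) or an even-indexed row (d,e,f)
label : (oddRow : Bool) → ℕ → Fin 6
label true  k = (k mod 3) ↑ˡ 3
label false k = 3 ↑ʳ (k mod 3)

rowWeight : Bool → ℕ → Vec ℕ 6
rowWeight o L = List.foldr (λ k w → vadd (unitV (label o k)) w) (Vec.replicate 6 0) (upTo L)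

weightFrom : Bool → List ℕ → Vec ℕ 6
weightFrom o []      = Vec.replicate 6 0
weightFrom o (L ∷ π) = vadd (rowWeight o L) (weightFrom (not o) π)

-- exponent vector of ω³_π (top row has index 1, hence odd)
weight : List ℕ → Vec ℕ 6
weight π = weightFrom true π

-- Formal power series in a,b,c,d,e,f with integer coefficients,
-- given by their coefficient function on exponent vectors.

Series : Set
Series = Vec ℕ 6 → ℤ

_⊕_ : Series → Series → Series
(f ⊕ g) e = f e ℤ.+ g e

_⊖_ : Series → Series → Series
(f ⊖ g) e = f e ℤ.- g e

_⊛_ : Series → Series → Series
(f ⊛ g) e = List.foldr ℤ._+_ (+ 0)
              (List.map (λ d → f d ℤ.* g (Vec.zipWith _∸_ e d)) (below e))

infixl 6 _⊕_ _⊖_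
infixl 7 _⊛_

mono : Vec ℕ 6 → Series
mono m e = if eqVec m e then + 1 else + 0

𝟙 : Series
𝟙 = mono (Vec.replicate 6 0)

_^ˢ_ : Series → ℕ → Series
f ^ˢ zero  = 𝟙
f ^ˢ suc n = f ⊛ (f ^ˢ n)

Σˢ : {A : Set} → List A → (A → Series) → Series
Σˢ []       F = λ _ → + 0
Σˢ (x ∷ xs) F = F x ⊕ Σˢ xs F

va vb vc vd ve vf : Series
va = mono (1 ∷ 0 ∷ 0 ∷ 0 ∷ 0 ∷ 0 ∷ [])
vb = mono (0 ∷ 1 ∷ 0 ∷ 0 ∷ 0 ∷ 0 ∷ [])
vc = mono (0 ∷ 0 ∷ 1 ∷ 0 ∷ 0 ∷ 0 ∷ [])
vd = mono (0 ∷ 0 ∷ 0 ∷ 1 ∷ 0 ∷ 0 ∷ [])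
ve = mono (0 ∷ 0 ∷ 0 ∷ 0 ∷ 1 ∷ 0 ∷ [])
vf = mono (0 ∷ 0 ∷ 0 ∷ 0 ∷ 0 ∷ 1 ∷ [])

vR : Series
vR = va ⊛ vb ⊛ vc ⊛ vd ⊛ ve ⊛ vf

poch : ℕ → Series
poch zero    = 𝟙
poch (suc n) = poch n ⊛ (𝟙 ⊖ vR ^ˢ suc n)

-- geometric series 1/(1 - R^i) = Σ_{k≥0} R^{ik}: coefficient at e is the
-- number of k with e = (ik,…,ik) (any such k is ≤ the first entry of e)
geomR : ℕ → Series
geomR i e = + count (λ k → eqVec (Vec.replicate 6 (i * k)) e) (upTo (suc (Vec.head e)))

invPoch : ℕ → Series
invPoch zero    = 𝟙
invPoch (suc n) = invPoch n ⊛ geomR (suc n)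

swapHalves : Vec ℕ 6 → Vec ℕ 6
swapHalves (x₀ ∷ x₁ ∷ x₂ ∷ x₃ ∷ x₄ ∷ x₅ ∷ []) = x₃ ∷ x₄ ∷ x₅ ∷ x₀ ∷ x₁ ∷ x₂ ∷ []

subst-defabc : Series → Series
subst-defabc f e = f (swapHalves e)

-- S³_M(a,…,f) = Σ_{π ∈ 𝒮³_{M,∞}} ω³_π : coefficient at x^e counts the
-- 3-strict partitions with largest part ≤ M and weight x^e
-- (such π have size |e|)
S3 : ℕ → Series
S3 M e = + count (λ π → is3Strict π ∧ eqVec (weight π) e) (partitionsUpTo M (vsum e))

DS3 : ℕ → Series
DS3 M e = + count (λ π → is3Strict π ∧ isDistinct π ∧ eqVec (weight π) e)
                  (partitionsUpTo M (vsum e))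

FT : Vec ℕ 4 → Series
FT (t₁ ∷ t₂ ∷ t₃ ∷ t₄ ∷ []) =
  (va ⊕ va ⊛ vb) ^ˢ t₁ ⊛ (va ⊛ vb ⊛ vc ⊛ vd ⊕ va ⊛ vb ⊛ vc ⊛ vd ⊛ ve) ^ˢ t₂
  ⊛ (va ⊛ vb ⊛ vc) ^ˢ t₃
  ⊛ invPoch t₁ ⊛ invPoch t₂ ⊛ invPoch t₃ ⊛ invPoch t₄

compositions4 : ℕ → List (Vec ℕ 4)
compositions4 N = List.filterᵇ (λ T → vsum T ≡ᵇ N) (below (Vec.replicate 4 N))

t₁of t₂of : Vec ℕ 4 → ℕ
t₁of T = Vec.lookup T Fin.zero
t₂of T = Vec.lookup T (Fin.suc Fin.zero)

sum0 : ℕ → Series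
sum0 N = Σˢ (compositions4 N) (λ T → vR ^ˢ (t₁of T C 2 + t₂of T C 2) ⊛ FT T)

sum2 : ℕ → Series
sum2 N = Σˢ (compositions4 N) (λ T → vR ^ˢ (suc (t₁of T) C 2 + t₂of T C 2) ⊛ FT T)

{-# OPTIONS --safe #-}
-- Write p = abc, q = def, u = a + ab, w = d + de, so R = pq. Two equal rows of length 3j weigh R^j
-- whatever the parity of the upper one, so deleting pairs of equal parts 3j gives S = DS / (R; R)_N.
-- Let D_N = DS_{3N}(a,…,f) and D′_N = DS_{3N}(d,e,f,a,b,c). Deleting the parts 3N+1, 3N+2, 3N+3
-- expresses (D_{N+1}, D′_{N+1}) linearly through (D_N, D′_N), and eliminating D′ yields
--   D_{N+2} = (1 + p + (u + pw) R^{N+1}) D_{N+1} + (u p w R^N − p)(1 − R^{N+1}) D_N.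
-- The sum over T is the coefficient of y^N in
--   (−uy; R)_∞ (−pwy; R)_∞ / ((py; R)_∞ (y; R)_∞),
-- whose q-difference equation under y ↦ Ry is the same recurrence for (R; R)_N times that coefficient.
-- For 3N+2, the series D_N + p^N u D′_N satisfies the recurrence with u replaced by uR.
module Submission where

open import Defs
open import Level using (Level; 0ℓ)
open import Algebra.Bundles using (CommutativeRing; RawRing)
open import Algebra.Morphism.Structures using (IsRingMonomorphism)
import Algebra.Morphism.RingMonomorphism as RingMonomorphism
open import Data.Nat as ℕ using (ℕ; zero; suc; _∸_; _≡ᵇ_; _≤ᵇ_; _%_; z≤n; s≤s)
import Data.Nat.Properties as ℕₚ
import Data.Nat.DivMod as ℕ
open import Data.Nat.DivMod using (_mod_)
open import Data.Nat.Combinatorics using (_C_; nCk+nC[k+1]≡[n+1]C[k+1]; nC1≡n)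
open import Data.Nat.ListAction using (sum)
open import Data.Nat.ListAction.Properties using (sum-++)
open import Data.Integer as ℤ using (ℤ; +_; -[1+_])
import Data.Integer.Properties as ℤₚ
open import Data.Bool using (Bool; true; false; if_then_else_; _∧_; _∨_; not; T)
open import Data.Bool.Properties using (T-∧; T-∨; ∧-assoc; not-involutive)
open import Data.Fin as Fin using (Fin; zero; suc; toℕ)
open import Data.List using (List; []; _∷_; _++_; map; concatMap; applyUpTo; upTo; replicate; foldr; filterᵇ; length)
open import Data.List.Properties using (length-upTo)
open import Data.List.Membership.Propositional using (_∈_)
open import Data.List.Membership.Propositional.Properties using (∈-upTo⁺)
open import Data.List.Relation.Unary.Any using (here; there)
open import Data.Vec as Vec using (Vec; []; _∷_)
import Data.Vec.Properties as Vecₚ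
open import Data.Product using (_×_; _,_; proj₁; proj₂)
open import Data.Sum using (inj₁; inj₂)
open import Data.Empty using (⊥-elim)
open import Data.Unit using (tt)
open import Data.Maybe as Maybe using ()
open import Function using (_∘_; id; Equivalence)
open import Relation.Nullary using (¬_; contradiction)
open import Relation.Nullary.Decidable using (dec⇒maybe)
open import Relation.Binary.PropositionalEquality as ≡ using (_≡_)
import Relation.Binary.Reasoning.Setoid as SetoidReasoning

-- The obstacle is that `S3` reads its coefficient at e from a box of multiplicities bounded by |e|,
-- and this box changes with e, so no single finite sum is the series. For fixed n, however, a
-- multiplicity above n forces a degree above n, so the sum over multiplicities at most n agrees
-- with the wanted series in all degrees up to n. Row sums are therefore evaluated modulo degree
-- greater than n, and each coefficient is read off with n equal to its own degree. Whether a row is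
-- labelled a, b, c or d, e, f depends on the number of rows above it. The weight of the lower rows
-- is thus a function of the type of their first row, and every new part exchanges the two types;
-- this is why D and D′ have to be carried together.

private variable
  c ℓ a : Level
  A B : Set a

-- Polynomial identities over an arbitrary commutative ring

module IntegerSolver (K : CommutativeRing c ℓ) where
  open CommutativeRing K
  open import Algebra.Properties.Ring ring
  open import Algebra.Properties.AbelianGroup +-abelianGroup using (⁻¹-∙-comm)
  open import Algebra.Properties.Semiring.Mult.TCOptimised semiring
    using (×-homo-+; ×1-homo-*) renaming (_×_ to _×′_)
  open import Algebra.Solver.Ring.AlmostCommutativeRing
  open SetoidReasoning setoid

  -- Normalising polynomials requires coefficients with decidable equality. Series do not have it,
  -- so integers are mapped into the ring; the optimised multiple makes the images of 0 and 1 reduce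
  -- to the zero and the unit of the ring.
  fromℤ : ℤ → Carrier
  fromℤ (+ n)    = n ×′ 1#
  fromℤ -[1+ n ] = - (suc n ×′ 1#)

  fromℤ-neg : ∀ i → fromℤ (ℤ.- i) ≈ - fromℤ i
  fromℤ-neg (+ zero)  = sym -0#≈0#
  fromℤ-neg (+ suc n) = refl
  fromℤ-neg -[1+ n ]  = sym (-‿involutive _)

  fromℤ-⊖ : ∀ m n → fromℤ (m ℤ.⊖ n) ≈ m ×′ 1# - n ×′ 1#
  fromℤ-⊖ m zero = sym (trans (+-congˡ -0#≈0#) (+-identityʳ _))
  fromℤ-⊖ zero (suc n) = sym (+-identityˡ _)
  fromℤ-⊖ (suc m) (suc n) = begin
    fromℤ (suc m ℤ.⊖ suc n)            ≡⟨ ≡.cong fromℤ (ℤₚ.[1+m]⊖[1+n]≡m⊖n m n) ⟩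
    fromℤ (m ℤ.⊖ n)                    ≈⟨ fromℤ-⊖ m n ⟩
    m ×′ 1# - n ×′ 1#                  ≈⟨ +-congʳ (+-identityʳ _) ⟨
    m ×′ 1# + 0# - n ×′ 1#             ≈⟨ +-congʳ (+-congˡ (-‿inverseʳ 1#)) ⟨
    m ×′ 1# + (1# - 1#) - n ×′ 1#      ≈⟨ +-congʳ (+-assoc _ _ _) ⟨
    m ×′ 1# + 1# - 1# - n ×′ 1#        ≈⟨ +-assoc _ _ _ ⟩
    m ×′ 1# + 1# + (- 1# - n ×′ 1#)    ≈⟨ +-cong (+-comm _ _) (⁻¹-∙-comm _ _) ⟩
    1# + m ×′ 1# - (1# + n ×′ 1#)      ≈⟨ +-cong (×-homo-+ 1# 1 m) (-‿cong (×-homo-+ 1# 1 n)) ⟨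
    suc m ×′ 1# - suc n ×′ 1#          ∎

  fromℤ-+ : ∀ i j → fromℤ (i ℤ.+ j) ≈ fromℤ i + fromℤ j
  fromℤ-+ (+ m)    (+ n)    = ×-homo-+ 1# m n
  fromℤ-+ (+ m)    -[1+ n ] = fromℤ-⊖ m (suc n)
  fromℤ-+ -[1+ m ] (+ n)    = trans (fromℤ-⊖ n (suc m)) (+-comm _ _)
  fromℤ-+ -[1+ m ] -[1+ n ] = begin
    - (suc (suc (m ℕ.+ n)) ×′ 1#)      ≡⟨ ≡.cong (λ k → - (k ×′ 1#)) (≡.cong suc (ℕₚ.+-suc m n)) ⟨
    - ((suc m ℕ.+ suc n) ×′ 1#)        ≈⟨ -‿cong (×-homo-+ 1# (suc m) (suc n)) ⟩
    - (suc m ×′ 1# + suc n ×′ 1#)      ≈⟨ ⁻¹-∙-comm _ _ ⟨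
    - (suc m ×′ 1#) - suc n ×′ 1#      ∎

  fromℤ-pos-* : ∀ m j → fromℤ (+ m ℤ.* j) ≈ m ×′ 1# * fromℤ j
  fromℤ-pos-* m (+ n)    = trans (reflexive (≡.cong fromℤ (≡.sym (ℤₚ.pos-* m n)))) (×1-homo-* m n)
  fromℤ-pos-* m -[1+ n ] = begin
    fromℤ (+ m ℤ.* ℤ.- (+ suc n))      ≡⟨ ≡.cong fromℤ (ℤₚ.neg-distribʳ-* (+ m) (+ suc n)) ⟨
    fromℤ (ℤ.- (+ m ℤ.* + suc n))      ≈⟨ fromℤ-neg (+ m ℤ.* + suc n) ⟩
    - fromℤ (+ m ℤ.* + suc n)          ≈⟨ -‿cong (fromℤ-pos-* m (+ suc n)) ⟩
    - (m ×′ 1# * suc n ×′ 1#)          ≈⟨ -‿distribʳ-* _ _ ⟩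
    m ×′ 1# * - (suc n ×′ 1#)          ∎

  fromℤ-* : ∀ i j → fromℤ (i ℤ.* j) ≈ fromℤ i * fromℤ j
  fromℤ-* (+ m)    j = fromℤ-pos-* m j
  fromℤ-* -[1+ m ] j = begin
    fromℤ (ℤ.- (+ suc m) ℤ.* j)        ≡⟨ ≡.cong fromℤ (ℤₚ.neg-distribˡ-* (+ suc m) j) ⟨
    fromℤ (ℤ.- (+ suc m ℤ.* j))        ≈⟨ fromℤ-neg (+ suc m ℤ.* j) ⟩
    - fromℤ (+ suc m ℤ.* j)            ≈⟨ -‿cong (fromℤ-pos-* (suc m) j) ⟩
    - (suc m ×′ 1# * fromℤ j)          ≈⟨ -‿distribˡ-* _ _ ⟩
    - (suc m ×′ 1#) * fromℤ j          ∎

  homomorphism : ℤ.+-*-rawRing -Raw-AlmostCommutative⟶ fromCommutativeRing K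
  homomorphism = record
    { ⟦_⟧    = fromℤ
    ; +-homo = fromℤ-+
    ; *-homo = fromℤ-*
    ; -‿homo = fromℤ-neg
    ; 0-homo = refl
    ; 1-homo = refl
    }

  open import Algebra.Solver.Ring ℤ.+-*-rawRing (fromCommutativeRing K) homomorphism
    (λ i j → Maybe.map (reflexive ∘ ≡.cong fromℤ) (dec⇒maybe (i ℤ.≟ j))) public
    using (solve; _:=_; _:+_; _:*_; _:-_; :-_; con)

-- Sums and power series

module Sums (K : CommutativeRing c ℓ) where
  open CommutativeRing K
  open import Algebra.Properties.CommutativeSemigroup +-commutativeSemigroup using (interchange)
  open SetoidReasoning setoid

  sumL : List A → (A → Carrier) → Carrier
  sumL []       F = 0#
  sumL (x ∷ xs) F = F x + sumL xs F

  Σ< : ℕ → (ℕ → Carrier) → Carrier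
  Σ< zero    f = 0#
  Σ< (suc n) f = f 0 + Σ< n (f ∘ suc)

  sumL-cong : ∀ (xs : List A) {F G} → (∀ x → F x ≈ G x) → sumL xs F ≈ sumL xs G
  sumL-cong []       e = refl
  sumL-cong (x ∷ xs) e = +-cong (e x) (sumL-cong xs e)

  sumL-0 : ∀ (xs : List A) → sumL xs (λ _ → 0#) ≈ 0#
  sumL-0 []       = refl
  sumL-0 (x ∷ xs) = trans (+-identityˡ _) (sumL-0 xs)

  sumL-+ : ∀ (xs : List A) F G → sumL xs (λ x → F x + G x) ≈ sumL xs F + sumL xs G
  sumL-+ []       F G = sym (+-identityˡ _)
  sumL-+ (x ∷ xs) F G = trans (+-congˡ (sumL-+ xs F G)) (interchange _ _ _ _)

  sumL-*ˡ : ∀ (xs : List A) k F → sumL xs (λ x → k * F x) ≈ k * sumL xs F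
  sumL-*ˡ []       k F = sym (zeroʳ k)
  sumL-*ˡ (x ∷ xs) k F = trans (+-congˡ (sumL-*ˡ xs k F)) (sym (distribˡ _ _ _))

  sumL-++ : ∀ (xs ys : List A) F → sumL (xs ++ ys) F ≈ sumL xs F + sumL ys F
  sumL-++ []       ys F = sym (+-identityˡ _)
  sumL-++ (x ∷ xs) ys F = trans (+-congˡ (sumL-++ xs ys F)) (sym (+-assoc _ _ _))

  sumL-map : ∀ (g : A → B) xs F → sumL (map g xs) F ≈ sumL xs (F ∘ g)
  sumL-map g []       F = refl
  sumL-map g (x ∷ xs) F = +-congˡ (sumL-map g xs F)

  sumL-concatMap : ∀ (g : A → List B) xs F → sumL (concatMap g xs) F ≈ sumL xs (λ x → sumL (g x) F)
  sumL-concatMap g []       F = refl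
  sumL-concatMap g (x ∷ xs) F = trans (sumL-++ (g x) _ F) (+-congˡ (sumL-concatMap g xs F))

  sumL-applyUpTo : ∀ (g : ℕ → A) n F → sumL (applyUpTo g n) F ≈ Σ< n (F ∘ g)
  sumL-applyUpTo g zero    F = refl
  sumL-applyUpTo g (suc n) F = +-congˡ (sumL-applyUpTo (g ∘ suc) n F)

  sumL-below : ∀ {n} x (xs : Vec ℕ n) F →
    sumL (below (x ∷ xs)) F ≈ Σ< (suc x) (λ i → sumL (below xs) (λ v → F (i ∷ v)))
  sumL-below x xs F = begin
    sumL (below (x ∷ xs)) F
      ≈⟨ sumL-concatMap (λ i → map (i ∷_) (below xs)) (upTo (suc x)) F ⟩
    sumL (upTo (suc x)) (λ i → sumL (map (i ∷_) (below xs)) F)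
      ≈⟨ sumL-cong (upTo (suc x)) (λ i → sumL-map (i ∷_) (below xs) F) ⟩
    sumL (upTo (suc x)) (λ i → sumL (below xs) (λ v → F (i ∷ v)))   ≈⟨ sumL-applyUpTo (λ i → i) (suc x) _ ⟩
    Σ< (suc x) (λ i → sumL (below xs) (λ v → F (i ∷ v)))            ∎

  Σ<-cong : ∀ n {f g} → (∀ i → f i ≈ g i) → Σ< n f ≈ Σ< n g
  Σ<-cong zero    e = refl
  Σ<-cong (suc n) e = +-cong (e 0) (Σ<-cong n (e ∘ suc))

  Σ<-cong-< : ∀ n {f g} → (∀ i → i ℕ.< n → f i ≈ g i) → Σ< n f ≈ Σ< n g
  Σ<-cong-< zero    e = refl
  Σ<-cong-< (suc n) e = +-cong (e 0 ℕ.z<s) (Σ<-cong-< n (λ i i<n → e (suc i) (ℕ.s<s i<n)))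

  Σ<-0 : ∀ n {f} → (∀ i → f i ≈ 0#) → Σ< n f ≈ 0#
  Σ<-0 zero    e = refl
  Σ<-0 (suc n) e = trans (+-cong (e 0) (Σ<-0 n (e ∘ suc))) (+-identityˡ _)

  Σ<-+ : ∀ n f g → Σ< n (λ i → f i + g i) ≈ Σ< n f + Σ< n g
  Σ<-+ zero    f g = sym (+-identityˡ _)
  Σ<-+ (suc n) f g = trans (+-congˡ (Σ<-+ n (f ∘ suc) (g ∘ suc))) (interchange _ _ _ _)

  Σ<-*ˡ : ∀ n k f → Σ< n (λ i → k * f i) ≈ k * Σ< n f
  Σ<-*ˡ zero    k f = sym (zeroʳ k)
  Σ<-*ˡ (suc n) k f = trans (+-congˡ (Σ<-*ˡ n k (f ∘ suc))) (sym (distribˡ _ _ _))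

  Σ<-sumL : ∀ n (xs : List A) (F : ℕ → A → Carrier) →
    Σ< n (λ i → sumL xs (F i)) ≈ sumL xs (λ x → Σ< n (λ i → F i x))
  Σ<-sumL zero    xs F = sym (sumL-0 xs)
  Σ<-sumL (suc n) xs F = trans (+-congˡ (Σ<-sumL n xs (F ∘ suc))) (sym (sumL-+ xs (F 0) _))

  Σ<-extend : ∀ {m n} f → m ℕ.≤ n → (∀ i → m ℕ.≤ i → f i ≈ 0#) → Σ< m f ≈ Σ< n f
  Σ<-extend {n = n} f ℕ.z≤n       e = sym (Σ<-0 n (λ i → e i ℕ.z≤n))
  Σ<-extend         f (ℕ.s≤s m≤n) e = +-congˡ (Σ<-extend (f ∘ suc) m≤n (λ i m≤i → e (suc i) (ℕ.s≤s m≤i)))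

  sumL-filterᵇ : ∀ {A : Set a} (q : A → Bool) xs F → sumL (filterᵇ q xs) F ≈ sumL xs (λ x → if q x then F x else 0#)
  sumL-filterᵇ q []       F = refl
  sumL-filterᵇ q (x ∷ xs) F with q x
  ... | true  = +-congˡ (sumL-filterᵇ q xs F)
  ... | false = trans (sumL-filterᵇ q xs F) (sym (+-identityˡ _))

  -- Multiplicities range over 0, ..., n. For n = 0 the index 1 falls outside this range, so its
  -- term has to be zero for another reason, such as a degree beyond the truncation bound.
  Σ<-two : ∀ n f → (∀ x → f (2 ℕ.+ x) ≈ 0#) → (n ≡ 0 → f 1 ≈ 0#) → Σ< (suc n) f ≈ f 0 + f 1
  Σ<-two zero    f f₂₊≈0 f₁≈0 = +-congˡ (sym (f₁≈0 ≡.refl))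
  Σ<-two (suc n) f f₂₊≈0 f₁≈0 = +-congˡ (trans (+-congˡ (Σ<-0 n f₂₊≈0)) (+-identityʳ _))

module PowerSeries (K : CommutativeRing c ℓ) where
  open CommutativeRing K
  open Sums K
  open SetoidReasoning setoid
  open import Algebra.Properties.CommutativeSemigroup +-commutativeSemigroup using (interchange; x∙yz≈y∙xz)

  conv : (ℕ → Carrier) → (ℕ → Carrier) → ℕ → Carrier
  conv f g n = Σ< (suc n) (λ i → f i * g (n ∸ i))

  δ : ℕ → Carrier
  δ zero    = 1#
  δ (suc _) = 0#

  conv-cong : ∀ {f f′ g g′} → (∀ n → f n ≈ f′ n) → (∀ n → g n ≈ g′ n) → ∀ n → conv f g n ≈ conv f′ g′ n
  conv-cong e e′ n = Σ<-cong (suc n) (λ i → *-cong (e i) (e′ (n ∸ i)))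

  conv-zeroˡ : ∀ {f} g → (∀ n → f n ≈ 0#) → ∀ n → conv f g n ≈ 0#
  conv-zeroˡ g e n = Σ<-0 (suc n) (λ i → trans (*-congʳ (e i)) (zeroˡ (g (n ∸ i))))

  conv-identityˡ : ∀ g n → conv δ g n ≈ g n
  conv-identityˡ g zero    = trans (+-identityʳ _) (*-identityˡ _)
  conv-identityˡ g (suc n) = begin
    1# * g (suc n) + conv (δ ∘ suc) g n ≈⟨ +-cong (*-identityˡ _) (conv-zeroˡ g (λ _ → refl) n) ⟩
    g (suc n) + 0#                      ≈⟨ +-identityʳ _ ⟩
    g (suc n)                           ∎

  conv-distribʳ : ∀ h f g n → conv (λ i → f i + g i) h n ≈ conv f h n + conv g h n
  conv-distribʳ h f g n = trans
    (Σ<-cong (suc n) (λ i → distribʳ (h (n ∸ i)) (f i) (g i)))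
    (Σ<-+ (suc n) (λ i → f i * h (n ∸ i)) (λ i → g i * h (n ∸ i)))

  conv-scaleˡ : ∀ k f g n → conv (λ i → k * f i) g n ≈ k * conv f g n
  conv-scaleˡ k f g n = trans
    (Σ<-cong (suc n) (λ i → *-assoc k (f i) (g (n ∸ i))))
    (Σ<-*ˡ (suc n) k (λ i → f i * g (n ∸ i)))

  -- The mirror image of the defining recursion: the last summand is split off instead of the first.
  -- Comparing the two gives commutativity.
  conv-sucʳ : ∀ f g n → conv f g (suc n) ≈ f (suc n) * g 0 + conv f (g ∘ suc) n
  conv-sucʳ f g zero    = x∙yz≈y∙xz _ _ _
  conv-sucʳ f g (suc n) = begin
    f 0 * g (2 ℕ.+ n) + conv (f ∘ suc) g (suc n)
      ≈⟨ +-congˡ (conv-sucʳ (f ∘ suc) g n) ⟩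
    f 0 * g (2 ℕ.+ n) + (f (2 ℕ.+ n) * g 0 + conv (f ∘ suc) (g ∘ suc) n)     ≈⟨ x∙yz≈y∙xz _ _ _ ⟩
    f (2 ℕ.+ n) * g 0 + conv f (g ∘ suc) (suc n)                             ∎

  conv-comm : ∀ f g n → conv f g n ≈ conv g f n
  conv-comm f g zero    = +-congʳ (*-comm _ _)
  conv-comm f g (suc n) = begin
    f 0 * g (suc n) + conv (f ∘ suc) g n ≈⟨ +-cong (*-comm _ _) (conv-comm (f ∘ suc) g n) ⟩
    g (suc n) * f 0 + conv g (f ∘ suc) n ≈⟨ conv-sucʳ g f n ⟨
    conv g f (suc n)                     ∎

  conv-assoc : ∀ f g h n → conv (conv f g) h n ≈ conv f (conv g h) n
  conv-assoc f g h zero    = +-congʳ (begin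
    (f 0 * g 0 + 0#) * h 0               ≈⟨ *-congʳ (+-identityʳ _) ⟩
    f 0 * g 0 * h 0                      ≈⟨ *-assoc _ _ _ ⟩
    f 0 * (g 0 * h 0)                    ≈⟨ *-congˡ (+-identityʳ _) ⟨
    f 0 * (g 0 * h 0 + 0#)               ∎)
  conv-assoc f g h (suc n) = begin
    (f 0 * g 0 + 0#) * h (suc n) + conv (λ i → f 0 * g (suc i) + conv (f ∘ suc) g i) h n
      ≈⟨ +-cong (*-congʳ (+-identityʳ _)) (conv-distribʳ h (λ i → f 0 * g (suc i)) (conv (f ∘ suc) g) n) ⟩
    f 0 * g 0 * h (suc n) + (conv (λ i → f 0 * g (suc i)) h n + conv (conv (f ∘ suc) g) h n)
      ≈⟨ +-cong (*-assoc _ _ _) (+-cong (conv-scaleˡ (f 0) (g ∘ suc) h n) (conv-assoc (f ∘ suc) g h n)) ⟩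
    f 0 * (g 0 * h (suc n)) + (f 0 * conv (g ∘ suc) h n + conv (f ∘ suc) (conv g h) n)
      ≈⟨ +-assoc _ _ _ ⟨
    f 0 * (g 0 * h (suc n)) + f 0 * conv (g ∘ suc) h n + conv (f ∘ suc) (conv g h) n
      ≈⟨ +-congʳ (distribˡ _ _ _) ⟨
    f 0 * conv g h (suc n) + conv (f ∘ suc) (conv g h) n ∎

  -- The monomial with coefficient x and exponent k. In iterated power series the coefficient is
  -- itself a series in the remaining variables.
  term : ℕ → Carrier → ℕ → Carrier
  term k x i = if k ≡ᵇ i then x else 0#

  if-*ˡ : ∀ (b : Bool) x y → x * (if b then y else 0#) ≈ (if b then x * y else 0#)
  if-*ˡ true  x y = refl
  if-*ˡ false x y = zeroʳ x

  term-* : ∀ k l x y n → conv (term k x) (term l y) n ≈ term (k ℕ.+ l) (x * y) n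
  term-* zero    l x y zero    = trans (+-identityʳ _) (if-*ˡ (l ≡ᵇ 0) x y)
  term-* zero    l x y (suc n) = begin
    x * term l y (suc n) + conv (term 0 x ∘ suc) (term l y) n
      ≈⟨ +-cong (if-*ˡ (l ≡ᵇ suc n) x y) (conv-zeroˡ (term l y) (λ _ → refl) n) ⟩
    term l (x * y) (suc n) + 0#                               ≈⟨ +-identityʳ _ ⟩
    term l (x * y) (suc n)                                    ∎
  term-* (suc k) l x y zero    = trans (+-identityʳ _) (zeroˡ _)
  term-* (suc k) l x y (suc n) = begin
    0# * term l y (suc n) + conv (term k x) (term l y) n ≈⟨ +-cong (zeroˡ _) (term-* k l x y n) ⟩
    0# + term (k ℕ.+ l) (x * y) n                        ≈⟨ +-identityˡ _ ⟩
    term (k ℕ.+ l) (x * y) n                             ∎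

  powerSeriesRing : CommutativeRing c ℓ
  powerSeriesRing = record
    { Carrier = ℕ → Carrier
    ; _≈_ = λ f g → ∀ n → f n ≈ g n
    ; _+_ = λ f g n → f n + g n
    ; _*_ = conv
    ; -_  = λ f n → - f n
    ; 0#  = λ _ → 0#
    ; 1#  = δ
    ; isCommutativeRing = record
      { isRing = record
        { +-isAbelianGroup = record
          { isGroup = record
            { isMonoid = record
              { isSemigroup = record
                { isMagma = record
                  { isEquivalence = record
                    { refl  = λ n → refl
                    ; sym   = λ e n → sym (e n)
                    ; trans = λ e e′ n → trans (e n) (e′ n)
                    }
                  ; ∙-cong = λ e e′ n → +-cong (e n) (e′ n)
                  }
                ; assoc = λ f g h n → +-assoc _ _ _
                }
              ; identity = (λ f n → +-identityˡ _) , (λ f n → +-identityʳ _)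
              }
            ; inverse = (λ f n → -‿inverseˡ _) , (λ f n → -‿inverseʳ _)
            ; ⁻¹-cong = λ e n → -‿cong (e n)
            }
          ; comm = λ f g n → +-comm _ _
          }
        ; *-cong = λ e e′ → conv-cong e e′
        ; *-assoc = conv-assoc
        ; *-identity = conv-identityˡ , λ g n → trans (conv-comm g δ n) (conv-identityˡ g n)
        ; distrib = (λ f g h n → trans (conv-comm f (λ i → g i + h i) n)
                       (trans (conv-distribʳ f g h n) (+-cong (conv-comm g f n) (conv-comm h f n))))
                  , conv-distribʳ
        }
      ; *-comm = conv-comm
      }
    }

-- Series in several variables

-- Taken one variable at a time, the ring laws come from one-variable power series; `curryV` then
-- transports them to series indexed by exponent vectors.
multiRing : ℕ → CommutativeRing 0ℓ 0ℓ
multiRing zero    = ℤₚ.+-*-commutativeRing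
multiRing (suc n) = PowerSeries.powerSeriesRing (multiRing n)

private
  module Multi n = CommutativeRing (multiRing n)
  module MultiSums n = Sums (multiRing n)
module ℤSums = Sums ℤₚ.+-*-commutativeRing

curryV : ∀ n → (Vec ℕ n → ℤ) → Multi.Carrier n
curryV zero    f   = f []
curryV (suc n) f i = curryV n (λ v → f (i ∷ v))

curryV-cong : ∀ n {f g} → (∀ v → f v ≡ g v) → Multi._≈_ n (curryV n f) (curryV n g)
curryV-cong zero    e   = e []
curryV-cong (suc n) e i = curryV-cong n (λ v → e (i ∷ v))

curryV-injective : ∀ n {f g} → Multi._≈_ n (curryV n f) (curryV n g) → ∀ v → f v ≡ g v
curryV-injective zero    e []      = e
curryV-injective (suc n) e (i ∷ v) = curryV-injective n (e i) v

curryV-+ : ∀ n f g → Multi._≈_ n (curryV n (λ v → f v ℤ.+ g v)) (Multi._+_ n (curryV n f) (curryV n g))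
curryV-+ zero    f g   = ≡.refl
curryV-+ (suc n) f g i = curryV-+ n (λ v → f (i ∷ v)) (λ v → g (i ∷ v))

curryV-neg : ∀ n f → Multi._≈_ n (curryV n (λ v → ℤ.- f v)) (Multi.-_ n (curryV n f))
curryV-neg zero    f   = ≡.refl
curryV-neg (suc n) f i = curryV-neg n (λ v → f (i ∷ v))

curryV-0 : ∀ n → Multi._≈_ n (curryV n (λ _ → + 0)) (Multi.0# n)
curryV-0 zero      = ≡.refl
curryV-0 (suc n) i = curryV-0 n

curryV-Σ< : ∀ n m F → Multi._≈_ n (curryV n (λ v → ℤSums.Σ< m (λ j → F j v))) (MultiSums.Σ< n m (curryV n ∘ F))
curryV-Σ< n zero    F = curryV-0 n
curryV-Σ< n (suc m) F = Multi.trans n (curryV-+ n (F 0) _) (Multi.+-congˡ n (curryV-Σ< n m (F ∘ suc)))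

-- The product `_⊛_` for any number of variables, which allows induction on that number; six
-- variables give `_⊛_` back by definition.
mulV : ∀ {n} → (Vec ℕ n → ℤ) → (Vec ℕ n → ℤ) → Vec ℕ n → ℤ
mulV f g e = foldr ℤ._+_ (+ 0) (map (λ d → f d ℤ.* g (Vec.zipWith _∸_ e d)) (below e))

foldr-map≡sumL : ∀ {A : Set} (F : A → ℤ) xs → foldr ℤ._+_ (+ 0) (map F xs) ≡ ℤSums.sumL xs F
foldr-map≡sumL F []       = ≡.refl
foldr-map≡sumL F (x ∷ xs) = ≡.cong (λ s → F x ℤ.+ s) (foldr-map≡sumL F xs)

mulV-∷ : ∀ {n} (f g : Vec ℕ (suc n) → ℤ) i v →
  mulV f g (i ∷ v) ≡ ℤSums.Σ< (suc i) (λ j → mulV (λ w → f (j ∷ w)) (λ w → g (i ∸ j ∷ w)) v)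
mulV-∷ f g i v = begin
  mulV f g (i ∷ v)                                           ≡⟨ foldr-map≡sumL F (below (i ∷ v)) ⟩
  ℤSums.sumL (below (i ∷ v)) F                                     ≡⟨ ℤSums.sumL-below i v F ⟩
  ℤSums.Σ< (suc i) (λ j → ℤSums.sumL (below v) (λ w → F (j ∷ w)))
    ≡⟨ ℤSums.Σ<-cong-< (suc i) (λ j _ → ≡.sym (foldr-map≡sumL (λ w → F (j ∷ w)) (below v))) ⟩
  ℤSums.Σ< (suc i) (λ j → mulV (λ w → f (j ∷ w)) (λ w → g (i ∸ j ∷ w)) v) ∎
  where
  open ≡.≡-Reasoning
  F = λ d → f d ℤ.* g (Vec.zipWith _∸_ (i ∷ v) d)

curryV-* : ∀ n f g → Multi._≈_ n (curryV n (mulV f g)) (Multi._*_ n (curryV n f) (curryV n g))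
curryV-* zero    f g   = ℤₚ.+-identityʳ _
curryV-* (suc n) f g i = begin
  curryV n (λ v → mulV f g (i ∷ v))                        ≈⟨ curryV-cong n (mulV-∷ f g i) ⟩
  curryV n (λ v → ℤSums.Σ< (suc i) (λ j → mulV (λ w → f (j ∷ w)) (λ w → g (i ∸ j ∷ w)) v))
    ≈⟨ curryV-Σ< n (suc i) (λ j → mulV (λ w → f (j ∷ w)) (λ w → g (i ∸ j ∷ w))) ⟩
  MultiSums.Σ< n (suc i) (λ j → curryV n (mulV (λ w → f (j ∷ w)) (λ w → g (i ∸ j ∷ w))))
    ≈⟨ MultiSums.Σ<-cong n (suc i) (λ j → curryV-* n (λ w → f (j ∷ w)) (λ w → g (i ∸ j ∷ w))) ⟩
  Multi._*_ (suc n) (curryV (suc n) f) (curryV (suc n) g) i ∎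
  where open SetoidReasoning (Multi.setoid n)

monoV : ∀ {n} → Vec ℕ n → Vec ℕ n → ℤ
monoV m e = if eqVec m e then + 1 else + 0

curryV-mono-∷ : ∀ n x m i → Multi._≈_ n (curryV (suc n) (monoV (x ∷ m)) i)
  (PowerSeries.term (multiRing n) x (curryV n (monoV m)) i)
curryV-mono-∷ n x m i with x ≡ᵇ i
... | true  = Multi.refl n
... | false = curryV-0 n

monoV-+ : ∀ {n} (m m′ : Vec ℕ n) e → mulV (monoV m) (monoV m′) e ≡ monoV (vadd m m′) e
monoV-+ {n} m m′ = curryV-injective n (Multi.trans n (curryV-* n (monoV m) (monoV m′)) (curried m m′))
  where
  curried : ∀ {n} (m m′ : Vec ℕ n) →
    Multi._≈_ n (Multi._*_ n (curryV n (monoV m)) (curryV n (monoV m′))) (curryV n (monoV (vadd m m′)))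
  curried []      []        = ≡.refl
  curried {suc n} (x ∷ m) (y ∷ m′) i = begin
    PS._*_ (curryV (suc n) (monoV (x ∷ m))) (curryV (suc n) (monoV (y ∷ m′))) i
      ≈⟨ PS.*-cong {curryV (suc n) (monoV (x ∷ m))} {term x (curryV n (monoV m))} (curryV-mono-∷ n x m) (curryV-mono-∷ n y m′) i ⟩
    PS._*_ (term x (curryV n (monoV m))) (term y (curryV n (monoV m′))) i
      ≈⟨ term-* x y _ _ i ⟩
    term (x ℕ.+ y) (Multi._*_ n (curryV n (monoV m)) (curryV n (monoV m′))) i
      ≈⟨ term-cong (x ℕ.+ y) i (curried m m′) ⟩
    term (x ℕ.+ y) (curryV n (monoV (vadd m m′))) i
      ≈⟨ curryV-mono-∷ n (x ℕ.+ y) (vadd m m′) i ⟨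
    curryV (suc n) (monoV (vadd (x ∷ m) (y ∷ m′))) i ∎
    where
    open PowerSeries (multiRing n) using (term; term-*)
    module PS = Multi (suc n)
    open SetoidReasoning (Multi.setoid n)
    term-cong : ∀ k i {y y′} → Multi._≈_ n y y′ → Multi._≈_ n (term k y i) (term k y′ i)
    term-cong k i e with k ≡ᵇ i
    ... | true  = e
    ... | false = Multi.refl n

curryV-1 : ∀ n → Multi._≈_ n (curryV n (monoV (Vec.replicate n 0))) (Multi.1# n)
curryV-1 zero          = ≡.refl
curryV-1 (suc n) zero    = curryV-1 n
curryV-1 (suc n) (suc i) = curryV-0 n

seriesRawRing : ℕ → RawRing 0ℓ 0ℓ
seriesRawRing n = record
  { Carrier = Vec ℕ n → ℤ
  ; _≈_ = λ f g → ∀ e → f e ≡ g e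
  ; _+_ = λ f g e → f e ℤ.+ g e
  ; _*_ = mulV
  ; -_  = λ f e → ℤ.- f e
  ; 0#  = λ _ → + 0
  ; 1#  = monoV (Vec.replicate n 0)
  }

curryV-isRingMonomorphism : ∀ n → IsRingMonomorphism (seriesRawRing n) (Multi.rawRing n) (curryV n)
curryV-isRingMonomorphism n = record
  { isRingHomomorphism = record
    { isSemiringHomomorphism = record
      { isNearSemiringHomomorphism = record
        { +-isMonoidHomomorphism = record
          { isMagmaHomomorphism = record
            { isRelHomomorphism = record { cong = curryV-cong n }
            ; homo = curryV-+ n
            }
          ; ε-homo = curryV-0 n
          }
        ; *-homo = curryV-* n
        }
      ; 1#-homo = curryV-1 n
      }
    ; -‿homo = curryV-neg n
    }
  ; injective = curryV-injective n
  }

seriesRing : ℕ → CommutativeRing 0ℓ 0ℓ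
seriesRing n = record
  { isCommutativeRing =
      RingMonomorphism.isCommutativeRing (curryV-isRingMonomorphism n) (Multi.isCommutativeRing n) }

-- Series modulo high total degree

_≈[_]_ : ∀ {n} → (Vec ℕ n → ℤ) → ℕ → (Vec ℕ n → ℤ) → Set
f ≈[ D ] g = ∀ e → vsum e ℕ.≤ D → f e ≡ g e

-- Each exponent d in the convolution at e, and its complement e - d, is entrywise at most e and
-- hence of degree at most that of e. So equality up to a degree is a congruence for the product.
mulV-cong-≤ : ∀ {n} (e : Vec ℕ n) {f f′ g g′} → f ≈[ vsum e ] f′ → g ≈[ vsum e ] g′ → mulV f g e ≡ mulV f′ g′ e
mulV-cong-≤ []      f≈ g≈ = ≡.cong (λ s → s ℤ.+ (+ 0)) (≡.cong₂ ℤ._*_ (f≈ [] ℕ.z≤n) (g≈ [] ℕ.z≤n))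
mulV-cong-≤ (i ∷ v) {f} {f′} {g} {g′} f≈ g≈ = begin
  mulV f g (i ∷ v) ≡⟨ mulV-∷ f g i v ⟩
  ℤSums.Σ< (suc i) (λ j → mulV (λ w → f (j ∷ w)) (λ w → g (i ∸ j ∷ w)) v)
    ≡⟨ ℤSums.Σ<-cong-< (suc i) (λ { j (ℕ.s≤s j≤i) → mulV-cong-≤ v
         (λ w w≤ → f≈ (j ∷ w) (ℕₚ.+-mono-≤ j≤i w≤))
         (λ w w≤ → g≈ (i ∸ j ∷ w) (ℕₚ.+-mono-≤ (ℕₚ.m∸n≤m i j) w≤)) }) ⟩
  ℤSums.Σ< (suc i) (λ j → mulV (λ w → f′ (j ∷ w)) (λ w → g′ (i ∸ j ∷ w)) v)
    ≡⟨ mulV-∷ f′ g′ i v ⟨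
  mulV f′ g′ (i ∷ v) ∎
  where open ≡.≡-Reasoning

-- The quotient by the series of order greater than D, realised by a coarser equality. Carrier and
-- operations stay those of the full ring, so the same terms can be read in both rings.
truncatedRing : ℕ → ℕ → CommutativeRing 0ℓ 0ℓ
truncatedRing n D = record
  { Carrier = Vec ℕ n → ℤ
  ; _≈_ = _≈[ D ]_
  ; _+_ = S._+_
  ; _*_ = S._*_
  ; -_  = S.-_
  ; 0#  = S.0#
  ; 1#  = S.1#
  ; isCommutativeRing = record
    { isRing = record
      { +-isAbelianGroup = record
        { isGroup = record
          { isMonoid = record
            { isSemigroup = record
              { isMagma = record
                { isEquivalence = record
                  { refl  = λ e _ → ≡.refl
                  ; sym   = λ p e e≤ → ≡.sym (p e e≤)
                  ; trans = λ p q e e≤ → ≡.trans (p e e≤) (q e e≤)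
                  }
                ; ∙-cong = λ p q e e≤ → ≡.cong₂ ℤ._+_ (p e e≤) (q e e≤)
                }
              ; assoc = λ f g h e _ → S.+-assoc f g h e
              }
            ; identity = (λ f e _ → S.+-identityˡ f e) , (λ f e _ → S.+-identityʳ f e)
            }
          ; inverse = (λ f e _ → S.-‿inverseˡ f e) , (λ f e _ → S.-‿inverseʳ f e)
          ; ⁻¹-cong = λ p e e≤ → ≡.cong ℤ.-_ (p e e≤)
          }
        ; comm = λ f g e _ → S.+-comm f g e
        }
      ; *-cong = λ p q e e≤ → mulV-cong-≤ e (λ d d≤ → p d (ℕₚ.≤-trans d≤ e≤)) (λ d d≤ → q d (ℕₚ.≤-trans d≤ e≤))
      ; *-assoc = λ f g h e _ → S.*-assoc f g h e
      ; *-identity = (λ f e _ → S.*-identityˡ f e) , (λ f e _ → S.*-identityʳ f e)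
      ; distrib = (λ f g h e _ → S.distribˡ f g h e) , (λ f g h e _ → S.distribʳ f g h e)
      }
    ; *-comm = λ f g e _ → S.*-comm f g e
    }
  }
  where module S = CommutativeRing (seriesRing n)

eqVec⇒≡ : ∀ {n} (m e : Vec ℕ n) → T (eqVec m e) → m ≡ e
eqVec⇒≡ []      []      _ = ≡.refl
eqVec⇒≡ (x ∷ m) (y ∷ e) t with x ≡ᵇ y in x≡ᵇy
... | true = ≡.cong₂ _∷_ (ℕₚ.≡ᵇ⇒≡ x y (≡.subst T (≡.sym x≡ᵇy) _)) (eqVec⇒≡ m e t)

monoV-large : ∀ {n} (m : Vec ℕ n) {D} → D ℕ.< vsum m → monoV m ≈[ D ] (λ _ → + 0)
monoV-large m D< e e≤ with eqVec m e in eq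
... | false = ≡.refl
... | true with eqVec⇒≡ m e (≡.subst T (≡.sym eq) _)
... | ≡.refl = ⊥-elim (ℕₚ.<⇒≱ D< e≤)

-- The sum side

module Relations (L : CommutativeRing c ℓ) where
  open CommutativeRing L
  open IntegerSolver L
  open SetoidReasoning setoid

  -- Multiplying α = (1 + uy)α′ and β = (1 + vy)β′ with (1 - zy)γ = γ′ and (1 - y)ε = ε′ gives (1 -
  -- y)(1 - zy)π = (1 + uy)(1 + vy)π′; the negative terms are then moved across. Powers of y are
  -- nested so that each factor y acts as one shift of coefficients.
  product-equation : ∀ {y u v z α α′ β β′ γ γ′ ε ε′} →
    α ≈ α′ + u * (y * α′) → β ≈ β′ + v * (y * β′) → γ ≈ γ′ + z * (y * γ) → ε ≈ ε′ + y * ε →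
    let π = α * (β * (γ * ε)); π′ = α′ * (β′ * (γ′ * ε′)) in
    π + z * (y * (y * π)) ≈ y * π + z * (y * π) + (π′ + u * (y * π′) + v * (y * π′) + u * (v * (y * (y * π′))))
  product-equation {y} {u} {v} {z} {α} {α′} {β} {β′} {γ} {γ′} {ε} {ε′} hα hβ hγ hε = begin
    α * (β * (γ * ε)) + z * (y * (y * (α * (β * (γ * ε)))))
      ≈⟨ solve 6 (λ y z α β γ ε → α :* (β :* (γ :* ε)) :+ z :* (y :* (y :* (α :* (β :* (γ :* ε)))))
           := y :* (α :* (β :* (γ :* ε))) :+ z :* (y :* (α :* (β :* (γ :* ε))))
              :+ α :* β :* (γ :- z :* (y :* γ)) :* (ε :- y :* ε)) refl y z α β γ ε ⟩
    y * π + z * (y * π) + α * β * (γ - z * (y * γ)) * (ε - y * ε)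
      ≈⟨ +-congˡ (*-cong (*-cong (*-cong hα hβ) (shift hγ)) (shift hε)) ⟩
    y * π + z * (y * π) + (α′ + u * (y * α′)) * (β′ + v * (y * β′)) * γ′ * ε′
      ≈⟨ +-congˡ (solve 7 (λ y u v α β γ ε → (α :+ u :* (y :* α)) :* (β :+ v :* (y :* β)) :* γ :* ε
           := let π = α :* (β :* (γ :* ε)) in π :+ u :* (y :* π) :+ v :* (y :* π) :+ u :* (v :* (y :* (y :* π))))
           refl y u v α′ β′ γ′ ε′) ⟩
    _ ∎
    where
    π = α * (β * (γ * ε))
    shift : ∀ {f g h} → f ≈ g + h → f - h ≈ g
    shift {f} {g} {h} e = trans (+-congʳ e) (solve 2 (λ g h → g :+ h :- h := g) refl g h)

module QSeries (K : CommutativeRing c ℓ) (R : CommutativeRing.Carrier K) where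
  open CommutativeRing K
  open Sums K
  open PowerSeries K
  open IntegerSolver K
  open import Algebra.Properties.Semiring.Exp semiring
  open SetoidReasoning setoid
  private module P = CommutativeRing powerSeriesRing

  -- The substitution y ↦ Ry on coefficient sequences.
  σ : (ℕ → Carrier) → ℕ → Carrier
  σ f n = R ^ n * f n

  σ-conv : ∀ f g n → conv (σ f) (σ g) n ≈ σ (conv f g) n
  σ-conv f g zero = solve 2 (λ f g → (con (+ 1) :* f) :* (con (+ 1) :* g) :+ con (+ 0) := con (+ 1) :* (f :* g :+ con (+ 0))) refl (f 0) (g 0)
  σ-conv f g (suc n) = begin
    1# * f 0 * (R ^ suc n * g (suc n)) + conv (σ f ∘ suc) (σ g) n
      ≈⟨ +-congˡ (conv-cong {g = σ g} (λ i → *-assoc R (R ^ i) (f (suc i))) (λ _ → refl) n) ⟩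
    1# * f 0 * (R ^ suc n * g (suc n)) + conv (λ i → R * σ (f ∘ suc) i) (σ g) n
      ≈⟨ +-congˡ (trans (conv-scaleˡ R (σ (f ∘ suc)) (σ g) n) (*-congˡ (σ-conv (f ∘ suc) g n))) ⟩
    1# * f 0 * (R * R ^ n * g (suc n)) + R * (R ^ n * conv (f ∘ suc) g n)
      ≈⟨ solve 5 (λ f g R r s → con (+ 1) :* f :* (R :* r :* g) :+ R :* (r :* s) := R :* r :* (f :* g :+ s))
           refl (f 0) (g (suc n)) R (R ^ n) (conv (f ∘ suc) g n) ⟩
    R ^ suc n * conv f g (suc n) ∎

  conv-const : ∀ k f n → conv (term 0 k) f n ≈ k * f n
  conv-const k f zero    = +-identityʳ _
  conv-const k f (suc n) = trans (+-congˡ (conv-zeroˡ f (λ _ → refl) n)) (+-identityʳ _)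

  y : ℕ → Carrier
  y = term 1 1#

  conv-y-zero : ∀ f → conv y f 0 ≈ 0#
  conv-y-zero f = trans (+-identityʳ _) (zeroˡ _)

  conv-y-suc : ∀ f n → conv y f (suc n) ≈ f n
  conv-y-suc f n = begin
    0# * f (suc n) + conv (term 0 1#) f n ≈⟨ +-cong (zeroˡ _) (conv-const 1# f n) ⟩
    0# + 1# * f n                         ≈⟨ trans (+-identityˡ _) (*-identityˡ _) ⟩
    f n                                   ∎

  module Pochhammer (poch inv : ℕ → Carrier)
           (poch-zero : poch 0 ≈ 1#) (poch-suc : ∀ n → poch (suc n) ≈ poch n * (1# - R ^ suc n))
           (inv-zero : inv 0 ≈ 1#) (inv-suc : ∀ n → inv (suc n) ≈ R ^ suc n * inv (suc n) + inv n) where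

    inv-poch : ∀ n → inv n * poch n ≈ 1#
    inv-poch zero    = trans (*-cong inv-zero poch-zero) (*-identityˡ _)
    inv-poch (suc n) = begin
      inv (suc n) * poch (suc n)                              ≈⟨ *-congˡ (poch-suc n) ⟩
      inv (suc n) * (poch n * (1# - R ^ suc n))
        ≈⟨ solve 3 (λ i p r → i :* (p :* (con (+ 1) :- r)) := (i :- r :* i) :* p) refl _ _ _ ⟩
      (inv (suc n) - R ^ suc n * inv (suc n)) * poch n        ≈⟨ *-congʳ (+-congʳ (inv-suc n)) ⟩
      (R ^ suc n * inv (suc n) + inv n - R ^ suc n * inv (suc n)) * poch n
        ≈⟨ solve 3 (λ a b p → (a :+ b :- a) :* p := b :* p) refl _ _ _ ⟩
      inv n * poch n                                          ≈⟨ inv-poch n ⟩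
      1#                                                      ∎

    -- The coefficients of (−xy; R)_∞ and of 1/(xy; R)_∞ in y.
    numer denom : Carrier → ℕ → Carrier
    numer x n = R ^ (n C 2) * (x ^ n * inv n)
    denom x n = x ^ n * inv n

    -- Coefficientwise form of (1 - xy) f(y) = f(Ry) for f(y) = 1/(xy; R)_∞: the factor 1 - xy
    -- cancels the first factor of the denominator.
    denom-equation : ∀ x n → denom x n ≈ σ (denom x) n + x * conv y (denom x) n
    denom-equation x zero = sym (trans (+-cong (*-identityˡ _) (trans (*-congˡ (conv-y-zero (denom x))) (zeroʳ _))) (+-identityʳ _))
    denom-equation x (suc n) = begin
      x * x ^ n * inv (suc n)                                     ≈⟨ *-congˡ (inv-suc n) ⟩
      x * x ^ n * (R ^ suc n * inv (suc n) + inv n)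
        ≈⟨ solve 5 (λ x xn r i j → x :* xn :* (r :* i :+ j) := r :* (x :* xn :* i) :+ x :* (xn :* j)) refl _ _ _ _ _ ⟩
      R ^ suc n * (x * x ^ n * inv (suc n)) + x * (x ^ n * inv n)
        ≈⟨ +-congˡ (*-congˡ (conv-y-suc (denom x) n)) ⟨
      σ (denom x) (suc n) + x * conv y (denom x) (suc n)          ∎

    R^[1+n]C2 : ∀ n → R ^ (suc n C 2) ≈ R ^ n * R ^ (n C 2)
    R^[1+n]C2 n = begin
      R ^ (suc n C 2)         ≡⟨ ≡.cong (R ^_) (nCk+nC[k+1]≡[n+1]C[k+1] n 1) ⟨
      R ^ (n C 1 ℕ.+ n C 2)   ≡⟨ ≡.cong (λ k → R ^ (k ℕ.+ n C 2)) (nC1≡n n) ⟩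
      R ^ (n ℕ.+ n C 2)       ≈⟨ ^-homo-* R n (n C 2) ⟩
      R ^ n * R ^ (n C 2)     ∎

    -- Splitting the first factor off the product, (-xy; R)_∞ = (1 + xy)(-xRy; R)_∞, leaves the
    -- shifted series in both terms. On coefficients this is n + C(n, 2) = C(n + 1, 2).
    numer-equation : ∀ x n → numer x n ≈ σ (numer x) n + x * conv y (σ (numer x)) n
    numer-equation x zero = sym (trans (+-cong (*-identityˡ _) (trans (*-congˡ (conv-y-zero (σ (numer x)))) (zeroʳ _))) (+-identityʳ _))
    numer-equation x (suc n) = begin
      R ^ (suc n C 2) * (x * x ^ n * inv (suc n))                 ≈⟨ *-congˡ (*-congˡ (inv-suc n)) ⟩
      R ^ (suc n C 2) * (x * x ^ n * (R ^ suc n * inv (suc n) + inv n))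
        ≈⟨ solve 6 (λ b x xn r i j → b :* (x :* xn :* (r :* i :+ j)) := r :* (b :* (x :* xn :* i)) :+ x :* (b :* (xn :* j))) refl _ _ _ _ _ _ ⟩
      R ^ suc n * (R ^ (suc n C 2) * (x * x ^ n * inv (suc n))) + x * (R ^ (suc n C 2) * (x ^ n * inv n))
        ≈⟨ +-congˡ (*-congˡ (trans (*-congʳ (R^[1+n]C2 n)) (*-assoc _ _ _))) ⟩
      σ (numer x) (suc n) + x * σ (numer x) n
        ≈⟨ +-congˡ (*-congˡ (conv-y-suc (σ (numer x)) n)) ⟨
      σ (numer x) (suc n) + x * conv y (σ (numer x)) (suc n)      ∎

    module _ (u v z : Carrier) where
      sumQ : ℕ → Carrier
      sumQ = conv (numer u) (conv (numer v) (conv (denom z) (denom 1#)))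

      σ-sumQ : ∀ n → conv (σ (numer u)) (conv (σ (numer v)) (conv (σ (denom z)) (σ (denom 1#)))) n ≈ σ sumQ n
      σ-sumQ = P.trans
        {conv (σ (numer u)) (conv (σ (numer v)) (conv (σ (denom z)) (σ (denom 1#))))}
        (P.*-congˡ {σ (numer u)} (P.trans {conv (σ (numer v)) (conv (σ (denom z)) (σ (denom 1#)))}
          (P.*-congˡ {σ (numer v)} (σ-conv (denom z) (denom 1#)))
          (σ-conv (numer v) (conv (denom z) (denom 1#)))))
        (σ-conv (numer u) (conv (numer v) (conv (denom z) (denom 1#))))

      with-const : (f g h : ℕ → Carrier) (k : Carrier) → (∀ n → f n ≈ g n + k * h n) → ∀ n → f n ≈ g n + conv (term 0 k) h n
      with-const f g h k e n = trans (e n) (+-congˡ (sym (conv-const k h n)))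

      sumQ-equation : ∀ n → let s = sumQ; s′ = σ sumQ in
        s n + z * conv y (conv y s) n ≈
        conv y s n + z * conv y s n + (s′ n + u * conv y s′ n + v * conv y s′ n + u * (v * conv y (conv y s′) n))
      sumQ-equation n = begin
        s n + z * conv y (conv y s) n
          ≈⟨ +-congˡ (conv-const z (conv y (conv y s)) n) ⟨
        s n + conv (term 0 z) (conv y (conv y s)) n
          ≈⟨ Relations.product-equation powerSeriesRing {y} {term 0 u} {term 0 v} {term 0 z}
               {numer u} {σ (numer u)} {numer v} {σ (numer v)} {denom z} {σ (denom z)} {denom 1#} {σ (denom 1#)}
               (with-const (numer u) (σ (numer u)) (conv y (σ (numer u))) u (numer-equation u))
               (with-const (numer v) (σ (numer v)) (conv y (σ (numer v))) v (numer-equation v))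
               (with-const (denom z) (σ (denom z)) (conv y (denom z)) z (denom-equation z))
               (λ m → trans (denom-equation 1# m) (+-congˡ (*-identityˡ _))) n ⟩
        conv y s n + conv (term 0 z) (conv y s) n
          + (s₁ n + conv (term 0 u) (conv y s₁) n + conv (term 0 v) (conv y s₁) n
             + conv (term 0 u) (conv (term 0 v) (conv y (conv y s₁))) n)
          ≈⟨ +-cong (+-congˡ (conv-const z (conv y s) n))
               (+-cong (+-cong (+-cong (σ-sumQ n) (trans (conv-const u (conv y s₁) n) (*-congˡ (ys₁ n))))
                               (trans (conv-const v (conv y s₁) n) (*-congˡ (ys₁ n))))
                       (trans (conv-const u (conv (term 0 v) (conv y (conv y s₁))) n)
                         (*-congˡ (trans (conv-const v (conv y (conv y s₁)) n)
                           (*-congˡ (P.*-congˡ {y} ys₁ n)))))) ⟩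
        conv y s n + z * conv y s n + (s′ n + u * conv y s′ n + v * conv y s′ n + u * (v * conv y (conv y s′) n)) ∎
        where
        s s′ s₁ : ℕ → Carrier
        s = sumQ
        s′ = σ sumQ
        s₁ = conv (σ (numer u)) (conv (σ (numer v)) (conv (σ (denom z)) (σ (denom 1#))))
        ys₁ : ∀ n → conv y s₁ n ≈ conv y s′ n
        ys₁ = P.*-congˡ {y} σ-sumQ

      pochSum : ℕ → Carrier
      pochSum n = poch n * sumQ n

      sumQ-zero : sumQ 0 ≈ 1#
      sumQ-zero = begin
        1# * (1# * inv 0) * (1# * (1# * inv 0) * (1# * inv 0 * (1# * inv 0) + 0#) + 0#) + 0#
          ≈⟨ solve 1 (λ i → let j = con (+ 1) :* i; k = con (+ 1) :* j in
               k :* (k :* (j :* j :+ con (+ 0)) :+ con (+ 0)) :+ con (+ 0) := i :* (i :* (i :* i))) refl (inv 0) ⟩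
        inv 0 * (inv 0 * (inv 0 * inv 0))
          ≈⟨ *-cong inv-zero (*-cong inv-zero (*-cong inv-zero inv-zero)) ⟩
        1# * (1# * (1# * 1#))
          ≈⟨ solve 0 (con (+ 1) :* (con (+ 1) :* (con (+ 1) :* con (+ 1))) := con (+ 1)) refl ⟩
        1# ∎

      pochSum-zero : pochSum 0 ≈ 1#
      pochSum-zero = trans (*-cong poch-zero sumQ-zero) (*-identityˡ _)

      pochSum-one : pochSum 1 ≈ 1# + z + u + v
      pochSum-one = begin
        poch 1 * sumQ 1
          ≈⟨ *-congʳ (trans (poch-suc 0) (*-congʳ poch-zero)) ⟩
        1# * (1# - R ^ 1) * sumQ 1
          -- At exponent 1 the term with y² vanishes; it is carried along as z times zero so that
          -- `sumQ-equation` applies.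
          ≈⟨ solve 3 (λ r s w → con (+ 1) :* (con (+ 1) :- r) :* s := s :+ w :- (r :* s :+ w)) refl (R ^ 1) (sumQ 1) (z * 0#) ⟩
        sumQ 1 + z * 0# - (R ^ 1 * sumQ 1 + z * 0#)
          ≈⟨ +-congʳ (+-congˡ (*-congˡ (trans (conv-y-suc (conv y sumQ) 0) (conv-y-zero sumQ)))) ⟨
        sumQ 1 + z * conv y (conv y sumQ) 1 - (R ^ 1 * sumQ 1 + z * 0#)
          ≈⟨ +-congʳ (sumQ-equation 1) ⟩
        conv y sumQ 1 + z * conv y sumQ 1 + (R ^ 1 * sumQ 1 + u * conv y (σ sumQ) 1 + v * conv y (σ sumQ) 1 + u * (v * conv y (conv y (σ sumQ)) 1))
          - (R ^ 1 * sumQ 1 + z * 0#)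
          ≈⟨ +-congʳ (+-cong (+-cong ys₁ (*-congˡ ys₁))
               (+-cong (+-cong (+-congˡ (*-congˡ ys′₁)) (*-congˡ ys′₁))
                 (*-congˡ (*-congˡ (trans (conv-y-suc (conv y (σ sumQ)) 0) (conv-y-zero (σ sumQ))))))) ⟩
        1# + z * 1# + (R ^ 1 * sumQ 1 + u * 1# + v * 1# + u * (v * 0#)) - (R ^ 1 * sumQ 1 + z * 0#)
          ≈⟨ solve 4 (λ z u v w → con (+ 1) :+ z :* con (+ 1) :+ (w :+ u :* con (+ 1) :+ v :* con (+ 1) :+ u :* (v :* con (+ 0))) :- (w :+ z :* con (+ 0))
               := con (+ 1) :+ z :+ u :+ v) refl z u v (R ^ 1 * sumQ 1) ⟩
        1# + z + u + v ∎
        where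
        ys₁ : conv y sumQ 1 ≈ 1#
        ys₁ = trans (conv-y-suc sumQ 0) sumQ-zero
        ys′₁ : conv y (σ sumQ) 1 ≈ 1#
        ys′₁ = trans (conv-y-suc (σ sumQ) 0) (trans (*-identityˡ _) sumQ-zero)

      -- Write s for `sumQ`. Comparing coefficients of y^(n+2) expresses (1 - R^(n+2)) s_(n+2)
      -- through s_(n+1) and s_n. Multiplication by (R; R)_(n+1) completes (R; R)_(n+2) on the left
      -- and leaves the factor 1 - R^(n+1) in front of (R; R)_n s_n on the right.
      pochSum-recurrence : ∀ n → pochSum (2 ℕ.+ n) ≈
        (1# + z + (u + v) * R ^ suc n) * pochSum (suc n) + (u * v * R ^ n - z) * (1# - R ^ suc n) * pochSum n
      pochSum-recurrence n = begin
        poch (2 ℕ.+ n) * s₂          ≈⟨ *-congʳ (poch-suc (suc n)) ⟩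
        p₁ * (1# - R ^ (2 ℕ.+ n)) * s₂
          -- The summand z s_n is added and subtracted because `equation` has it on its left side;
          -- afterwards the term R^(n+2) s_(n+2) cancels.
          ≈⟨ solve 5 (λ p r s z t → p :* (con (+ 1) :- r) :* s := p :* (s :+ z :* t :- (r :* s :+ z :* t)))
               refl p₁ (R ^ (2 ℕ.+ n)) s₂ z s₀ ⟩
        p₁ * (s₂ + z * s₀ - (R ^ (2 ℕ.+ n) * s₂ + z * s₀))
          ≈⟨ *-congˡ (+-congʳ equation) ⟩
        p₁ * (s₁ + z * s₁ + (R ^ (2 ℕ.+ n) * s₂ + u * (R ^ suc n * s₁) + v * (R ^ suc n * s₁) + u * (v * (R ^ n * s₀)))
              - (R ^ (2 ℕ.+ n) * s₂ + z * s₀))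
          ≈⟨ solve 9 (λ p s z t w u v r q → p :* (s :+ z :* s :+ (w :+ u :* (r :* s) :+ v :* (r :* s) :+ u :* (v :* (q :* t))) :- (w :+ z :* t))
               := (con (+ 1) :+ z :+ (u :+ v) :* r) :* (p :* s) :+ (u :* v :* q :- z) :* p :* t)
               refl p₁ s₁ z s₀ (R ^ (2 ℕ.+ n) * s₂) u v (R ^ suc n) (R ^ n) ⟩
        (1# + z + (u + v) * R ^ suc n) * (p₁ * s₁) + (u * v * R ^ n - z) * p₁ * s₀
          ≈⟨ +-congˡ (*-congʳ (*-congˡ (poch-suc n))) ⟩
        (1# + z + (u + v) * R ^ suc n) * (p₁ * s₁) + (u * v * R ^ n - z) * (poch n * (1# - R ^ suc n)) * s₀
          ≈⟨ +-congˡ (solve 4 (λ c p r s → c :* (p :* r) :* s := c :* r :* (p :* s)) refl _ _ _ _) ⟩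
        (1# + z + (u + v) * R ^ suc n) * (p₁ * s₁) + (u * v * R ^ n - z) * (1# - R ^ suc n) * (poch n * s₀) ∎
        where
        p₁ = poch (suc n)
        s₀ = sumQ n
        s₁ = sumQ (suc n)
        s₂ = sumQ (2 ℕ.+ n)
        y² : ∀ f → conv y (conv y f) (2 ℕ.+ n) ≈ f n
        y² f = trans (conv-y-suc (conv y f) (suc n)) (conv-y-suc f n)
        equation : s₂ + z * s₀ ≈
          s₁ + z * s₁ + (R ^ (2 ℕ.+ n) * s₂ + u * (R ^ suc n * s₁) + v * (R ^ suc n * s₁) + u * (v * (R ^ n * s₀)))
        equation = begin
          s₂ + z * s₀                                ≈⟨ +-congˡ (*-congˡ (y² sumQ)) ⟨
          s₂ + z * conv y (conv y sumQ) (2 ℕ.+ n)    ≈⟨ sumQ-equation (2 ℕ.+ n) ⟩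
          _  ≈⟨ +-cong (+-cong (conv-y-suc sumQ (suc n)) (*-congˡ (conv-y-suc sumQ (suc n))))
                  (+-cong (+-cong (+-congˡ (*-congˡ (conv-y-suc (σ sumQ) (suc n)))) (*-congˡ (conv-y-suc (σ sumQ) (suc n))))
                    (*-congˡ (*-congˡ (y² (σ sumQ))))) ⟩
          _ ∎

-- The linear system for D and D′ and its elimination

module TransferSystem (K : CommutativeRing c ℓ) where
  open CommutativeRing K
  open import Algebra.Properties.CommutativeSemiring.Exp commutativeSemiring
  open IntegerSolver K
  open SetoidReasoning setoid

  recurrence-unique : ∀ (α β x y : ℕ → Carrier) → x 0 ≈ y 0 → x 1 ≈ y 1 →
    (∀ n → x (2 ℕ.+ n) ≈ α n * x (suc n) + β n * x n) →
    (∀ n → y (2 ℕ.+ n) ≈ α n * y (suc n) + β n * y n) → ∀ n → x n ≈ y n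
  recurrence-unique α β x y x₀≈y₀ x₁≈y₁ hx hy n = proj₁ (both n)
    where
    both : ∀ n → x n ≈ y n × x (suc n) ≈ y (suc n)
    both zero    = x₀≈y₀ , x₁≈y₁
    both (suc n) = let e₀ , e₁ = both n in
      e₁ , trans (hx n) (trans (+-cong (*-congˡ e₁) (*-congˡ e₀)) (sym (hy n)))

  module System
    (p q u w R : Carrier) (R≈pq : R ≈ p * q)
    (D D′ : ℕ → Carrier) (D-zero : D 0 ≈ 1#) (D′-zero : D′ 0 ≈ 1#)
    (D-suc  : ∀ n → D (suc n)  ≈ (1# + p ^ suc n * (q ^ n * w)) * D n + (p ^ suc n + p ^ n * u) * D′ n)
    (D′-suc : ∀ n → D′ (suc n) ≈ (1# + q ^ suc n * (p ^ n * u)) * D′ n + (q ^ suc n + q ^ n * w) * D n)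
    where

    R^≈ : ∀ n → R ^ n ≈ p ^ n * q ^ n
    R^≈ n = trans (^-congˡ n R≈pq) (^-distrib-* p q n)

    -- Write the system as D_(n+1) = A_n D_n + B_n D′_n and D′_(n+1) = A′_n D′_n + B′_n D_n. Since
    -- B_n = p^n (p + u) satisfies B_(n+1) = p B_n, eliminating D′ needs no division: D_(n+2) =
    -- (A_(n+1) + p A′_n) D_(n+1) - p (A_n A′_n - B_n B′_n) D_n. The determinant factors as (1 - u w
    -- R^n)(1 - R^(n+1)), the origin of the factor 1 - R^(n+1).
    D-recurrence : ∀ n → D (2 ℕ.+ n) ≈
      (1# + p + (u + p * w) * R ^ suc n) * D (suc n) + (u * (p * w) * R ^ n - p) * (1# - R ^ suc n) * D n
    D-recurrence n = begin
      D (2 ℕ.+ n)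
        ≈⟨ D-suc (suc n) ⟩
      (1# + p ^ (2 ℕ.+ n) * (q ^ suc n * w)) * D (suc n) + (p ^ (2 ℕ.+ n) + p ^ suc n * u) * D′ (suc n)
        ≈⟨ +-cong (*-congˡ (D-suc n)) (*-congˡ (D′-suc n)) ⟩
      -- The identity is polynomial in p, q, u, w, P = p^n, Q = q^n and the two values at n, all
      -- treated as independent; the products of P and Q are folded back into powers of R
      -- afterwards.
      _ ≈⟨ solve 8 (λ p q u w P Q d d′ →
             let p₁ = p :* P; q₁ = q :* Q
                 d₁ = (con (+ 1) :+ p₁ :* (Q :* w)) :* d :+ (p₁ :+ P :* u) :* d′
                 d₁′ = (con (+ 1) :+ q₁ :* (P :* u)) :* d′ :+ (q₁ :+ Q :* w) :* d
             in (con (+ 1) :+ p :* p₁ :* (q₁ :* w)) :* d₁ :+ (p :* p₁ :+ p₁ :* u) :* d₁′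
                := (con (+ 1) :+ p :+ (u :+ p :* w) :* (p₁ :* q₁)) :* d₁
                   :+ (u :* (p :* w) :* (P :* Q) :- p) :* (con (+ 1) :- p₁ :* q₁) :* d)
             refl p q u w (p ^ n) (q ^ n) (D n) (D′ n) ⟩
      _ ≈⟨ +-cong (*-cong (+-congˡ (*-congˡ (sym (R^≈ (suc n))))) (sym (D-suc n)))
             (*-congʳ (*-cong (+-congʳ (*-congˡ (sym (R^≈ n)))) (+-congˡ (-‿cong (sym (R^≈ (suc n))))))) ⟩
      (1# + p + (u + p * w) * R ^ suc n) * D (suc n) + (u * (p * w) * R ^ n - p) * (1# - R ^ suc n) * D n ∎

    -- E N is DS_{3N+2}, by deleting the part 3N+1 or 3N+2.
    E : ℕ → Carrier
    E n = D n + p ^ n * u * D′ n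

    -- With E′_n = D′_n + q^n w D_n one has E_(n+1) = (1 + u R^(n+1)) E_n + p^(n+1) (1 + u) E′_n and
    -- the mirror image for E′. The off-diagonal entry again grows by the factor p, and the
    -- determinant is (1 - R^(n+1))(1 - u w R^(n+1)); hence the passage from u to uR.
    E-recurrence : ∀ n → E (2 ℕ.+ n) ≈
      (1# + p + (u * R + p * w) * R ^ suc n) * E (suc n) + (u * R * (p * w) * R ^ n - p) * (1# - R ^ suc n) * E n
    E-recurrence n = begin
      D (2 ℕ.+ n) + p ^ (2 ℕ.+ n) * u * D′ (2 ℕ.+ n)
        ≈⟨ +-cong (D-suc (suc n)) (*-congˡ (D′-suc (suc n))) ⟩
      _ ≈⟨ +-cong (step (D-suc n) (D′-suc n)) (*-congˡ (step (D′-suc n) (D-suc n))) ⟩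
      _ ≈⟨ solve 8 (λ p q u w P Q d d′ →
             let p₁ = p :* P; q₁ = q :* Q
                 d₁ = (con (+ 1) :+ p₁ :* (Q :* w)) :* d :+ (p₁ :+ P :* u) :* d′
                 d₁′ = (con (+ 1) :+ q₁ :* (P :* u)) :* d′ :+ (q₁ :+ Q :* w) :* d
                 d₂ = (con (+ 1) :+ p :* p₁ :* (q₁ :* w)) :* d₁ :+ (p :* p₁ :+ p₁ :* u) :* d₁′
                 d₂′ = (con (+ 1) :+ q :* q₁ :* (p₁ :* u)) :* d₁′ :+ (q :* q₁ :+ q₁ :* w) :* d₁
             in d₂ :+ p :* p₁ :* u :* d₂′
                := (con (+ 1) :+ p :+ (u :* (p :* q) :+ p :* w) :* (p₁ :* q₁)) :* (d₁ :+ p₁ :* u :* d₁′)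
                   :+ (u :* (p :* q) :* (p :* w) :* (P :* Q) :- p) :* (con (+ 1) :- p₁ :* q₁) :* (d :+ P :* u :* d′))
             refl p q u w (p ^ n) (q ^ n) (D n) (D′ n) ⟩
      _ ≈⟨ +-cong (*-cong (+-congˡ (*-cong (+-congʳ (*-congˡ (sym R≈pq))) (sym (R^≈ (suc n)))))
                     (+-cong (sym (D-suc n)) (*-congˡ (sym (D′-suc n)))))
             (*-congʳ (*-cong (+-congʳ (*-cong (*-congʳ (*-congˡ (sym R≈pq))) (sym (R^≈ n)))) (+-congˡ (-‿cong (sym (R^≈ (suc n))))))) ⟩
      (1# + p + (u * R + p * w) * R ^ suc n) * E (suc n) + (u * R * (p * w) * R ^ n - p) * (1# - R ^ suc n) * E n ∎
      where
      step : ∀ {k l f f′ g g′} → f ≈ f′ → g ≈ g′ → k * f + l * g ≈ k * f′ + l * g′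
      step f≈ g≈ = +-cong (*-congˡ f≈) (*-congˡ g≈)

    module _ (poch inv : ℕ → Carrier)
             (poch-zero : poch 0 ≈ 1#) (poch-suc : ∀ n → poch (suc n) ≈ poch n * (1# - R ^ suc n))
             (inv-zero : inv 0 ≈ 1#) (inv-suc : ∀ n → inv (suc n) ≈ R ^ suc n * inv (suc n) + inv n) where
      open QSeries K R
      open Pochhammer poch inv poch-zero poch-suc inv-zero inv-suc

      D≈pochSum : ∀ n → D n ≈ pochSum u (p * w) p n
      D≈pochSum = recurrence-unique
        (λ n → 1# + p + (u + p * w) * R ^ suc n) (λ n → (u * (p * w) * R ^ n - p) * (1# - R ^ suc n)) D S
        (trans D-zero (sym (pochSum-zero u (p * w) p)))
        (trans D-one (sym (pochSum-one u (p * w) p)))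
        D-recurrence (pochSum-recurrence u (p * w) p)
        where
        S = pochSum u (p * w) p
        D-one : D 1 ≈ 1# + p + u + p * w
        D-one = trans (D-suc 0) (trans (+-cong (*-congˡ D-zero) (*-congˡ D′-zero))
          (solve 3 (λ p u w → (con (+ 1) :+ p :* con (+ 1) :* (con (+ 1) :* w)) :* con (+ 1) :+ (p :* con (+ 1) :+ con (+ 1) :* u) :* con (+ 1)
            := con (+ 1) :+ p :+ u :+ p :* w) refl p u w))

      -- The recurrence is linear, so the constant 1 + u may be pulled out; it is forced by the
      -- initial values E_0 = 1 + u and E_1 = (1 + u)(1 + p + uR + pw).
      E≈pochSum : ∀ n → E n ≈ (1# + u) * pochSum (u * R) (p * w) p n
      E≈pochSum = recurrence-unique
        (λ n → 1# + p + (u * R + p * w) * R ^ suc n) (λ n → (u * R * (p * w) * R ^ n - p) * (1# - R ^ suc n)) E (λ n → (1# + u) * S n)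
        (trans E-zero (sym (trans (*-congˡ (pochSum-zero (u * R) (p * w) p)) (*-identityʳ _))))
        (trans E-one (sym (*-congˡ (pochSum-one (u * R) (p * w) p))))
        E-recurrence
        (λ n → trans (*-congˡ (pochSum-recurrence (u * R) (p * w) p n))
          (solve 5 (λ k α β s t → k :* (α :* s :+ β :* t) := α :* (k :* s) :+ β :* (k :* t)) refl _ _ _ _ _))
        where
        S = pochSum (u * R) (p * w) p
        E-zero : E 0 ≈ 1# + u
        E-zero = trans (+-cong D-zero (*-congˡ D′-zero))
          (solve 1 (λ u → con (+ 1) :+ con (+ 1) :* u :* con (+ 1) := con (+ 1) :+ u) refl u)
        E-one : E 1 ≈ (1# + u) * (1# + p + u * R + p * w)
        E-one = begin
          E 1
            ≈⟨ +-cong (D-suc 0) (*-congˡ (D′-suc 0)) ⟩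
          _
            ≈⟨ +-cong (+-cong (*-congˡ D-zero) (*-congˡ D′-zero)) (*-congˡ (+-cong (*-congˡ D′-zero) (*-congˡ D-zero))) ⟩
          _ ≈⟨ solve 4 (λ p q u w → let o = con (+ 1) in
                 (o :+ p :* o :* (o :* w)) :* o :+ (p :* o :+ o :* u) :* o
                 :+ p :* o :* u :* ((o :+ q :* o :* (o :* u)) :* o :+ (q :* o :+ o :* w) :* o)
                 := (o :+ u) :* (o :+ p :+ u :* (p :* q) :+ p :* w)) refl p q u w ⟩
          (1# + u) * (1# + p + u * (p * q) + p * w)
            ≈⟨ *-congˡ (+-congʳ (+-congˡ (*-congˡ (sym R≈pq)))) ⟩
          (1# + u) * (1# + p + u * R + p * w) ∎

-- Partitions and row weights

-- The entries are the multiplicities of 1, 2, 3, …; ok is the condition on those of multiples of 3.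
strictMults : ∀ {M} → (ℕ → Bool) → Vec ℕ M → Bool
strictMults ok []              = true
strictMults ok (x ∷ [])        = x ≤ᵇ 1
strictMults ok (x ∷ y ∷ [])    = x ℕ.+ y ≤ᵇ 1
strictMults ok (x ∷ y ∷ z ∷ v) = (x ℕ.+ y ≤ᵇ 1) ∧ (ok z ∧ strictMults ok v)

-- A form of 3j + μ that unfolds to three successors, so that a multiplicity vector of this length
-- splits off a block of three entries by definition.
3[_]+_ : ℕ → ℕ → ℕ
3[ zero ]+ μ  = μ
3[ suc j ]+ μ = 3 ℕ.+ (3[ j ]+ μ)

-- The ring is a parameter because the same weights are needed twice: modulo degree n, where sums
-- over bounded multiplicities are evaluated, and in the full ring, where the closed forms live
-- independently of n.
module RowWeights (K : CommutativeRing c ℓ) (r : Bool → ℕ → CommutativeRing.Carrier K) where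
  open CommutativeRing K
  open Sums K
  open import Algebra.Properties.Semiring.Exp semiring using (_^_)
  open IntegerSolver K
  open SetoidReasoning setoid

  -- Weight of the rows π, the first of type o; h is the weight of what follows, given the type of its first row.
  W : Bool → List ℕ → (Bool → Carrier) → Carrier
  W o []      h = h o
  W o (L ∷ π) h = r o L * W (not o) π h

  W-++ : ∀ o π π′ h → W o (π ++ π′) h ≡ W o π (λ o′ → W o′ π′ h)
  W-++ o []      π′ h = ≡.refl
  W-++ o (L ∷ π) π′ h = ≡.cong (r o L *_) (W-++ (not o) π π′ h)

  W-0 : ∀ o π {h} → (∀ o′ → h o′ ≈ 0#) → W o π h ≈ 0#
  W-0 o []      e = e o
  W-0 o (L ∷ π) e = trans (*-congˡ (W-0 (not o) π e)) (zeroʳ _)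

  W-+ : ∀ o π h h′ → W o π (λ o′ → h o′ + h′ o′) ≈ W o π h + W o π h′
  W-+ o []      h h′ = refl
  W-+ o (L ∷ π) h h′ = trans (*-congˡ (W-+ (not o) π h h′)) (distribˡ _ _ _)

  W-Σ< : ∀ o π m (H : ℕ → Bool → Carrier) → W o π (λ o′ → Σ< m (λ i → H i o′)) ≈ Σ< m (λ i → W o π (H i))
  W-Σ< o π zero    H = W-0 o π (λ _ → refl)
  W-Σ< o π (suc m) H = trans (W-+ o π (H 0) _) (+-congˡ (W-Σ< o π m (H ∘ suc)))

  [_]_ : Bool → Carrier → Carrier
  [ b ] x = if b then x else 0#

  []-cong : ∀ b {x y} → x ≈ y → [ b ] x ≈ [ b ] y
  []-cong true  e = e
  []-cong false e = refl

  []-0 : ∀ b {x} → x ≈ 0# → [ b ] x ≈ 0#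
  []-0 true  e = e
  []-0 false e = refl

  []-+ : ∀ b x y → [ b ] (x + y) ≈ [ b ] x + [ b ] y
  []-+ true  x y = refl
  []-+ false x y = sym (+-identityˡ 0#)

  []-∧ : ∀ b b′ x → [ b ∧ b′ ] x ≈ [ b ] ([ b′ ] x)
  []-∧ true  b′ x = refl
  []-∧ false b′ x = refl

  []-comm : ∀ b b′ x → [ b ] ([ b′ ] x) ≈ [ b′ ] ([ b ] x)
  []-comm true  b′    x = refl
  []-comm false true  x = refl
  []-comm false false x = refl

  []-Σ< : ∀ b m f → [ b ] (Σ< m f) ≈ Σ< m (λ i → [ b ] f i)
  []-Σ< true  m f = refl
  []-Σ< false m f = sym (Σ<-0 m (λ _ → refl))

  W-[] : ∀ b o π h → W o π (λ o′ → [ b ] h o′) ≈ [ b ] (W o π h)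
  W-[] true  o π h = refl
  W-[] false o π h = W-0 o π (λ _ → refl)

  -- The choices for one block of parts placed above the smaller parts h: at most one of k + 1 and k
  -- + 2 here, and an optional k + 3 in `step`. An inserted row moves everything below it to the
  -- opposite type, hence `h (not o)`.
  lower : ℕ → (Bool → Carrier) → Bool → Carrier
  lower k h o = h o + (r o (1 ℕ.+ k) * h (not o) + r o (2 ℕ.+ k) * h (not o))

  step : ℕ → (Bool → Carrier) → Bool → Carrier
  step k h o = lower k h o + r o (3 ℕ.+ k) * lower k h (not o)

  lower-cong : ∀ k {h h′} o → (∀ o′ → h o′ ≈ h′ o′) → lower k h o ≈ lower k h′ o
  lower-cong k o e = +-cong (e o) (+-cong (*-congˡ (e (not o))) (*-congˡ (e (not o))))

  lower-scale : ∀ k x h o → lower k (λ o′ → x * h o′) o ≈ x * lower k h o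
  lower-scale k x h o =
    solve 5 (λ x h h′ r s → x :* h :+ (r :* (x :* h′) :+ s :* (x :* h′)) := x :* (h :+ (r :* h′ :+ s :* h′))) refl x _ _ _ _

  step-cong : ∀ k {h h′} o → (∀ o′ → h o′ ≈ h′ o′) → step k h o ≈ step k h′ o
  step-cong k o e = +-cong (lower-cong k o e) (*-congˡ (lower-cong k (not o) e))

  step-scale : ∀ k x h o → step k (λ o′ → x * h o′) o ≈ x * step k h o
  step-scale k x h o =
    trans (+-cong (lower-scale k x h o) (*-congˡ (lower-scale k x h (not o))))
      (solve 4 (λ x a ρ b → x :* a :+ ρ :* (x :* b) := x :* (a :+ ρ :* b)) refl x _ _ _)

  remainder : Fin 3 → ℕ → (Bool → Carrier) → Bool → Carrier
  remainder zero             k h o = h o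
  remainder (suc zero)       k h o = h o + r o (1 ℕ.+ k) * h (not o)
  remainder (suc (suc zero)) k h o = lower k h o

  remainder-cong : ∀ μ k {h h′} o → (∀ o′ → h o′ ≈ h′ o′) → remainder μ k h o ≈ remainder μ k h′ o
  remainder-cong zero             k o e = e o
  remainder-cong (suc zero)       k o e = +-cong (e o) (*-congˡ (e (not o)))
  remainder-cong (suc (suc zero)) k o e = lower-cong k o e

  remainder-scale : ∀ μ k x h o → remainder μ k (λ o′ → x * h o′) o ≈ x * remainder μ k h o
  remainder-scale zero             k x h o = refl
  remainder-scale (suc zero)       k x h o = solve 4 (λ x a ρ b → x :* a :+ ρ :* (x :* b) := x :* (a :+ ρ :* b)) refl x _ _ _
  remainder-scale (suc (suc zero)) k x h o = lower-scale k x h o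

  -- distinct N true = DS_{3N}(a,…,f) and distinct N false = DS_{3N}(d,e,f,a,b,c).
  distinct : ℕ → Bool → Carrier
  distinct zero    o = 1#
  distinct (suc j) o = step (3[ j ]+ 0) (distinct j) o

  module _ (n : ℕ) where

    total : ∀ (ok : ℕ → Bool) (o : Bool) (k M : ℕ) (h : Bool → Carrier) → Carrier
    total ok o k M h = sumL (below (Vec.replicate M n)) (λ v → [ strictMults ok v ] W o (multToParts k v) h)

    rows : (x y z k : ℕ) → (Bool → Carrier) → Bool → Carrier
    rows x y z k h o = W o (replicate z (3 ℕ.+ k)) (λ o′ → W o′ (replicate y (2 ℕ.+ k)) (λ o″ → W o″ (replicate x (1 ℕ.+ k)) h))

    -- The rows of lengths k+1, k+2, k+3 lying above h.
    block : (ok : ℕ → Bool) (k : ℕ) → (Bool → Carrier) → Bool → Carrier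
    block ok k h o = Σ< (suc n) (λ x → Σ< (suc n) (λ y → [ x ℕ.+ y ≤ᵇ 1 ] Σ< (suc n) (λ z → [ ok z ] rows x y z k h o)))

    -- The vector lists small parts first while the diagram has them at the bottom, so the
    -- multiplicities x, y, z give the outermost sums but the innermost weights. `W` is linear in
    -- its continuation, so these sums move inside and become the continuation of the larger parts.
    total-step : ∀ ok o k M h → total ok o k (3 ℕ.+ M) h ≈ total ok o (3 ℕ.+ k) M (block ok k h)
    total-step ok o k M h = begin
      total ok o k (3 ℕ.+ M) h
        ≈⟨ sumL-below n (n ∷ n ∷ vs) F ⟩
      Σ< (suc n) (λ x → sumL (below (n ∷ n ∷ vs)) (λ v → F (x ∷ v)))
        ≈⟨ Σ<-cong (suc n) (λ x → trans (sumL-below n (n ∷ vs) (λ v → F (x ∷ v)))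
             (Σ<-cong (suc n) (λ y → sumL-below n vs (λ v → F (x ∷ y ∷ v))))) ⟩
      Σ< (suc n) (λ x → Σ< (suc n) (λ y → Σ< (suc n) (λ z → sumL (below vs) (λ v → F (x ∷ y ∷ z ∷ v)))))
        ≈⟨ Σ<-cong (suc n) (λ x → trans (Σ<-cong (suc n) (λ y → Σ<-sumL (suc n) (below vs) (λ z v → F (x ∷ y ∷ z ∷ v))))
             (Σ<-sumL (suc n) (below vs) (λ y v → Σ< (suc n) (λ z → F (x ∷ y ∷ z ∷ v))))) ⟩
      Σ< (suc n) (λ x → sumL (below vs) (λ v → Σ< (suc n) (λ y → Σ< (suc n) (λ z → F (x ∷ y ∷ z ∷ v)))))
        ≈⟨ Σ<-sumL (suc n) (below vs) (λ x v → Σ< (suc n) (λ y → Σ< (suc n) (λ z → F (x ∷ y ∷ z ∷ v)))) ⟩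
      sumL (below vs) (λ v → Σ< (suc n) (λ x → Σ< (suc n) (λ y → Σ< (suc n) (λ z → F (x ∷ y ∷ z ∷ v)))))
        ≈⟨ sumL-cong (below vs) inner ⟩
      total ok o (3 ℕ.+ k) M (block ok k h) ∎
      where
      vs = Vec.replicate M n
      F : Vec ℕ (3 ℕ.+ M) → Carrier
      F v = [ strictMults ok v ] W o (multToParts k v) h
      W-split : ∀ x y z (v : Vec ℕ M) → W o (multToParts k (x ∷ y ∷ z ∷ v)) h ≡ W o (multToParts (3 ℕ.+ k) v) (rows x y z k h)
      W-split x y z v = let π = multToParts (3 ℕ.+ k) v in
        ≡.trans (W-++ o ((π ++ replicate z (3 ℕ.+ k)) ++ replicate y (2 ℕ.+ k)) (replicate x (1 ℕ.+ k)) h)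
        (≡.trans (W-++ o (π ++ replicate z (3 ℕ.+ k)) (replicate y (2 ℕ.+ k)) _)
          (W-++ o π (replicate z (3 ℕ.+ k)) _))
      inner : ∀ v → Σ< (suc n) (λ x → Σ< (suc n) (λ y → Σ< (suc n) (λ z → F (x ∷ y ∷ z ∷ v))))
        ≈ [ strictMults ok v ] W o (multToParts (3 ℕ.+ k) v) (block ok k h)
      inner v = begin
        Σ< (suc n) (λ x → Σ< (suc n) (λ y → Σ< (suc n) (λ z → F (x ∷ y ∷ z ∷ v))))
          ≈⟨ Σ<-cong (suc n) (λ x → Σ<-cong (suc n) (λ y → term x y)) ⟩
        Σ< (suc n) (λ x → Σ< (suc n) (λ y → Λ (λ o′ → [ x ℕ.+ y ≤ᵇ 1 ] Σ< (suc n) (λ z → [ ok z ] rows x y z k h o′))))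
          ≈⟨ Σ<-cong (suc n) (λ x → Λ-Σ< (H x)) ⟨
        Σ< (suc n) (λ x → Λ (λ o′ → Σ< (suc n) (λ y → [ x ℕ.+ y ≤ᵇ 1 ] Σ< (suc n) (λ z → [ ok z ] rows x y z k h o′))))
          ≈⟨ Λ-Σ< (λ x o′ → Σ< (suc n) (λ y → H x y o′)) ⟨
        Λ (block ok k h) ∎
        where
        g = strictMults ok v
        π = multToParts (3 ℕ.+ k) v
        H : ℕ → ℕ → Bool → Carrier
        H x y o′ = [ x ℕ.+ y ≤ᵇ 1 ] Σ< (suc n) (λ z → [ ok z ] rows x y z k h o′)
        Λ : (Bool → Carrier) → Carrier
        Λ H = [ g ] W o π H
        Λ-Σ< : ∀ H → Λ (λ o′ → Σ< (suc n) (λ i → H i o′)) ≈ Σ< (suc n) (λ i → Λ (H i))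
        Λ-Σ< H = trans ([]-cong g (W-Σ< o π (suc n) H)) ([]-Σ< g (suc n) (λ i → W o π (H i)))
        Λ-[] : ∀ b H → Λ (λ o′ → [ b ] H o′) ≈ [ b ] Λ H
        Λ-[] b H = trans ([]-cong g (W-[] b o π H)) ([]-comm g b _)
        term : ∀ x y → Σ< (suc n) (λ z → F (x ∷ y ∷ z ∷ v))
          ≈ Λ (λ o′ → [ x ℕ.+ y ≤ᵇ 1 ] Σ< (suc n) (λ z → [ ok z ] rows x y z k h o′))
        term x y = begin
          Σ< (suc n) (λ z → F (x ∷ y ∷ z ∷ v))
            ≈⟨ Σ<-cong (suc n) (λ z → begin
                 F (x ∷ y ∷ z ∷ v)
                   ≡⟨ ≡.cong ([ (x ℕ.+ y ≤ᵇ 1) ∧ (ok z ∧ g) ]_) (W-split x y z v) ⟩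
                 [ (x ℕ.+ y ≤ᵇ 1) ∧ (ok z ∧ g) ] W o π (rows x y z k h)
                   ≈⟨ trans ([]-∧ (x ℕ.+ y ≤ᵇ 1) (ok z ∧ g) _) ([]-cong (x ℕ.+ y ≤ᵇ 1) ([]-∧ (ok z) g _)) ⟩
                 [ x ℕ.+ y ≤ᵇ 1 ] [ ok z ] Λ (rows x y z k h)
                   ≈⟨ []-cong (x ℕ.+ y ≤ᵇ 1) (Λ-[] (ok z) (rows x y z k h)) ⟨
                 [ x ℕ.+ y ≤ᵇ 1 ] Λ (λ o′ → [ ok z ] rows x y z k h o′) ∎) ⟩
          Σ< (suc n) (λ z → [ x ℕ.+ y ≤ᵇ 1 ] Λ (λ o′ → [ ok z ] rows x y z k h o′))
            ≈⟨ []-Σ< (x ℕ.+ y ≤ᵇ 1) (suc n) (λ z → Λ (λ o′ → [ ok z ] rows x y z k h o′)) ⟨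
          [ x ℕ.+ y ≤ᵇ 1 ] Σ< (suc n) (λ z → Λ (λ o′ → [ ok z ] rows x y z k h o′))
            ≈⟨ []-cong (x ℕ.+ y ≤ᵇ 1) (Λ-Σ< (λ z o′ → [ ok z ] rows x y z k h o′)) ⟨
          [ x ℕ.+ y ≤ᵇ 1 ] Λ (λ o′ → Σ< (suc n) (λ z → [ ok z ] rows x y z k h o′))
            ≈⟨ Λ-[] (x ℕ.+ y ≤ᵇ 1) (λ o′ → Σ< (suc n) (λ z → [ ok z ] rows x y z k h o′)) ⟨
          Λ (λ o′ → [ x ℕ.+ y ≤ᵇ 1 ] Σ< (suc n) (λ z → [ ok z ] rows x y z k h o′)) ∎

    Σ<-pairs : ∀ (g : ℕ → ℕ → Carrier) → (n ≡ 0 → ∀ y → g 1 y ≈ 0#) → (n ≡ 0 → g 0 1 ≈ 0#) →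
      Σ< (suc n) (λ x → Σ< (suc n) (λ y → [ x ℕ.+ y ≤ᵇ 1 ] g x y)) ≈ g 0 0 + (g 1 0 + g 0 1)
    Σ<-pairs g g₁≈0 g₀₁≈0 = begin
      Σ< (suc n) (λ x → Σ< (suc n) (λ y → [ x ℕ.+ y ≤ᵇ 1 ] g x y))
        ≈⟨ Σ<-two n (λ x → Σ< (suc n) (λ y → [ x ℕ.+ y ≤ᵇ 1 ] g x y)) (λ x → Σ<-0 (suc n) (λ y → refl))
             (λ n≡0 → Σ<-0 (suc n) (λ y → []-0 (1 ℕ.+ y ≤ᵇ 1) (g₁≈0 n≡0 y))) ⟩
      Σ< (suc n) (λ y → [ y ≤ᵇ 1 ] g 0 y) + Σ< (suc n) (λ y → [ 1 ℕ.+ y ≤ᵇ 1 ] g 1 y)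
        ≈⟨ +-cong (Σ<-two n (λ y → [ y ≤ᵇ 1 ] g 0 y) (λ y → refl) g₀₁≈0)
             (Σ<-two n (λ y → [ 1 ℕ.+ y ≤ᵇ 1 ] g 1 y) (λ y → refl) (λ _ → refl)) ⟩
      g 0 0 + g 0 1 + (g 1 0 + 0#)
        ≈⟨ solve 3 (λ a b c → a :+ b :+ (c :+ con (+ 0)) := a :+ (c :+ b)) refl _ _ _ ⟩
      g 0 0 + (g 1 0 + g 0 1) ∎

    -- The hypothesis holds modulo degree greater than n. Through it the bounded sums over
    -- multiplicities behave like infinite ones.
    module _ (vanish : ∀ o L x h → n ℕ.< x → W o (replicate x (suc L)) h ≈ 0#) where

      private
        vanish₁ : ∀ o L h → n ≡ 0 → W o (replicate 1 (suc L)) h ≈ 0#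
        vanish₁ o L h ≡.refl = vanish o L 1 h (ℕ.s≤s ℕ.z≤n)

      total-0 : ∀ ok o k h → total ok o k 0 h ≈ h o
      total-0 ok o k h = +-identityʳ _

      total-1 : ∀ ok o k h → total ok o k 1 h ≈ h o + r o (1 ℕ.+ k) * h (not o)
      total-1 ok o k h = begin
        total ok o k 1 h ≈⟨ sumL-below n [] (λ v → [ strictMults ok v ] W o (multToParts k v) h) ⟩
        Σ< (suc n) (λ x → f x + 0#) ≈⟨ Σ<-cong (suc n) (λ x → +-identityʳ (f x)) ⟩
        Σ< (suc n) f ≈⟨ Σ<-two n f (λ x → refl) (vanish₁ o k h) ⟩
        h o + r o (1 ℕ.+ k) * h (not o) ∎
        where
        f : ℕ → Carrier
        f x = [ x ≤ᵇ 1 ] W o (replicate x (1 ℕ.+ k)) h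

      total-2 : ∀ ok o k h → total ok o k 2 h ≈ lower k h o
      total-2 ok o k h = begin
        total ok o k 2 h ≈⟨ sumL-below n (n ∷ []) F ⟩
        Σ< (suc n) (λ x → sumL (below (n ∷ [])) (λ v → F (x ∷ v)))
          ≈⟨ Σ<-cong (suc n) (λ x → trans (sumL-below n [] (λ v → F (x ∷ v))) (Σ<-cong (suc n) (λ y → trans (+-identityʳ (F (x ∷ y ∷ [])))
               ([]-cong (x ℕ.+ y ≤ᵇ 1) (reflexive (W-++ o (replicate y (2 ℕ.+ k)) (replicate x (1 ℕ.+ k)) h)))))) ⟩
        Σ< (suc n) (λ x → Σ< (suc n) (λ y → [ x ℕ.+ y ≤ᵇ 1 ] g x y))
          ≈⟨ Σ<-pairs g (λ n≡0 y → W-0 o (replicate y (2 ℕ.+ k)) (λ o′ → vanish₁ o′ k h n≡0)) (vanish₁ o (1 ℕ.+ k) h) ⟩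
        lower k h o ∎
        where
        F : Vec ℕ 2 → Carrier
        F v = [ strictMults ok v ] W o (multToParts k v) h
        g : ℕ → ℕ → Carrier
        g x y = W o (replicate y (2 ℕ.+ k)) (λ o′ → W o′ (replicate x (1 ℕ.+ k)) h)

      total-remainder : ∀ μ ok o k h → total ok o k (toℕ μ) h ≈ remainder μ k h o
      total-remainder zero             = total-0
      total-remainder (suc zero)       = total-1
      total-remainder (suc (suc zero)) = total-2

      block≈ : ∀ ok k h o → block ok k h o ≈ Σ< (suc n) (λ z → [ ok z ] W o (replicate z (3 ℕ.+ k)) (lower k h))
      block≈ ok k h o = begin
        block ok k h o
          ≈⟨ Σ<-pairs g (λ n≡0 y → g≈0 1 y (λ z o′ → W-0 o′ (replicate y (2 ℕ.+ k)) (λ o″ → vanish₁ o″ k h n≡0)))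
               (λ n≡0 → g≈0 0 1 (λ z o′ → vanish₁ o′ (1 ℕ.+ k) h n≡0)) ⟩
        g 0 0 + (g 1 0 + g 0 1)
          ≈⟨ trans (Σ<-+ (suc n) (f 0 0) (λ z → f 1 0 z + f 0 1 z)) (+-congˡ (Σ<-+ (suc n) (f 1 0) (f 0 1))) ⟨
        Σ< (suc n) (λ z → f 0 0 z + (f 1 0 z + f 0 1 z))
          ≈⟨ Σ<-cong (suc n) (λ z → begin
               [ ok z ] W o (replicate z (3 ℕ.+ k)) (lower k h)
                 ≈⟨ []-cong (ok z) (trans (W-+ o (replicate z (3 ℕ.+ k)) h _) (+-congˡ (W-+ o (replicate z (3 ℕ.+ k)) _ _))) ⟩
               [ ok z ] (rows 0 0 z k h o + (rows 1 0 z k h o + rows 0 1 z k h o))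
                 ≈⟨ trans ([]-+ (ok z) _ _) (+-congˡ ([]-+ (ok z) _ _)) ⟩
               f 0 0 z + (f 1 0 z + f 0 1 z) ∎) ⟨
        Σ< (suc n) (λ z → [ ok z ] W o (replicate z (3 ℕ.+ k)) (lower k h)) ∎
        where
        f : ℕ → ℕ → ℕ → Carrier
        f x y z = [ ok z ] rows x y z k h o
        g : ℕ → ℕ → Carrier
        g x y = Σ< (suc n) (f x y)
        g≈0 : ∀ x y → (∀ z o′ → W o′ (replicate y (2 ℕ.+ k)) (λ o″ → W o″ (replicate x (1 ℕ.+ k)) h) ≈ 0#) → g x y ≈ 0#
        g≈0 x y e = Σ<-0 (suc n) (λ z → []-0 (ok z) (W-0 o (replicate z (3 ℕ.+ k)) (e z)))

      block-distinct : ∀ k h o → block (_≤ᵇ 1) k h o ≈ step k h o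
      block-distinct k h o = trans (block≈ (_≤ᵇ 1) k h o) (Σ<-two n (λ z → [ z ≤ᵇ 1 ] W o (replicate z (3 ℕ.+ k)) (lower k h)) (λ x → refl) (vanish₁ o (2 ℕ.+ k) (lower k h)))

      -- Let f z be the weight with z copies of k + 3. Two copies contribute ρ and leave the type of
      -- the next row unchanged, so f (z + 2) = ρ f z, and the sum G over z satisfies G = f 0 + f 1
      -- + ρ G.
      block-all : ∀ {ρ} k h o → r o (3 ℕ.+ k) * r (not o) (3 ℕ.+ k) ≈ ρ → (1# - ρ) * block (λ _ → true) k h o ≈ step k h o
      block-all {ρ} k h o rr≈ρ = begin
        (1# - ρ) * block (λ _ → true) k h o    ≈⟨ *-congˡ (block≈ (λ _ → true) k h o) ⟩
        (1# - ρ) * G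
          ≈⟨ solve 2 (λ ρ G → (con (+ 1) :- ρ) :* G := G :- ρ :* G) refl ρ G ⟩
        G - ρ * G                              ≈⟨ +-congʳ telescope ⟩
        f 0 + (f 1 + ρ * G) - ρ * G
          ≈⟨ solve 3 (λ a b c → a :+ (b :+ c) :- c := a :+ b) refl (f 0) (f 1) (ρ * G) ⟩
        f 0 + f 1 ∎
        where
        L = 3 ℕ.+ k
        f : ℕ → Carrier
        f z = W o (replicate z L) (lower k h)
        G = Σ< (suc n) f
        f-2+ : ∀ z → f (2 ℕ.+ z) ≈ ρ * f z
        f-2+ z = trans (sym (*-assoc _ _ _)) (*-cong rr≈ρ (reflexive (≡.cong (λ o′ → W o′ (replicate z L) (lower k h)) (not-involutive o))))
        Σ<-suc : ∀ m → n ℕ.< m → Σ< m f ≈ Σ< (suc m) f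
        Σ<-suc m n<m = go m f (vanish o (2 ℕ.+ k) m (lower k h) n<m)
          where
          go : ∀ m f → f m ≈ 0# → Σ< m f ≈ Σ< (suc m) f
          go zero    f e = sym (trans (+-identityʳ _) e)
          go (suc m) f e = +-congˡ (go m (f ∘ suc) e)
        -- Two vanishing terms beyond the bound n are added; after f 0 and f 1 are split off, the
        -- remaining range has again the length of G.
        telescope : G ≈ f 0 + (f 1 + ρ * G)
        telescope = begin
          Σ< (1 ℕ.+ n) f    ≈⟨ Σ<-suc (1 ℕ.+ n) ℕₚ.≤-refl ⟩
          Σ< (2 ℕ.+ n) f    ≈⟨ Σ<-suc (2 ℕ.+ n) (ℕₚ.m≤n⇒m≤1+n ℕₚ.≤-refl) ⟩
          Σ< (3 ℕ.+ n) f    ≈⟨ +-congˡ (+-congˡ (trans (Σ<-cong (suc n) f-2+) (Σ<-*ˡ (suc n) ρ f))) ⟩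
          f 0 + (f 1 + ρ * G) ∎

      full : (ok : ℕ → Bool) → ℕ → Bool → Carrier
      full ok zero    o = 1#
      full ok (suc j) o = block ok (3[ j ]+ 0) (full ok j) o

      total-full : ∀ ok o N μ → total ok o 0 (3[ N ]+ μ) (λ _ → 1#) ≈ total ok o (3[ N ]+ 0) μ (full ok N)
      total-full ok o N μ =
        trans (go N 0) (reflexive (≡.cong (λ m → total ok o (3[ m ]+ 0) μ (full ok m)) (ℕₚ.+-identityʳ N)))
        where
        -- The parts up to 3j have already been absorbed into the continuation; j rises as N falls.
        go : ∀ N j → total ok o (3[ j ]+ 0) (3[ N ]+ μ) (full ok j) ≈ total ok o (3[ N ℕ.+ j ]+ 0) μ (full ok (N ℕ.+ j))
        go zero    j = refl
        go (suc N) j = begin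
          total ok o (3[ j ]+ 0) (3[ suc N ]+ μ) (full ok j)
            ≈⟨ total-step ok o (3[ j ]+ 0) (3[ N ]+ μ) (full ok j) ⟩
          total ok o (3[ suc j ]+ 0) (3[ N ]+ μ) (full ok (suc j))  ≈⟨ go N (suc j) ⟩
          total ok o (3[ N ℕ.+ suc j ]+ 0) μ (full ok (N ℕ.+ suc j))
            ≡⟨ ≡.cong (λ m → total ok o (3[ m ]+ 0) μ (full ok m)) (ℕₚ.+-suc N j) ⟩
          total ok o (3[ suc N ℕ.+ j ]+ 0) μ (full ok (suc N ℕ.+ j)) ∎

      full-distinct : ∀ j o → full (_≤ᵇ 1) j o ≈ distinct j o
      full-distinct zero    o = refl
      full-distinct (suc j) o = trans (block-distinct (3[ j ]+ 0) (full (_≤ᵇ 1) j) o) (step-cong (3[ j ]+ 0) o (full-distinct j))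

      -- The new factor 1 - R^(j+1) cancels the geometric sum over the multiplicity of 3j + 3. Since
      -- `step` is linear, the remaining (R; R)_j passes through it to the previous stage.
      poch-full : ∀ {R} (poch : ℕ → Carrier) → poch 0 ≈ 1# →
        (∀ j → poch (suc j) ≈ poch j * (1# - R ^ suc j)) →
        (∀ o j → r o (3[ suc j ]+ 0) * r (not o) (3[ suc j ]+ 0) ≈ R ^ suc j) →
        ∀ j o → poch j * full (λ _ → true) j o ≈ distinct j o
      poch-full poch poch-zero poch-suc rr≈R^ zero    o = trans (*-identityʳ _) poch-zero
      poch-full {R} poch poch-zero poch-suc rr≈R^ (suc j) o = begin
        poch (suc j) * block (λ _ → true) k X o              ≈⟨ trans (*-congʳ (poch-suc j)) (*-assoc _ _ _) ⟩
        poch j * ((1# - R ^ suc j) * block (λ _ → true) k X o) ≈⟨ *-congˡ (block-all k X o (rr≈R^ o j)) ⟩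
        poch j * step k X o                                  ≈⟨ step-scale k (poch j) X o ⟨
        step k (λ o′ → poch j * X o′) o
          ≈⟨ step-cong k o (poch-full poch poch-zero poch-suc rr≈R^ j) ⟩
        step k (distinct j) o                                ∎
        where
        k = 3[ j ]+ 0
        X = full (λ _ → true) j

-- Strictness and distinctness in terms of multiplicities

T-injective : ∀ {a b} → (T a → T b) → (T b → T a) → a ≡ b
T-injective {true}  {true}  f g = ≡.refl
T-injective {true}  {false} f g = ⊥-elim (f tt)
T-injective {false} {true}  f g = ⊥-elim (g tt)
T-injective {false} {false} f g = ≡.refl

T-∧⁻ : ∀ {a b} → T (a ∧ b) → T a × T b
T-∧⁻ = Equivalence.to T-∧

T-∧⁺ : ∀ {a b} → T a → T b → T (a ∧ b)
T-∧⁺ s t = Equivalence.from T-∧ (s , t)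

T-not⁺ : ∀ {a} → ¬ T a → T (not a)
T-not⁺ {true}  f = f tt
T-not⁺ {false} f = tt

T-not⁻ : ∀ {a} → T (not a) → ¬ T a
T-not⁻ {true} ()
T-not⁻ {false} _ ()

allL⁻ : ∀ {A : Set} {p : A → Bool} {xs x} → T (allL p xs) → x ∈ xs → T (p x)
allL⁻ {p = p} {y ∷ xs} t (here ≡.refl) = proj₁ (T-∧⁻ t)
allL⁻ {p = p} {y ∷ xs} t (there x∈xs)  = allL⁻ (proj₂ (T-∧⁻ {p y} t)) x∈xs

allL⁺ : ∀ {A : Set} {p : A → Bool} xs → (∀ x → T (p x)) → T (allL p xs)
allL⁺ []       f = tt
allL⁺ (x ∷ xs) f = T-∧⁺ (f x) (allL⁺ xs f)

mult≥1⇒∈ : ∀ p π → 1 ℕ.≤ mult p π → p ∈ π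
mult≥1⇒∈ p (L ∷ π) h with p ≡ᵇ L in eq
... | true  = here (ℕₚ.≡ᵇ⇒≡ p L (≡.subst T (≡.sym eq) tt))
... | false = there (mult≥1⇒∈ p π h)

occurs⇒mult≥1 : ∀ p π → T (occurs p π) → 1 ℕ.≤ mult p π
occurs⇒mult≥1 p (L ∷ π) h with p ≡ᵇ L
... | true  = s≤s z≤n
... | false = occurs⇒mult≥1 p π h

mult≥1⇒occurs : ∀ p π → 1 ℕ.≤ mult p π → T (occurs p π)
mult≥1⇒occurs p (L ∷ π) h with p ≡ᵇ L
... | true  = tt
... | false = mult≥1⇒occurs p π h

∈⇒≤sum : ∀ {p π} → p ∈ π → p ℕ.≤ sum π
∈⇒≤sum {π = L ∷ π} (here ≡.refl) = ℕₚ.m≤m+n L (sum π)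
∈⇒≤sum {π = L ∷ π} (there p∈π)  = ℕₚ.≤-trans (∈⇒≤sum p∈π) (ℕₚ.m≤n+m (sum π) L)

≤1-split : ∀ {a b} → (1 ℕ.≤ a → b ≡ 0 × a ℕ.≤ 1) → (1 ℕ.≤ b → b ℕ.≤ 1) → a ℕ.+ b ℕ.≤ 1
≤1-split {zero}  {zero}  f g = z≤n
≤1-split {zero}  {suc b} f g = g (s≤s z≤n)
≤1-split {suc a} {b}     f g with f (s≤s z≤n)
... | ≡.refl , a≤1 = ≡.subst (ℕ._≤ 1) (≡.sym (ℕₚ.+-identityʳ (suc a))) a≤1

-- Absence of repetition and absence of joint occurrence merge into one bound on a combined
-- multiplicity. The definition tests l only up to |π|, and every l for which the part 3l + 1 occurs
-- lies in this range.
is3Strict⇒ : ∀ π → T (is3Strict π) → ∀ l → mult (3 ℕ.* l ℕ.+ 1) π ℕ.+ mult (3 ℕ.* l ℕ.+ 2) π ℕ.≤ 1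
is3Strict⇒ π strict l = ≤1-split
  (λ h → ℕₚ.n≤0⇒n≡0 (ℕₚ.≮⇒≥ (λ h′ → T-not⁻ (allL⁻ (proj₁ split) (∈-upTo⁺ (s≤s (l≤sum h))))
                        (T-∧⁺ (mult≥1⇒occurs (3 ℕ.* l ℕ.+ 1) π h) (mult≥1⇒occurs (3 ℕ.* l ℕ.+ 2) π h′))))
       , single 1 h ≡.refl)
  (λ h → single 2 h ≡.refl)
  where
  split = T-∧⁻ {allL (λ l → not (occurs (3 ℕ.* l ℕ.+ 1) π ∧ occurs (3 ℕ.* l ℕ.+ 2) π)) (upTo (suc (sum π)))} strict
  l≤sum : 1 ℕ.≤ mult (3 ℕ.* l ℕ.+ 1) π → l ℕ.≤ sum π
  l≤sum h = ℕₚ.≤-trans (ℕₚ.≤-trans (ℕₚ.m≤n*m l 3) (ℕₚ.m≤m+n (3 ℕ.* l) 1)) (∈⇒≤sum (mult≥1⇒∈ (3 ℕ.* l ℕ.+ 1) π h))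
  mod : ∀ r → (3 ℕ.* l ℕ.+ r) % 3 ≡ r % 3
  mod r = ≡.trans (≡.cong (_% 3) (≡.trans (ℕₚ.+-comm (3 ℕ.* l) r) (≡.cong (r ℕ.+_) (ℕₚ.*-comm 3 l)))) (ℕ.[m+kn]%n≡m%n r l 3)
  single : ∀ r → 1 ℕ.≤ mult (3 ℕ.* l ℕ.+ r) π → (r % 3 ≡ᵇ 0) ≡ false → mult (3 ℕ.* l ℕ.+ r) π ℕ.≤ 1
  single r h r≢0 with Equivalence.to T-∨ (allL⁻ (proj₂ split) (mult≥1⇒∈ (3 ℕ.* l ℕ.+ r) π h))
  ... | inj₁ t = ⊥-elim (≡.subst T (≡.trans (≡.cong (_≡ᵇ 0) (mod r)) r≢0) t)
  ... | inj₂ t = ℕₚ.≤ᵇ⇒≤ _ 1 t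

is3Strict⇐ : ∀ π → (∀ l → mult (3 ℕ.* l ℕ.+ 1) π ℕ.+ mult (3 ℕ.* l ℕ.+ 2) π ℕ.≤ 1) → T (is3Strict π)
is3Strict⇐ π h = T-∧⁺ (allL⁺ (upTo (suc (sum π))) (λ l → T-not⁺ (λ t →
    let t₁ , t₂ = T-∧⁻ {occurs (3 ℕ.* l ℕ.+ 1) π} t in
    ℕₚ.<⇒≱ (ℕₚ.+-mono-≤ (occurs⇒mult≥1 (3 ℕ.* l ℕ.+ 1) π t₁) (occurs⇒mult≥1 (3 ℕ.* l ℕ.+ 2) π t₂)) (h l))))
  (allL⁺ π single)
  where
  single : ∀ p → T ((p % 3 ≡ᵇ 0) ∨ (mult p π ≤ᵇ 1))
  single p with p % 3 | ℕ.m≡m%n+[m/n]*n p 3 | ℕ.m%n<n p 3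
  ... | 0 | _ | _ = tt
  ... | 1 | p≡ | _ = ℕₚ.≤⇒≤ᵇ (≡.subst (λ p → mult p π ℕ.≤ 1) (≡.sym (≡.trans p≡ (comm 1)))
                      (ℕₚ.≤-trans (ℕₚ.m≤m+n _ _) (h (p ℕ./ 3))))
    where
    comm : ∀ r → r ℕ.+ p ℕ./ 3 ℕ.* 3 ≡ 3 ℕ.* (p ℕ./ 3) ℕ.+ r
    comm r = ≡.trans (ℕₚ.+-comm r _) (≡.cong (ℕ._+ r) (ℕₚ.*-comm (p ℕ./ 3) 3))
  ... | 2 | p≡ | _ = ℕₚ.≤⇒≤ᵇ (≡.subst (λ p → mult p π ℕ.≤ 1) (≡.sym (≡.trans p≡ (comm 2)))
                      (ℕₚ.≤-trans (ℕₚ.m≤n+m _ _) (h (p ℕ./ 3))))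
    where
    comm : ∀ r → r ℕ.+ p ℕ./ 3 ℕ.* 3 ≡ 3 ℕ.* (p ℕ./ 3) ℕ.+ r
    comm r = ≡.trans (ℕₚ.+-comm r _) (≡.cong (ℕ._+ r) (ℕₚ.*-comm (p ℕ./ 3) 3))
  ... | suc (suc (suc _)) | _ | s≤s (s≤s (s≤s ()))

isDistinct⇒ : ∀ π → T (isDistinct π) → ∀ p → mult p π ℕ.≤ 1
isDistinct⇒ π distinct p with mult p π in eq
... | zero  = z≤n
... | suc m = ≡.subst (ℕ._≤ 1) eq
  (ℕₚ.≤ᵇ⇒≤ _ 1 (allL⁻ distinct (mult≥1⇒∈ p π (≡.subst (1 ℕ.≤_) (≡.sym eq) (s≤s z≤n)))))

isDistinct⇐ : ∀ π → (∀ p → mult p π ℕ.≤ 1) → T (isDistinct π)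
isDistinct⇐ π h = allL⁺ π (λ p → ℕₚ.≤⇒≤ᵇ (h p))

-- Positions past the end stand for parts larger than M, which have multiplicity 0; conditions can
-- then quantify over all l. This default is the source of the hypothesis `T (ok 0)` in
-- `strictMults⇒`.
entry : ∀ {M} → ℕ → Vec ℕ M → ℕ
entry i       []      = 0
entry zero    (x ∷ v) = x
entry (suc i) (x ∷ v) = entry i v

mult-++ : ∀ p π π′ → mult p (π ++ π′) ≡ mult p π ℕ.+ mult p π′
mult-++ p []      π′ = ≡.refl
mult-++ p (L ∷ π) π′ = ≡.trans (≡.cong ((if p ≡ᵇ L then 1 else 0) ℕ.+_) (mult-++ p π π′))
  (≡.sym (ℕₚ.+-assoc (if p ≡ᵇ L then 1 else 0) _ _))

≡ᵇ-refl : ∀ p → (p ≡ᵇ p) ≡ true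
≡ᵇ-refl zero    = ≡.refl
≡ᵇ-refl (suc p) = ≡ᵇ-refl p

≢⇒≡ᵇ-false : ∀ p q → ¬ p ≡ q → (p ≡ᵇ q) ≡ false
≢⇒≡ᵇ-false p q p≢q with p ≡ᵇ q in eq
... | true  = contradiction (ℕₚ.≡ᵇ⇒≡ p q (≡.subst T (≡.sym eq) tt)) p≢q
... | false = ≡.refl

mult-replicate : ∀ p x → mult p (replicate x p) ≡ x
mult-replicate p zero    = ≡.refl
mult-replicate p (suc x) rewrite ≡ᵇ-refl p = ≡.cong suc (mult-replicate p x)

mult-replicate-≢ : ∀ p q x → ¬ p ≡ q → mult p (replicate x q) ≡ 0
mult-replicate-≢ p q zero    p≢q = ≡.refl
mult-replicate-≢ p q (suc x) p≢q rewrite ≢⇒≡ᵇ-false p q p≢q = mult-replicate-≢ p q x p≢q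

mult-small : ∀ {M} k p (v : Vec ℕ M) → p ℕ.≤ k → mult p (multToParts k v) ≡ 0
mult-small k p []      p≤k = ≡.refl
mult-small k p (x ∷ v) p≤k = ≡.trans (mult-++ p (multToParts (suc k) v) _)
  (≡.cong₂ ℕ._+_ (mult-small (suc k) p v (ℕₚ.m≤n⇒m≤1+n p≤k)) (mult-replicate-≢ p (suc k) x (ℕₚ.<⇒≢ (s≤s p≤k))))

mult-multToParts : ∀ {M} k i (v : Vec ℕ M) → mult (suc (i ℕ.+ k)) (multToParts k v) ≡ entry i v
mult-multToParts k i       []      = ≡.refl
mult-multToParts k zero    (x ∷ v) = ≡.trans (mult-++ (suc k) (multToParts (suc k) v) _)
  (≡.cong₂ ℕ._+_ (mult-small (suc k) (suc k) v ℕₚ.≤-refl) (mult-replicate (suc k) x))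
mult-multToParts k (suc i) (x ∷ v) = ≡.trans (mult-++ (2 ℕ.+ i ℕ.+ k) (multToParts (suc k) v) _)
  (≡.trans (≡.cong₂ ℕ._+_
      (≡.trans (≡.cong (λ p → mult (suc p) (multToParts (suc k) v)) (≡.sym (ℕₚ.+-suc i k))) (mult-multToParts (suc k) i v))
      (mult-replicate-≢ (2 ℕ.+ i ℕ.+ k) (suc k) x (ℕₚ.>⇒≢ (s≤s (s≤s (ℕₚ.m≤n+m k i))))))
    (ℕₚ.+-identityʳ _))

mult-entry : ∀ {M} i (v : Vec ℕ M) → mult (suc i) (multToParts 0 v) ≡ entry i v
mult-entry i v = ≡.trans (≡.cong (λ j → mult (suc j) (multToParts 0 v)) (≡.sym (ℕₚ.+-identityʳ i))) (mult-multToParts 0 i v)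

Strict : ∀ {M} → (ℕ → Bool) → Vec ℕ M → Set
Strict ok v = ∀ l → entry (3[ l ]+ 0) v ℕ.+ entry (3[ l ]+ 1) v ℕ.≤ 1 × T (ok (entry (3[ l ]+ 2) v))

strictMults⇒ : ∀ {M ok} → T (ok 0) → (v : Vec ℕ M) → T (strictMults ok v) → Strict ok v
strictMults⇒ ok0 []              t l       = z≤n , ok0
strictMults⇒ ok0 (x ∷ [])        t zero    = ≡.subst (ℕ._≤ 1) (≡.sym (ℕₚ.+-identityʳ x)) (ℕₚ.≤ᵇ⇒≤ x 1 t) , ok0
strictMults⇒ ok0 (x ∷ [])        t (suc l) = z≤n , ok0
strictMults⇒ ok0 (x ∷ y ∷ [])    t zero    = ℕₚ.≤ᵇ⇒≤ (x ℕ.+ y) 1 t , ok0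
strictMults⇒ ok0 (x ∷ y ∷ [])    t (suc l) = z≤n , ok0
strictMults⇒ ok0 (x ∷ y ∷ z ∷ v) t zero    =
  ℕₚ.≤ᵇ⇒≤ (x ℕ.+ y) 1 (proj₁ (T-∧⁻ t)) , proj₁ (T-∧⁻ (proj₂ (T-∧⁻ {x ℕ.+ y ≤ᵇ 1} t)))
strictMults⇒ {ok = ok} ok0 (x ∷ y ∷ z ∷ v) t (suc l) =
  strictMults⇒ ok0 v (proj₂ (T-∧⁻ {ok z} (proj₂ (T-∧⁻ {x ℕ.+ y ≤ᵇ 1} t)))) l

strictMults⇐ : ∀ {M ok} (v : Vec ℕ M) → Strict ok v → T (strictMults ok v)
strictMults⇐ []              h = tt
strictMults⇐ (x ∷ [])        h = ℕₚ.≤⇒≤ᵇ (≡.subst (ℕ._≤ 1) (ℕₚ.+-identityʳ x) (proj₁ (h 0)))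
strictMults⇐ (x ∷ y ∷ [])    h = ℕₚ.≤⇒≤ᵇ (proj₁ (h 0))
strictMults⇐ (x ∷ y ∷ z ∷ v) h = T-∧⁺ (ℕₚ.≤⇒≤ᵇ (proj₁ (h 0))) (T-∧⁺ (proj₂ (h 0)) (strictMults⇐ v (h ∘ suc)))

3[]+≡ : ∀ l r → 3[ l ]+ r ≡ 3 ℕ.* l ℕ.+ r
3[]+≡ zero    r = ≡.refl
3[]+≡ (suc l) r = ≡.trans (≡.cong (3 ℕ.+_) (3[]+≡ l r)) (≡.cong (ℕ._+ r) (≡.sym (ℕₚ.*-suc 3 l)))

entry-mult : ∀ {M} l r (v : Vec ℕ M) → entry (3[ l ]+ r) v ≡ mult (3 ℕ.* l ℕ.+ suc r) (multToParts 0 v)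
entry-mult l r v = ≡.trans (≡.sym (mult-entry (3[ l ]+ r) v))
  (≡.cong (λ p → mult p (multToParts 0 v)) (≡.trans (≡.cong suc (3[]+≡ l r)) (≡.sym (ℕₚ.+-suc (3 ℕ.* l) r))))

is3Strict-multToParts : ∀ {M} (v : Vec ℕ M) → is3Strict (multToParts 0 v) ≡ strictMults (λ _ → true) v
is3Strict-multToParts v = T-injective
  (λ t → strictMults⇐ v (λ l → ≡.subst₂ (λ a b → a ℕ.+ b ℕ.≤ 1) (≡.sym (entry-mult l 0 v)) (≡.sym (entry-mult l 1 v))
    (is3Strict⇒ (multToParts 0 v) t l) , tt))
  (λ t → is3Strict⇐ (multToParts 0 v) (λ l → ≡.subst₂ (λ a b → a ℕ.+ b ℕ.≤ 1) (entry-mult l 0 v) (entry-mult l 1 v)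
    (proj₁ (strictMults⇒ {ok = λ _ → true} tt v t l))))

isDistinct-multToParts : ∀ {M} (v : Vec ℕ M) →
  is3Strict (multToParts 0 v) ∧ isDistinct (multToParts 0 v) ≡ strictMults (_≤ᵇ 1) v
isDistinct-multToParts v = T-injective
  (λ t → let t₁ , t₂ = T-∧⁻ {is3Strict π} t in strictMults⇐ v (λ l →
    proj₁ (strictMults⇒ {ok = λ _ → true} tt v (≡.subst T (is3Strict-multToParts v) t₁) l) ,
    ℕₚ.≤⇒≤ᵇ (≡.subst (ℕ._≤ 1) (mult-entry (3[ l ]+ 2) v) (isDistinct⇒ π t₂ (suc (3[ l ]+ 2))))))
  (λ t → let h = strictMults⇒ {ok = _≤ᵇ 1} tt v t in
    T-∧⁺ (≡.subst T (≡.sym (is3Strict-multToParts v)) (strictMults⇐ v (λ l → proj₁ (h l) , tt)))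
         (isDistinct⇐ π (distinct h)))
  where
  π = multToParts 0 v
  ≤1 : ∀ {M} (v : Vec ℕ M) → Strict (_≤ᵇ 1) v → ∀ i → entry i v ℕ.≤ 1
  ≤1 []              h i                   = z≤n
  ≤1 (x ∷ v)         h 0                   = ℕₚ.≤-trans (ℕₚ.m≤m+n x _) (proj₁ (h 0))
  ≤1 (x ∷ v)         h 1                   = ℕₚ.≤-trans (ℕₚ.m≤n+m _ x) (proj₁ (h 0))
  ≤1 (x ∷ y ∷ v)     h 2                   = ℕₚ.≤ᵇ⇒≤ _ 1 (proj₂ (h 0))
  ≤1 (x ∷ [])        h (suc (suc i))       = z≤n
  ≤1 (x ∷ y ∷ [])    h (suc (suc (suc i))) = z≤n
  ≤1 (x ∷ y ∷ z ∷ v) h (suc (suc (suc i))) = ≤1 v (h ∘ suc) i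
  distinct : Strict (_≤ᵇ 1) v → ∀ p → mult p π ℕ.≤ 1
  distinct h zero    = ≡.subst (ℕ._≤ 1) (≡.sym (mult-small 0 0 v z≤n)) z≤n
  distinct h (suc i) = ≡.subst (ℕ._≤ 1) (≡.sym (mult-entry i v)) (≤1 v h i)

-- Sums over compositions as iterated convolutions

module Compositions (K : CommutativeRing c ℓ) where
  open CommutativeRing K
  open Sums K
  open PowerSeries K using (conv; δ; if-*ˡ)
  open SetoidReasoning setoid

  productAt : ∀ {k} → Vec (ℕ → Carrier) k → Vec ℕ k → Carrier
  productAt []       []      = 1#
  productAt (f ∷ fs) (t ∷ T) = f t * productAt fs T

  convs : ∀ {k} → Vec (ℕ → Carrier) k → ℕ → Carrier
  convs []       = δ
  convs (f ∷ fs) = conv f (convs fs)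

  +-∸-≡ᵇ : ∀ {t m} → t ℕ.≤ m → ∀ s → (t ℕ.+ s ≡ᵇ m) ≡ (s ≡ᵇ m ∸ t)
  +-∸-≡ᵇ ℕ.z≤n       s = ≡.refl
  +-∸-≡ᵇ (ℕ.s≤s t≤m) s = +-∸-≡ᵇ t≤m s

  -- Once the first index t is chosen, the required total drops from m to m - t while the side N of
  -- the box stays the same; the induction therefore keeps m and N apart.
  sum-compositions : ∀ {k} (fs : Vec (ℕ → Carrier) k) {m N} → m ℕ.≤ N →
    sumL (below (Vec.replicate k N)) (λ T → if vsum T ≡ᵇ m then productAt fs T else 0#) ≈ convs fs m
  sum-compositions []       {zero}  m≤N = +-identityʳ _
  sum-compositions []       {suc m} m≤N = +-identityʳ _
  sum-compositions {suc k} (f ∷ fs) {m} {N} m≤N = begin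
    sumL (below (Vec.replicate (suc k) N)) G
      ≈⟨ sumL-below N (Vec.replicate k N) G ⟩
    Σ< (suc N) g
      -- Values t > m exceed the total and contribute nothing. Cutting the range to t ≤ m makes m ∸
      -- t a true difference.
      ≈⟨ Σ<-extend g (ℕ.s≤s m≤N) (λ t m<t → trans (sumL-cong Ts (λ T → reflexive (≡.cong (λ b → if b then productAt (f ∷ fs) (t ∷ T) else 0#)
           (≢⇒≡ᵇ-false (t ℕ.+ vsum T) m (ℕₚ.>⇒≢ (ℕₚ.≤-trans m<t (ℕₚ.m≤m+n t (vsum T)))))))) (sumL-0 Ts)) ⟨
    Σ< (suc m) g
      ≈⟨ Σ<-cong-< (suc m) (λ { t (ℕ.s≤s t≤m) → begin
           g t
             ≈⟨ sumL-cong Ts (λ T → trans (reflexive (≡.cong (λ b → if b then f t * productAt fs T else 0#) (+-∸-≡ᵇ t≤m (vsum T))))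
                  (sym (if-*ˡ (vsum T ≡ᵇ m ∸ t) (f t) (productAt fs T)))) ⟩
           sumL Ts (λ T → f t * (if vsum T ≡ᵇ m ∸ t then productAt fs T else 0#))
             ≈⟨ sumL-*ˡ Ts (f t) (λ T → if vsum T ≡ᵇ m ∸ t then productAt fs T else 0#) ⟩
           f t * sumL Ts (λ T → if vsum T ≡ᵇ m ∸ t then productAt fs T else 0#)
             ≈⟨ *-congˡ (sum-compositions fs (ℕₚ.≤-trans (ℕₚ.m∸n≤m m t) m≤N)) ⟩
           f t * convs fs (m ∸ t) ∎ }) ⟩
    convs (f ∷ fs) m ∎
    where
    Ts = below (Vec.replicate k N)
    G : Vec ℕ (suc k) → Carrier
    G T = if vsum T ≡ᵇ m then productAt (f ∷ fs) T else 0#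
    g : ℕ → Carrier
    g t = sumL Ts (λ T → G (t ∷ T))

-- Degree, periodicity and exchange of row weights

vsum-vadd : ∀ {n} (u v : Vec ℕ n) → vsum (vadd u v) ≡ vsum u ℕ.+ vsum v
vsum-vadd []      []      = ≡.refl
vsum-vadd (x ∷ u) (y ∷ v) = ≡.trans (≡.cong (x ℕ.+ y ℕ.+_) (vsum-vadd u v)) (interchange x y (vsum u) (vsum v))
  where open import Algebra.Properties.CommutativeSemigroup ℕₚ.+-commutativeSemigroup using (interchange)

vsum-unitV : ∀ i → vsum (unitV i) ≡ 1
vsum-unitV Fin.zero = ≡.refl
vsum-unitV (Fin.suc Fin.zero) = ≡.refl
vsum-unitV (Fin.suc (Fin.suc Fin.zero)) = ≡.refl
vsum-unitV (Fin.suc (Fin.suc (Fin.suc Fin.zero))) = ≡.refl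
vsum-unitV (Fin.suc (Fin.suc (Fin.suc (Fin.suc Fin.zero)))) = ≡.refl
vsum-unitV (Fin.suc (Fin.suc (Fin.suc (Fin.suc (Fin.suc Fin.zero))))) = ≡.refl

-- `rowWeight` for an arbitrary list of cells: the tail of `upTo (suc L)` is a shifted list rather
-- than `upTo L`, so inductions run over general lists.
cellsWeight : Bool → List ℕ → Vec ℕ 6
cellsWeight o = foldr (λ k w → vadd (unitV (label o k)) w) (Vec.replicate 6 0)

vsum-cellsWeight : ∀ o ks → vsum (cellsWeight o ks) ≡ length ks
vsum-cellsWeight o []       = ≡.refl
vsum-cellsWeight o (k ∷ ks) = ≡.trans (vsum-vadd (unitV (label o k)) (cellsWeight o ks))
  (≡.cong₂ ℕ._+_ (vsum-unitV (label o k)) (vsum-cellsWeight o ks))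

-- Each cell contributes one variable. This ties the size filter of `partitionsUpTo` to the exponent
-- e, and it bounds the number of nonempty rows by the degree.
vsum-weightFrom : ∀ o π → vsum (weightFrom o π) ≡ sum π
vsum-weightFrom o []      = ≡.refl
vsum-weightFrom o (L ∷ π) = ≡.trans (vsum-vadd (rowWeight o L) (weightFrom (not o) π))
  (≡.cong₂ ℕ._+_ (≡.trans (vsum-cellsWeight o (upTo L)) (length-upTo L)) (vsum-weightFrom (not o) π))

cellsWeight-period : ∀ o L → cellsWeight o (applyUpTo (3 ℕ.+_) L) ≡ rowWeight o L
cellsWeight-period o L = go L id
  where
  label-period : ∀ o k → label o (3 ℕ.+ k) ≡ label o k
  label-period true  k = ≡.refl
  label-period false k = ≡.refl
  go : ∀ L (g : ℕ → ℕ) → cellsWeight o (applyUpTo (λ k → 3 ℕ.+ g k) L) ≡ cellsWeight o (applyUpTo g L)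
  go zero    g = ≡.refl
  go (suc L) g = ≡.cong₂ vadd (≡.cong unitV (label-period o (g 0))) (go L (g ∘ suc))

sum-replicate : ∀ x L → sum (replicate x L) ≡ x ℕ.* L
sum-replicate zero    L = ≡.refl
sum-replicate (suc x) L = ≡.cong (L ℕ.+_) (sum-replicate x L)

sum-multToParts : ∀ {M} k (v : Vec ℕ M) →
  sum (multToParts k v) ≡ vsum (Vec.zipWith ℕ._*_ (Vec.tabulate (λ i → suc (k ℕ.+ toℕ i))) v)
sum-multToParts k []      = ≡.refl
sum-multToParts k (x ∷ v) = begin
  sum (multToParts (suc k) v ++ replicate x (suc k))
    ≡⟨ sum-++ (multToParts (suc k) v) (replicate x (suc k)) ⟩
  sum (multToParts (suc k) v) ℕ.+ sum (replicate x (suc k))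
    ≡⟨ ≡.cong₂ ℕ._+_ (sum-multToParts (suc k) v) (≡.trans (sum-replicate x (suc k)) (ℕₚ.*-comm x (suc k))) ⟩
  vsum (Vec.zipWith ℕ._*_ (Vec.tabulate (λ i → suc (suc k ℕ.+ toℕ i))) v) ℕ.+ suc k ℕ.* x
    ≡⟨ ℕₚ.+-comm _ (suc k ℕ.* x) ⟩
  suc k ℕ.* x ℕ.+ vsum (Vec.zipWith ℕ._*_ (Vec.tabulate (λ i → suc (suc k ℕ.+ toℕ i))) v)
    ≡⟨ ≡.cong₂ (λ m f → suc m ℕ.* x ℕ.+ vsum (Vec.zipWith ℕ._*_ f v)) (ℕₚ.+-identityʳ k) (Vecₚ.tabulate-cong (λ i → ≡.cong suc (ℕₚ.+-suc k (toℕ i)))) ⟨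
  vsum (Vec.zipWith ℕ._*_ (Vec.tabulate (λ i → suc (k ℕ.+ toℕ i))) (x ∷ v)) ∎
  where open ≡.≡-Reasoning

swap-vadd : ∀ u v → swapHalves (vadd u v) ≡ vadd (swapHalves u) (swapHalves v)
swap-vadd (_ ∷ _ ∷ _ ∷ _ ∷ _ ∷ _ ∷ []) (_ ∷ _ ∷ _ ∷ _ ∷ _ ∷ _ ∷ []) = ≡.refl

swap-↑ˡ : ∀ (i : Fin 3) → swapHalves (unitV (i Fin.↑ˡ 3)) ≡ unitV (3 Fin.↑ʳ i)
swap-↑ˡ Fin.zero                     = ≡.refl
swap-↑ˡ (Fin.suc Fin.zero)           = ≡.refl
swap-↑ˡ (Fin.suc (Fin.suc Fin.zero)) = ≡.refl

swap-involutive : ∀ u → swapHalves (swapHalves u) ≡ u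
swap-involutive (_ ∷ _ ∷ _ ∷ _ ∷ _ ∷ _ ∷ []) = ≡.refl

swap-unitV : ∀ o k → swapHalves (unitV (label o k)) ≡ unitV (label (not o) k)
swap-unitV true  k = swap-↑ˡ (k mod 3)
swap-unitV false k = ≡.trans (≡.cong swapHalves (≡.sym (swap-↑ˡ (k mod 3)))) (swap-involutive _)

swap-cellsWeight : ∀ o ks → swapHalves (cellsWeight o ks) ≡ cellsWeight (not o) ks
swap-cellsWeight o []       = ≡.refl
swap-cellsWeight o (k ∷ ks) = ≡.trans (swap-vadd (unitV (label o k)) (cellsWeight o ks))
  (≡.cong₂ vadd (swap-unitV o k) (swap-cellsWeight o ks))

-- Exchanging abc with def exchanges the types of all rows at once. Thus the series at (d, e, f, a,
-- b, c) counts the same partitions with the top row read as an even one.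
swap-weightFrom : ∀ o π → swapHalves (weightFrom o π) ≡ weightFrom (not o) π
swap-weightFrom o []      = ≡.refl
swap-weightFrom o (L ∷ π) = ≡.trans (swap-vadd (rowWeight o L) (weightFrom (not o) π))
  (≡.cong₂ vadd (swap-cellsWeight o (upTo L)) (swap-weightFrom (not o) π))

eqVec-refl : ∀ {n} (e : Vec ℕ n) → T (eqVec e e)
eqVec-refl []      = _
eqVec-refl (x ∷ e) = T-∧⁺ (ℕₚ.≡⇒≡ᵇ x x ≡.refl) (eqVec-refl e)

eqVec-swap : ∀ u e → eqVec u (swapHalves e) ≡ eqVec (swapHalves u) e
eqVec-swap u e = T-injective
  (λ t → ≡.subst (λ w → T (eqVec w e)) (≡.trans (≡.sym (swap-involutive e)) (≡.cong swapHalves (≡.sym (eqVec⇒≡ u (swapHalves e) t)))) (eqVec-refl e))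
  (λ t → ≡.subst (λ w → T (eqVec u w)) (≡.trans (≡.sym (swap-involutive u)) (≡.cong swapHalves (eqVec⇒≡ (swapHalves u) e t))) (eqVec-refl u))

vsum-swap : ∀ e → vsum (swapHalves e) ≡ vsum e
vsum-swap (x₀ ∷ x₁ ∷ x₂ ∷ x₃ ∷ x₄ ∷ x₅ ∷ []) =
  solve 6 (λ a b c d e f → d :+ (e :+ (f :+ (a :+ (b :+ (c :+ con 0))))) := a :+ (b :+ (c :+ (d :+ (e :+ (f :+ con 0))))))
    ≡.refl x₀ x₁ x₂ x₃ x₄ x₅
  where open import Data.Nat.Solver using (module +-*-Solver); open +-*-Solver

-- Counting partitions as a sum over multiplicity vectors

indicator : Bool → ℤ
indicator b = if b then + 1 else + 0

count≡sum : ∀ {A : Set} (P : A → Bool) xs → + count P xs ≡ ℤSums.sumL xs (indicator ∘ P)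
count≡sum P []       = ≡.refl
count≡sum P (x ∷ xs) = ≡.trans (ℤₚ.pos-+ (if P x then 1 else 0) (count P xs)) (≡.cong₂ ℤ._+_ (head (P x)) (count≡sum P xs))
  where
  head : ∀ b → + (if b then 1 else 0) ≡ indicator b
  head true  = ≡.refl
  head false = ≡.refl

-- The size condition of partitionsUpTo is implied by the weight condition.
count-partitions : ∀ M n (P : List ℕ → Bool) o e → vsum e ≡ n →
  + count (λ π → P π ∧ eqVec (weightFrom o π) e) (partitionsUpTo M n) ≡
  ℤSums.sumL (below (Vec.replicate M n)) (λ v → if P (multToParts 0 v) then monoV (weightFrom o (multToParts 0 v)) e else + 0)
count-partitions M n P o e vsum≡n = begin
  + count Q (partitionsUpTo M n)               ≡⟨ count≡sum Q (partitionsUpTo M n) ⟩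
  ℤSums.sumL (partitionsUpTo M n) (indicator ∘ Q)
    ≡⟨ ℤSums.sumL-map (multToParts 0) (filterᵇ size≡n vs) (indicator ∘ Q) ⟩
  ℤSums.sumL (filterᵇ size≡n vs) (indicator ∘ Q ∘ multToParts 0)
    ≡⟨ ℤSums.sumL-filterᵇ size≡n vs (indicator ∘ Q ∘ multToParts 0) ⟩
  ℤSums.sumL vs (λ v → if size≡n v then indicator (Q (multToParts 0 v)) else + 0)
    ≡⟨ ℤSums.sumL-cong vs pointwise ⟩
  ℤSums.sumL vs (λ v → if P (multToParts 0 v) then monoV (weightFrom o (multToParts 0 v)) e else + 0) ∎
  where
  open ≡.≡-Reasoning
  vs = below (Vec.replicate M n)
  Q : List ℕ → Bool
  Q π = P π ∧ eqVec (weightFrom o π) e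
  size≡n : Vec ℕ M → Bool
  size≡n v = vsum (Vec.zipWith ℕ._*_ (Vec.tabulate (λ i → suc (toℕ i))) v) ≡ᵇ n
  pointwise : ∀ v → (if size≡n v then indicator (Q (multToParts 0 v)) else + 0)
    ≡ (if P (multToParts 0 v) then monoV (weightFrom o (multToParts 0 v)) e else + 0)
  pointwise v with P (multToParts 0 v) | eqVec (weightFrom o (multToParts 0 v)) e in eq | size≡n v in size
  ... | false | _     | true  = ≡.refl
  ... | false | _     | false = ≡.refl
  ... | true  | false | true  = ≡.refl
  ... | true  | false | false = ≡.refl
  ... | true  | true  | true  = ≡.refl
  ... | true  | true  | false with () ← ≡.subst T size (ℕₚ.≡⇒≡ᵇ _ n (≡.trans (≡.sym (sum-multToParts 0 v))
          (≡.trans (≡.sym (vsum-weightFrom o (multToParts 0 v)))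
            (≡.trans (≡.cong vsum (eqVec⇒≡ (weightFrom o (multToParts 0 v)) e (≡.subst T (≡.sym eq) _))) vsum≡n))))

-- The series of the theorem

module S = CommutativeRing (seriesRing 6)
module RowSeries where
  open import Algebra.Properties.CommutativeSemiring.Exp S.commutativeSemiring
  open SetoidReasoning S.setoid
  open IntegerSolver (seriesRing 6)

  r : Bool → ℕ → Series
  r o L = mono (rowWeight o L)

  period : Bool → Series
  period true  = va ⊛ vb ⊛ vc
  period false = vd ⊛ ve ⊛ vf

  vR≈ : ∀ o → vR S.≈ period o ⊛ period (not o)
  vR≈ true  = solve 6 (λ a b c d e f → a :* b :* c :* d :* e :* f := a :* b :* c :* (d :* e :* f)) (λ _ → ≡.refl) va vb vc vd ve vf
  vR≈ false = solve 6 (λ a b c d e f → a :* b :* c :* d :* e :* f := d :* e :* f :* (a :* b :* c)) (λ _ → ≡.refl) va vb vc vd ve vf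

  ^ˢ≡^ : ∀ f n → f ^ˢ n ≡ f ^ n
  ^ˢ≡^ f zero    = ≡.refl
  ^ˢ≡^ f (suc n) = ≡.cong (f ⊛_) (^ˢ≡^ f n)

  r-3+ : ∀ o L → r o (3 ℕ.+ L) S.≈ period o ⊛ r o L
  r-3+ o L = begin
    mono (vadd u₀ (vadd u₁ (vadd u₂ w)))             ≈⟨ monoV-+ u₀ (vadd u₁ (vadd u₂ w)) ⟨
    mono u₀ ⊛ mono (vadd u₁ (vadd u₂ w))
      ≈⟨ S.*-congˡ {mono u₀} (λ e → ≡.sym (monoV-+ u₁ (vadd u₂ w) e)) ⟩
    mono u₀ ⊛ (mono u₁ ⊛ mono (vadd u₂ w))
      ≈⟨ S.*-congˡ {mono u₀} (S.*-congˡ {mono u₁} (λ e → ≡.sym (monoV-+ u₂ w e))) ⟩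
    mono u₀ ⊛ (mono u₁ ⊛ (mono u₂ ⊛ mono w))
      ≈⟨ solve 4 (λ a b c w → a :* (b :* (c :* w)) := a :* b :* c :* w) (λ _ → ≡.refl) (mono u₀) (mono u₁) (mono u₂) (mono w) ⟩
    mono u₀ ⊛ mono u₁ ⊛ mono u₂ ⊛ mono w
      ≡⟨ ≡.cong₂ (λ p w → p ⊛ mono w) (period≡ o) (cellsWeight-period o L) ⟩
    period o ⊛ r o L                                 ∎
    where
    u₀ = unitV (label o 0)
    u₁ = unitV (label o 1)
    u₂ = unitV (label o 2)
    w = cellsWeight o (applyUpTo (3 ℕ.+_) L)
    period≡ : ∀ o → mono (unitV (label o 0)) ⊛ mono (unitV (label o 1)) ⊛ mono (unitV (label o 2)) ≡ period o
    period≡ true  = ≡.refl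
    period≡ false = ≡.refl

  r-3[]+ : ∀ o j μ → r o (3[ j ]+ μ) S.≈ period o ^ j ⊛ r o μ
  r-3[]+ o zero    μ = S.sym {x = 𝟙 ⊛ r o μ} (S.*-identityˡ (r o μ))
  r-3[]+ o (suc j) μ = begin
    r o (3 ℕ.+ (3[ j ]+ μ))                ≈⟨ r-3+ o (3[ j ]+ μ) ⟩
    period o ⊛ r o (3[ j ]+ μ)             ≈⟨ S.*-congˡ {period o} (r-3[]+ o j μ) ⟩
    period o ⊛ (period o ^ j ⊛ r o μ)      ≈⟨ S.*-assoc (period o) (period o ^ j) (r o μ) ⟨
    period o ^ suc j ⊛ r o μ               ∎

  r-full : ∀ o j → r o (3[ j ]+ 0) S.≈ period o ^ j
  r-full o j = begin
    r o (3[ j ]+ 0)         ≈⟨ r-3[]+ o j 0 ⟩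
    period o ^ j ⊛ 𝟙        ≈⟨ S.*-identityʳ (period o ^ j) ⟩
    period o ^ j            ∎

  r-+3[] : ∀ o j μ → r o (μ ℕ.+ (3[ j ]+ 0)) S.≈ period o ^ j ⊛ r o μ
  r-+3[] o j μ = begin
    r o (μ ℕ.+ (3[ j ]+ 0)) ≡⟨ ≡.cong (r o) (shift j) ⟩
    r o (3[ j ]+ μ)         ≈⟨ r-3[]+ o j μ ⟩
    period o ^ j ⊛ r o μ    ∎
    where
    shift : ∀ j → μ ℕ.+ (3[ j ]+ 0) ≡ 3[ j ]+ μ
    shift j = ≡.trans (ℕₚ.+-comm μ (3[ j ]+ 0))
      (≡.trans (≡.cong (ℕ._+ μ) (≡.trans (3[]+≡ j 0) (ℕₚ.+-identityʳ _))) (≡.sym (3[]+≡ j μ)))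

  r-square : ∀ o j → r o (3[ j ]+ 0) ⊛ r (not o) (3[ j ]+ 0) S.≈ vR ^ˢ j
  r-square o j = begin
    r o (3[ j ]+ 0) ⊛ r (not o) (3[ j ]+ 0)
      ≈⟨ S.*-cong {r o (3[ j ]+ 0)} {period o ^ j} (r-full o j) (r-full (not o) j) ⟩
    period o ^ j ⊛ period (not o) ^ j         ≈⟨ ^-distrib-* (period o) (period (not o)) j ⟨
    (period o ⊛ period (not o)) ^ j           ≈⟨ ^-congˡ j {vR} {period o ⊛ period (not o)} (vR≈ o) ⟨
    vR ^ j                                    ≡⟨ ^ˢ≡^ vR j ⟨
    vR ^ˢ j                                   ∎

  -- Links the powers of R with the constant exponent vectors through which `geomR` is defined.
  vR^≈mono : ∀ i → vR ^ˢ i S.≈ mono (Vec.replicate 6 i)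
  vR^≈mono zero    e = ≡.refl
  vR^≈mono (suc i) = begin
    vR ⊛ vR ^ˢ i
      ≈⟨ S.*-cong {vR} {mono (Vec.replicate 6 1)} vR≈mono (vR^≈mono i) ⟩
    mono (Vec.replicate 6 1) ⊛ mono (Vec.replicate 6 i) ≈⟨ monoV-+ (Vec.replicate 6 1) (Vec.replicate 6 i) ⟩
    mono (Vec.replicate 6 (suc i))                   ∎
    where
    vR≈mono : vR S.≈ mono (Vec.replicate 6 1)
    vR≈mono = times (va ⊛ vb ⊛ vc ⊛ vd ⊛ ve) (# 1 1 1 1 1 0) (# 0 0 0 0 0 1)
      (times (va ⊛ vb ⊛ vc ⊛ vd) (# 1 1 1 1 0 0) (# 0 0 0 0 1 0)
        (times (va ⊛ vb ⊛ vc) (# 1 1 1 0 0 0) (# 0 0 0 1 0 0)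
          (times (va ⊛ vb) (# 1 1 0 0 0 0) (# 0 0 1 0 0 0) (monoV-+ (# 1 0 0 0 0 0) (# 0 1 0 0 0 0)))))
      where
      # : ℕ → ℕ → ℕ → ℕ → ℕ → ℕ → Vec ℕ 6
      # a b c d e f = a ∷ b ∷ c ∷ d ∷ e ∷ f ∷ []
      times : ∀ f u v → f S.≈ mono u → f ⊛ mono v S.≈ mono (vadd u v)
      times f u v e = begin
        f ⊛ mono v       ≈⟨ S.*-congʳ {mono v} {f} {mono u} e ⟩
        mono u ⊛ mono v  ≈⟨ monoV-+ u v ⟩
        mono (vadd u v)  ∎

open RowSeries

open RowWeights (seriesRing 6) r using () renaming (distinct to distinctˢ; remainder to remainderˢ)

-- Evaluation modulo degree greater than n

module Truncated (n : ℕ) where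
  open CommutativeRing (truncatedRing 6 n)
  open import Algebra.Properties.Semiring.Exp semiring using (_^_)
  open Sums (truncatedRing 6 n)
  open RowWeights (truncatedRing 6 n) r
  open IntegerSolver (truncatedRing 6 n)
  open SetoidReasoning setoid

  exact : ∀ {f g} → f S.≈ g → f ≈ g
  exact e v _ = e v

  ^ˢ≡^ᵀ : ∀ f k → f ^ˢ k ≡ f ^ k
  ^ˢ≡^ᵀ f zero    = ≡.refl
  ^ˢ≡^ᵀ f (suc k) = ≡.cong (f ⊛_) (^ˢ≡^ᵀ f k)

  sumL-at : ∀ {A : Set} (xs : List A) F e → sumL xs F e ≡ ℤSums.sumL xs (λ x → F x e)
  sumL-at []       F e = ≡.refl
  sumL-at (x ∷ xs) F e = ≡.cong (λ s → F x e ℤ.+ s) (sumL-at xs F e)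

  Σ<-at : ∀ m f e → Σ< m f e ≡ ℤSums.Σ< m (λ i → f i e)
  Σ<-at zero    f e = ≡.refl
  Σ<-at (suc m) f e = ≡.cong (λ s → f 0 e ℤ.+ s) (Σ<-at m (f ∘ suc) e)

  lastRow : Bool → List ℕ → Bool
  lastRow o []      = o
  lastRow o (L ∷ π) = lastRow (not o) π

  W≈mono : ∀ o π h → W o π h ≈ mono (weightFrom o π) * h (lastRow o π)
  W≈mono o []      h = sym {𝟙 * h o} {h o} (*-identityˡ (h o))
  W≈mono o (L ∷ π) h = begin
    r o L * W (not o) π h
      ≈⟨ *-congˡ {r o L} (W≈mono (not o) π h) ⟩
    r o L * (mono (weightFrom (not o) π) * h (lastRow (not o) π))
      ≈⟨ *-assoc (r o L) (mono (weightFrom (not o) π)) (h (lastRow (not o) π)) ⟨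
    r o L * mono (weightFrom (not o) π) * h (lastRow (not o) π)
      ≈⟨ *-congʳ {h (lastRow (not o) π)} (exact (monoV-+ (rowWeight o L) (weightFrom (not o) π))) ⟩
    mono (weightFrom o (L ∷ π)) * h (lastRow o (L ∷ π))                ∎

  -- More than n rows of positive length contain more than n cells, so the monomial in front has
  -- degree above n.
  vanish : ∀ o L x h → n ℕ.< x → W o (replicate x (suc L)) h ≈ 0#
  vanish o L x h n<x = begin
    W o π h                                         ≈⟨ W≈mono o π h ⟩
    mono (weightFrom o π) * h (lastRow o π)
      ≈⟨ *-congʳ {h (lastRow o π)} (monoV-large (weightFrom o π) n<size) ⟩
    0# * h (lastRow o π)                            ≈⟨ zeroˡ (h (lastRow o π)) ⟩
    0#                                              ∎
    where
    π = replicate x (suc L)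
    n<size : n ℕ.< vsum (weightFrom o π)
    n<size = ≡.subst (n ℕ.<_) (≡.sym (≡.trans (vsum-weightFrom o π) (sum-replicate x (suc L))))
      (ℕₚ.<-≤-trans n<x (ℕₚ.m≤m*n x (suc L)))

  -- Modulo degree n the geometric series is a finite sum, which telescopes.
  geomR-equation : ∀ i → geomR (suc i) ≈ 1# + vR ^ˢ suc i * geomR (suc i)
  geomR-equation i = begin
    geomR (suc i)                    ≈⟨ geomR≈Σ ⟩
    Σ< (suc n) g
      ≈⟨ Σ<-extend g (ℕₚ.n≤1+n (suc n)) (λ k n<k → monoV-large (Vec.replicate 6 (suc i ℕ.* k)) (large k n<k)) ⟩
    g 0 + Σ< (suc n) (g ∘ suc)
      ≈⟨ +-cong {g 0} {1#} {Σ< (suc n) (g ∘ suc)} {ρ * Σ< (suc n) g} (reflexive (≡.cong (mono ∘ Vec.replicate 6) (ℕₚ.*-zeroʳ i)))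
                                          (trans {Σ< (suc n) (g ∘ suc)} {Σ< (suc n) (λ k → ρ * g k)} {ρ * Σ< (suc n) g}
                                            (Σ<-cong (suc n) {g ∘ suc} {λ k → ρ * g k} g-suc) (Σ<-*ˡ (suc n) ρ g)) ⟩
    1# + ρ * Σ< (suc n) g
      ≈⟨ +-congˡ {1#} {ρ * Σ< (suc n) g} {vR ^ˢ suc i * geomR (suc i)} (*-cong {ρ} {vR ^ˢ suc i} {Σ< (suc n) g} {geomR (suc i)} (λ e _ → ≡.sym (vR^≈mono (suc i) e)) (λ e e≤ → ≡.sym (geomR≈Σ e e≤))) ⟩
    1# + vR ^ˢ suc i * geomR (suc i) ∎
    where
    g : ℕ → Series
    g k = mono (Vec.replicate 6 (suc i ℕ.* k))
    ρ = mono (Vec.replicate 6 (suc i))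
    g-suc : ∀ k → g (suc k) ≈ ρ * g k
    g-suc k e _ = ≡.trans (≡.cong (λ m → mono (Vec.replicate 6 m) e) (ℕₚ.*-suc (suc i) k))
      (≡.sym (monoV-+ (Vec.replicate 6 (suc i)) (Vec.replicate 6 (suc i ℕ.* k)) e))
    large : ∀ k → suc n ℕ.≤ k → n ℕ.< vsum (Vec.replicate 6 (suc i ℕ.* k))
    large k n<k = ℕₚ.≤-trans n<k (ℕₚ.≤-trans (ℕₚ.m≤n*m k (suc i)) (ℕₚ.m≤m+n (suc i ℕ.* k) _))
    geomR≈Σ : geomR (suc i) ≈ Σ< (suc n) g
    -- The count defining `geomR` stops at the first entry h of e. Larger indices cannot match e, so
    -- the range extends to the common bound n.
    geomR≈Σ e@(h ∷ t) e≤n = ≡.trans (count≡sum P (upTo (suc h)))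
      (≡.trans (ℤSums.sumL-applyUpTo id (suc h) (indicator ∘ P))
      (≡.trans (ℤSums.Σ<-extend (indicator ∘ P) (ℕ.s≤s (ℕₚ.≤-trans (ℕₚ.m≤m+n h _) e≤n)) beyond)
        (≡.sym (Σ<-at (suc n) g e))))
      where
      P : ℕ → Bool
      P k = eqVec (Vec.replicate 6 (suc i ℕ.* k)) e
      beyond : ∀ k → suc h ℕ.≤ k → indicator (P k) ≡ + 0
      beyond k h<k = ≡.cong (λ b → indicator (b ∧ eqVec (Vec.replicate 5 (suc i ℕ.* k)) t))
        (≢⇒≡ᵇ-false (suc i ℕ.* k) h (ℕₚ.>⇒≢ (ℕₚ.<-≤-trans h<k (ℕₚ.m≤n*m k (suc i)))))

  -- The two instances of the row weights, modulo degree and in full, run the same recursion.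
  -- Identifying them makes the closed form independent of n.
  distinct≈ : ∀ j o → distinct j o ≈ distinctˢ j o
  distinct≈ zero    o e _ = ≡.refl
  distinct≈ (suc j) o     = step-cong (3[ j ]+ 0) {distinct j} {distinctˢ j} o (distinct≈ j)

  total≈ : ∀ ok o M → total n ok o 0 M (λ _ → 1#) ≈
    sumL (below (Vec.replicate M n)) (λ v → if strictMults ok v then mono (weightFrom o (multToParts 0 v)) else 0#)
  total≈ ok o M = sumL-cong (below (Vec.replicate M n)) λ v →
    []-cong (strictMults ok v) {W o (multToParts 0 v) (λ _ → 1#)} {mono (weightFrom o (multToParts 0 v))}
      (trans {W o (multToParts 0 v) (λ _ → 1#)} {mono (weightFrom o (multToParts 0 v)) * 1#} {mono (weightFrom o (multToParts 0 v))}
        (W≈mono o (multToParts 0 v) (λ _ → 1#)) (*-identityʳ (mono (weightFrom o (multToParts 0 v)))))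

  remainder≡ : ∀ μ k h o → remainder μ k h o ≡ remainderˢ μ k h o
  remainder≡ zero             k h o = ≡.refl
  remainder≡ (suc zero)       k h o = ≡.refl
  remainder≡ (suc (suc zero)) k h o = ≡.refl

  closed-form-distinct : ∀ N μ o →
    total n (_≤ᵇ 1) o 0 (3[ N ]+ toℕ μ) (λ _ → 1#) ≈ remainderˢ μ (3[ N ]+ 0) (distinctˢ N) o
  closed-form-distinct N μ o = begin
    total n (_≤ᵇ 1) o 0 (3[ N ]+ toℕ μ) (λ _ → 1#)       ≈⟨ total-full n vanish (_≤ᵇ 1) o N (toℕ μ) ⟩
    total n (_≤ᵇ 1) o k (toℕ μ) (full n vanish (_≤ᵇ 1) N)
      ≈⟨ total-remainder n vanish μ (_≤ᵇ 1) o k (full n vanish (_≤ᵇ 1) N) ⟩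
    remainder μ k (full n vanish (_≤ᵇ 1) N) o            ≈⟨ remainder-cong μ k o (full-distinct n vanish N) ⟩
    remainder μ k (distinct N) o                         ≈⟨ remainder-cong μ k o (distinct≈ N) ⟩
    remainder μ k (distinctˢ N) o                        ≡⟨ remainder≡ μ k (distinctˢ N) o ⟩
    remainderˢ μ k (distinctˢ N) o                       ∎
    where
    k = 3[ N ]+ 0

-- The coefficient at e is read in the truncation at the degree of e, where nothing is lost.
geomR-equation : ∀ i → geomR (suc i) S.≈ 𝟙 ⊕ vR ^ˢ suc i ⊛ geomR (suc i)
geomR-equation i e = Truncated.geomR-equation (vsum e) i e ℕₚ.≤-refl

-- Closed forms of the partition series

open import Algebra.Properties.CommutativeSemiring.Exp S.commutativeSemiring
open SetoidReasoning S.setoid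
open IntegerSolver (seriesRing 6)
open RowWeights (seriesRing 6) r using (distinct; remainder; lower; step)

-- The additive form of (1 - R^(n+1)) / (R; R)_(n+1) = 1 / (R; R)_n, obtained from g = 1 + R^(n+1) g
-- for the geometric series g.
invPoch-suc : ∀ n → invPoch (suc n) S.≈ vR ^ suc n ⊛ invPoch (suc n) ⊕ invPoch n
invPoch-suc n = begin
  invPoch n ⊛ g                                     ≈⟨ S.*-congˡ {invPoch n} (geomR-equation n) ⟩
  invPoch n ⊛ (𝟙 ⊕ vR ^ˢ suc n ⊛ g)
    ≡⟨ ≡.cong (λ ρ → invPoch n ⊛ (𝟙 ⊕ ρ ⊛ g)) (^ˢ≡^ vR (suc n)) ⟩
  invPoch n ⊛ (𝟙 ⊕ vR ^ suc n ⊛ g)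
    ≈⟨ solve 3 (λ i ρ g → i :* (con (+ 1) :+ ρ :* g) := ρ :* (i :* g) :+ i) (λ _ → ≡.refl) (invPoch n) (vR ^ suc n) g ⟩
  vR ^ suc n ⊛ (invPoch n ⊛ g) ⊕ invPoch n          ∎
  where g = geomR (suc n)

poch-suc : ∀ n → poch (suc n) S.≈ poch n ⊛ (𝟙 ⊖ vR ^ suc n)
poch-suc n e = ≡.cong (λ ρ → (poch n ⊛ (𝟙 ⊖ ρ)) e) (^ˢ≡^ vR (suc n))

module Q = QSeries (seriesRing 6) vR
module P = Q.Pochhammer poch invPoch (λ _ → ≡.refl) poch-suc (λ _ → ≡.refl) invPoch-suc

module _ (n : ℕ) where
  open Truncated n using (vanish; ^ˢ≡^ᵀ; exact; distinct≈; remainder≡)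
  private
    module R = RowWeights (truncatedRing 6 n) r
    module E = SetoidReasoning (CommutativeRing.setoid (truncatedRing 6 n))
  open CommutativeRing (truncatedRing 6 n) using (_≈_; *-congˡ; *-congʳ; *-assoc; *-identityˡ)

  full≈ : ∀ N o → R.full n vanish (λ _ → true) N o ≈ invPoch N ⊛ R.distinct N o
  full≈ N o = E.begin
    f                              E.≈⟨ *-identityˡ f ⟨
    𝟙 ⊛ f                          E.≈⟨ *-congʳ {f} (exact (P.inv-poch N)) ⟨
    invPoch N ⊛ poch N ⊛ f         E.≈⟨ *-assoc (invPoch N) (poch N) f ⟩
    invPoch N ⊛ (poch N ⊛ f)       E.≈⟨ *-congˡ {invPoch N} (R.poch-full n vanish {vR} poch (λ _ _ → ≡.refl)
                                         (λ j e _ → ≡.cong (λ ρ → (poch j ⊛ (𝟙 ⊖ ρ)) e) (^ˢ≡^ᵀ vR (suc j)))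
                                         (λ o j e _ → ≡.trans (r-square o (suc j) e) (≡.cong (λ ρ → ρ e) (^ˢ≡^ᵀ vR (suc j)))) N o) ⟩
    invPoch N ⊛ R.distinct N o     E.∎
    where f = R.full n vanish (λ _ → true) N o

  -- The leftover parts 3N + 1 and 3N + 2 occur at most once in total, so `remainder` is linear in
  -- the stage below it, and the factor 1 / (R; R)_N produced by the multiples of 3 comes out
  -- unchanged.
  closed-form-strict : ∀ N μ o →
    R.total n (λ _ → true) o 0 (3[ N ]+ toℕ μ) (λ _ → 𝟙) ≈ invPoch N ⊛ remainder μ (3[ N ]+ 0) (distinct N) o
  closed-form-strict N μ o = E.begin
    R.total n (λ _ → true) o 0 (3[ N ]+ toℕ μ) (λ _ → 𝟙)
      E.≈⟨ R.total-full n vanish (λ _ → true) o N (toℕ μ) ⟩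
    R.total n (λ _ → true) o k (toℕ μ) (R.full n vanish (λ _ → true) N)
      E.≈⟨ R.total-remainder n vanish μ (λ _ → true) o k (R.full n vanish (λ _ → true) N) ⟩
    R.remainder μ k (R.full n vanish (λ _ → true) N) o      E.≈⟨ R.remainder-cong μ k o (full≈ N) ⟩
    R.remainder μ k (λ o′ → invPoch N ⊛ R.distinct N o′) o
      E.≈⟨ R.remainder-scale μ k (invPoch N) (R.distinct N) o ⟩
    invPoch N ⊛ R.remainder μ k (R.distinct N) o
      E.≈⟨ *-congˡ {invPoch N} (R.remainder-cong μ k o (distinct≈ N)) ⟩
    invPoch N ⊛ R.remainder μ k (distinct N) o
      E.≡⟨ ≡.cong (invPoch N ⊛_) (remainder≡ μ k (distinct N) o) ⟩
    invPoch N ⊛ remainder μ k (distinct N) o                E.∎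
    where k = 3[ N ]+ 0

count-cong : ∀ {A : Set} {P Q : A → Bool} xs → (∀ x → P x ≡ Q x) → count P xs ≡ count Q xs
count-cong []       e = ≡.refl
count-cong (x ∷ xs) e = ≡.cong₂ (λ b m → (if b then 1 else 0) ℕ.+ m) (e x) (count-cong xs e)

count≡total : ∀ M (P : List ℕ → Bool) ok o e → (∀ v → P (multToParts 0 v) ≡ strictMults ok v) →
  + count (λ π → P π ∧ eqVec (weightFrom o π) e) (partitionsUpTo M (vsum e)) ≡
  RowWeights.total (truncatedRing 6 (vsum e)) r (vsum e) ok o 0 M (λ _ → 𝟙) e
count≡total M P ok o e P≡ = ≡.trans (count-partitions M (vsum e) P o e ≡.refl)
  (≡.trans (ℤSums.sumL-cong vs pointwise)
    (≡.sym (≡.trans (Truncated.total≈ (vsum e) ok o M e ℕₚ.≤-refl) (Truncated.sumL-at (vsum e) vs F e))))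
  where
  vs = below (Vec.replicate M (vsum e))
  F : Vec ℕ M → Series
  F v = if strictMults ok v then mono (weightFrom o (multToParts 0 v)) else (λ _ → + 0)
  pointwise : ∀ v → (if P (multToParts 0 v) then mono (weightFrom o (multToParts 0 v)) e else + 0) ≡ F v e
  pointwise v rewrite P≡ v with strictMults ok v
  ... | true  = ≡.refl
  ... | false = ≡.refl

-- At each exponent e the count is the bounded sum with n = |e|, and e itself lies within that
-- truncation. The right side does not involve n, so the coefficients assemble into an identity of
-- series.
S3-closed : ∀ N μ → S3 (3[ N ]+ toℕ μ) S.≈ invPoch N ⊛ remainder μ (3[ N ]+ 0) (distinct N) true
S3-closed N μ e = ≡.trans
  (count≡total (3[ N ]+ toℕ μ) is3Strict (λ _ → true) true e is3Strict-multToParts)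
  (closed-form-strict (vsum e) N μ true e ℕₚ.≤-refl)

S3-swap-closed : ∀ N → subst-defabc (S3 (3[ N ]+ 0)) S.≈ invPoch N ⊛ distinct N false
S3-swap-closed N e = ER.begin
  S3 M (swapHalves e)
    ER.≡⟨ ≡.cong +_ (count-cong (partitionsUpTo M (vsum (swapHalves e))) (λ π → ≡.cong (is3Strict π ∧_) (≡.trans (eqVec-swap (weight π) e) (≡.cong (λ w → eqVec w e) (swap-weightFrom true π))))) ⟩
  + count (λ π → is3Strict π ∧ eqVec (weightFrom false π) e) (partitionsUpTo M (vsum (swapHalves e)))
    ER.≡⟨ ≡.cong (λ n → + count (λ π → is3Strict π ∧ eqVec (weightFrom false π) e) (partitionsUpTo M n)) (vsum-swap e) ⟩
  + count (λ π → is3Strict π ∧ eqVec (weightFrom false π) e) (partitionsUpTo M (vsum e))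
    ER.≡⟨ count≡total M is3Strict (λ _ → true) false e is3Strict-multToParts ⟩
  RowWeights.total (truncatedRing 6 (vsum e)) r (vsum e) (λ _ → true) false 0 M (λ _ → 𝟙) e
    ER.≡⟨ closed-form-strict (vsum e) N zero false e ℕₚ.≤-refl ⟩
  (invPoch N ⊛ distinct N false) e ER.∎
  where
  module ER = ≡.≡-Reasoning
  M = 3[ N ]+ 0

DS3-closed : ∀ N μ → DS3 (3[ N ]+ toℕ μ) S.≈ remainder μ (3[ N ]+ 0) (distinct N) true
DS3-closed N μ e = ≡.trans
  (≡.cong +_ (count-cong (partitionsUpTo M (vsum e)) (λ π → ≡.sym (∧-assoc (is3Strict π) (isDistinct π) _))))
  (≡.trans (count≡total M (λ π → is3Strict π ∧ isDistinct π) (_≤ᵇ 1) true e isDistinct-multToParts)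
    (Truncated.closed-form-distinct (vsum e) N μ true e ℕₚ.≤-refl))
  where M = 3[ N ]+ toℕ μ

-- The linear system in the six variables

p q u w : Series
p = va ⊛ vb ⊛ vc
q = vd ⊛ ve ⊛ vf
u = va ⊕ va ⊛ vb
w = vd ⊕ vd ⊛ ve

r-one r-two : Bool → Series
r-one o = if o then va else vd
r-two o = if o then va ⊛ vb else vd ⊛ ve

r-1+ : ∀ o j → r o (1 ℕ.+ (3[ j ]+ 0)) S.≈ period o ^ j ⊛ r-one o
r-1+ true  j = r-+3[] true j 1
r-1+ false j = r-+3[] false j 1

r-2+ : ∀ o j → r o (2 ℕ.+ (3[ j ]+ 0)) S.≈ period o ^ j ⊛ r-two o
r-2+ true  j = S.trans {r true (2 ℕ.+ (3[ j ]+ 0))} {p ^ j ⊛ r true 2} (r-+3[] true j 2)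
  (S.*-congˡ {p ^ j} (λ e → ≡.sym (monoV-+ (unitV zero) (unitV (suc zero)) e)))
r-2+ false j = S.trans {r false (2 ℕ.+ (3[ j ]+ 0))} {q ^ j ⊛ r false 2} (r-+3[] false j 2)
  (S.*-congˡ {q ^ j} (λ e → ≡.sym (monoV-+ (unitV (suc (suc (suc zero)))) (unitV (suc (suc (suc (suc zero))))) e)))

lower≈ : ∀ o j h → lower (3[ j ]+ 0) h o S.≈ h o ⊕ period o ^ j ⊛ (r-one o ⊕ r-two o) ⊛ h (not o)
lower≈ o j h = begin
  h o ⊕ (r o (1 ℕ.+ k) ⊛ h′ ⊕ r o (2 ℕ.+ k) ⊛ h′)
    ≈⟨ S.+-congˡ {h o} (S.+-cong {r o (1 ℕ.+ k) ⊛ h′} {period o ^ j ⊛ r-one o ⊛ h′} (S.*-congʳ {h′} {r o (1 ℕ.+ k)} (r-1+ o j)) (S.*-congʳ {h′} {r o (2 ℕ.+ k)} (r-2+ o j))) ⟩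
  h o ⊕ (period o ^ j ⊛ r-one o ⊛ h′ ⊕ period o ^ j ⊛ r-two o ⊛ h′)
    ≈⟨ solve 5 (λ h p x y g → h :+ (p :* x :* g :+ p :* y :* g) := h :+ p :* (x :+ y) :* g) (λ _ → ≡.refl) (h o) (period o ^ j) (r-one o) (r-two o) h′ ⟩
  h o ⊕ period o ^ j ⊛ (r-one o ⊕ r-two o) ⊛ h′ ∎
  where
  k = 3[ j ]+ 0
  h′ = h (not o)

-- The coefficient of `h o` collects an even number of new rows: none, or 3j + 3 above one of 3j + 1
-- and 3j + 2. The coefficient of `h (not o)` collects a single new row.
step≈ : ∀ o j h → let P = period o; P′ = period (not o) in step (3[ j ]+ 0) h o S.≈
  (𝟙 ⊕ P ^ suc j ⊛ (P′ ^ j ⊛ (r-one (not o) ⊕ r-two (not o)))) ⊛ h o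
  ⊕ (P ^ suc j ⊕ P ^ j ⊛ (r-one o ⊕ r-two o)) ⊛ h (not o)
step≈ o j h = begin
  lower k h o ⊕ r o (3 ℕ.+ k) ⊛ lower k h (not o)
    ≈⟨ S.+-cong {lower k h o} {h o ⊕ P ^ j ⊛ x ⊛ h′} (lower≈ o j h)
         (S.*-cong {r o (3 ℕ.+ k)} {P ^ suc j} (r-full o (suc j)) (lower≈ (not o) j h)) ⟩
  h o ⊕ P ^ j ⊛ x ⊛ h′ ⊕ P ^ suc j ⊛ (h′ ⊕ P′ ^ j ⊛ y ⊛ h (not (not o)))
    ≡⟨ ≡.cong (λ o → h₀ ⊕ P ^ j ⊛ x ⊛ h′ ⊕ P ^ suc j ⊛ (h′ ⊕ P′ ^ j ⊛ y ⊛ h o)) (not-involutive o) ⟩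
  h o ⊕ P ^ j ⊛ x ⊛ h′ ⊕ P ^ suc j ⊛ (h′ ⊕ P′ ^ j ⊛ y ⊛ h o)
    ≈⟨ solve 7 (λ h g s t z x y → h :+ s :* x :* g :+ t :* (g :+ z :* y :* h)
         := (con (+ 1) :+ t :* (z :* y)) :* h :+ (t :+ s :* x) :* g) (λ _ → ≡.refl) (h o) h′ (P ^ j) (P ^ suc j) (P′ ^ j) x y ⟩
  (𝟙 ⊕ P ^ suc j ⊛ (P′ ^ j ⊛ y)) ⊛ h o ⊕ (P ^ suc j ⊕ P ^ j ⊛ x) ⊛ h′ ∎
  where
  k = 3[ j ]+ 0
  P = period o
  P′ = period (not o)
  x = r-one o ⊕ r-two o
  y = r-one (not o) ⊕ r-two (not o)
  h₀ = h o
  h′ = h (not o)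

module Transfer = TransferSystem (seriesRing 6)
module D = Transfer.System p q u w vR (vR≈ true) (λ n → distinct n true) (λ n → distinct n false)
  (λ _ → ≡.refl) (λ _ → ≡.refl) (λ n → step≈ true n (distinct n)) (λ n → step≈ false n (distinct n))

strict≈sumQ : ∀ N → invPoch N ⊛ distinct N true S.≈ P.sumQ u (p ⊛ w) p N
strict≈sumQ N = begin
  invPoch N ⊛ distinct N true
    ≈⟨ S.*-congˡ {invPoch N} (D.D≈pochSum poch invPoch (λ _ → ≡.refl) poch-suc (λ _ → ≡.refl) invPoch-suc N) ⟩
  invPoch N ⊛ (poch N ⊛ s)                             ≈⟨ S.*-assoc (invPoch N) (poch N) s ⟨
  invPoch N ⊛ poch N ⊛ s
    ≈⟨ S.*-congʳ {s} {invPoch N ⊛ poch N} {𝟙} (P.inv-poch N) ⟩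
  𝟙 ⊛ s                                                ≈⟨ S.*-identityˡ s ⟩
  s                                                    ∎
  where s = P.sumQ u (p ⊛ w) p N

strict₂≈sumQ : ∀ N → invPoch N ⊛ D.E N S.≈ (𝟙 ⊕ u) ⊛ P.sumQ (u ⊛ vR) (p ⊛ w) p N
strict₂≈sumQ N = begin
  invPoch N ⊛ D.E N
    ≈⟨ S.*-congˡ {invPoch N} (D.E≈pochSum poch invPoch (λ _ → ≡.refl) poch-suc (λ _ → ≡.refl) invPoch-suc N) ⟩
  invPoch N ⊛ ((𝟙 ⊕ u) ⊛ (poch N ⊛ s))
    ≈⟨ solve 4 (λ i k p s → i :* (k :* (p :* s)) := k :* (i :* p :* s)) (λ _ → ≡.refl) (invPoch N) (𝟙 ⊕ u) (poch N) s ⟩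
  (𝟙 ⊕ u) ⊛ (invPoch N ⊛ poch N ⊛ s)
    ≈⟨ S.*-congˡ {𝟙 ⊕ u} (S.*-congʳ {s} {invPoch N ⊛ poch N} {𝟙} (P.inv-poch N)) ⟩
  (𝟙 ⊕ u) ⊛ (𝟙 ⊛ s)                                    ≈⟨ S.*-congˡ {𝟙 ⊕ u} (S.*-identityˡ s) ⟩
  (𝟙 ⊕ u) ⊛ s                                          ∎
  where s = P.sumQ (u ⊛ vR) (p ⊛ w) p N

-- The sums over T as coefficients of a product of four series

open Compositions (seriesRing 6)
open Sums (seriesRing 6)

Σˢ≡sumL : ∀ {A : Set} (xs : List A) F → Σˢ xs F ≡ sumL xs F
Σˢ≡sumL []       F = ≡.refl
Σˢ≡sumL (x ∷ xs) F = ≡.cong (F x ⊕_) (Σˢ≡sumL xs F)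

sum≈sumQ : ∀ x (k : Vec ℕ 4 → ℕ) N →
  (∀ T → vR ^ˢ k T ⊛ FT T S.≈ productAt (P.numer x ∷ P.numer (p ⊛ w) ∷ P.denom p ∷ P.denom 𝟙 ∷ []) T) →
  Σˢ (compositions4 N) (λ T → vR ^ˢ k T ⊛ FT T) S.≈ P.sumQ x (p ⊛ w) p N
sum≈sumQ x k N term≈ = begin
  Σˢ (compositions4 N) F                ≡⟨ Σˢ≡sumL (compositions4 N) F ⟩
  sumL (compositions4 N) F              ≈⟨ sumL-cong (compositions4 N) {F} {productAt fs} term≈ ⟩
  sumL (compositions4 N) (productAt fs)
    ≈⟨ sumL-filterᵇ (λ T → vsum T ≡ᵇ N) (below (Vec.replicate 4 N)) (productAt fs) ⟩
  sumL (below (Vec.replicate 4 N)) (λ T → if vsum T ≡ᵇ N then productAt fs T else (λ _ → + 0))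
                                        ≈⟨ sum-compositions fs {N} {N} ℕₚ.≤-refl ⟩
  convs fs N
    -- The iterated convolution ends in the unit `δ`, which is removed behind the fourth factor.
    ≈⟨ conv-cong {f = P.numer x} (λ _ _ → ≡.refl) (conv-cong {f = P.numer (p ⊛ w)} (λ _ _ → ≡.refl)
                                             (conv-cong {f = P.denom p} (λ _ _ → ≡.refl)
                                               (λ n → S.trans {conv (P.denom 𝟙) δ n} {conv δ (P.denom 𝟙) n} (conv-comm (P.denom 𝟙) δ n) (conv-identityˡ (P.denom 𝟙) n)))) N ⟩
  P.sumQ x (p ⊛ w) p N                  ∎
  where
  open PowerSeries (seriesRing 6)
  fs : Vec (ℕ → Series) 4
  fs = P.numer x ∷ P.numer (p ⊛ w) ∷ P.denom p ∷ P.denom 𝟙 ∷ []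
  F : Vec ℕ 4 → Series
  F T = vR ^ˢ k T ⊛ FT T

𝟙^n≈𝟙 : ∀ n → 𝟙 ^ n S.≈ 𝟙
𝟙^n≈𝟙 zero    _ = ≡.refl
𝟙^n≈𝟙 (suc n)   = S.trans {𝟙 ⊛ 𝟙 ^ n} {𝟙 ^ n} {𝟙} (S.*-identityˡ (𝟙 ^ n)) (𝟙^n≈𝟙 n)

-- Each index owns one factor. For t₂ one uses abcd + abcde = pw; the index t₄ carries a power of 1,
-- as befits the coefficients of 1/(y; R)_∞.
FT-factors : ∀ x y t₁ t₂ t₃ t₄ → vR ^ˢ (x ℕ.+ y) ⊛ FT (t₁ ∷ t₂ ∷ t₃ ∷ t₄ ∷ []) S.≈
  vR ^ x ⊛ (u ^ t₁ ⊛ invPoch t₁) ⊛ (vR ^ y ⊛ ((p ⊛ w) ^ t₂ ⊛ invPoch t₂) ⊛ (P.denom p t₃ ⊛ (P.denom 𝟙 t₄ ⊛ 𝟙)))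
FT-factors x y t₁ t₂ t₃ t₄ = begin
  vR ^ˢ (x ℕ.+ y) ⊛ (u ^ˢ t₁ ⊛ v ^ˢ t₂ ⊛ p ^ˢ t₃ ⊛ i₁ ⊛ i₂ ⊛ i₃ ⊛ i₄)
    ≡⟨ ≡.cong₂ (λ ρ π → ρ ⊛ (π ⊛ i₁ ⊛ i₂ ⊛ i₃ ⊛ i₄)) (^ˢ≡^ vR (x ℕ.+ y))
         (≡.cong₂ _⊛_ (≡.cong₂ _⊛_ (^ˢ≡^ u t₁) (^ˢ≡^ v t₂)) (^ˢ≡^ p t₃)) ⟩
  vR ^ (x ℕ.+ y) ⊛ (u ^ t₁ ⊛ v ^ t₂ ⊛ p ^ t₃ ⊛ i₁ ⊛ i₂ ⊛ i₃ ⊛ i₄)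
    ≈⟨ S.*-cong {vR ^ (x ℕ.+ y)} {vR ^ x ⊛ vR ^ y} (^-homo-* vR x y)
         (S.*-congʳ {i₄} (S.*-congʳ {i₃} (S.*-congʳ {i₂} (S.*-congʳ {i₁} (S.*-congʳ {p ^ t₃} (S.*-congˡ {u ^ t₁} (^-congˡ t₂ {v} {p ⊛ w} v≈))))))) ⟩
  vR ^ x ⊛ vR ^ y ⊛ (u ^ t₁ ⊛ (p ⊛ w) ^ t₂ ⊛ p ^ t₃ ⊛ i₁ ⊛ i₂ ⊛ i₃ ⊛ i₄)
    ≈⟨ solve 9 (λ ρ σ x y z i j k l → ρ :* σ :* (x :* y :* z :* i :* j :* k :* l)
         := ρ :* (x :* i) :* (σ :* (y :* j) :* (z :* k :* (con (+ 1) :* l :* con (+ 1))))) (λ _ → ≡.refl)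
         (vR ^ x) (vR ^ y) (u ^ t₁) ((p ⊛ w) ^ t₂) (p ^ t₃) i₁ i₂ i₃ i₄ ⟩
  vR ^ x ⊛ (u ^ t₁ ⊛ i₁) ⊛ (vR ^ y ⊛ ((p ⊛ w) ^ t₂ ⊛ i₂) ⊛ (p ^ t₃ ⊛ i₃ ⊛ (𝟙 ⊛ i₄ ⊛ 𝟙)))
    ≈⟨ S.*-congˡ {vR ^ x ⊛ (u ^ t₁ ⊛ i₁)} (S.*-congˡ {vR ^ y ⊛ ((p ⊛ w) ^ t₂ ⊛ i₂)} (S.*-congˡ {p ^ t₃ ⊛ i₃}
         (S.*-congʳ {𝟙} (S.*-congʳ {i₄} {𝟙} {𝟙 ^ t₄} (λ e → ≡.sym (𝟙^n≈𝟙 t₄ e)))))) ⟩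
  vR ^ x ⊛ (u ^ t₁ ⊛ i₁) ⊛ (vR ^ y ⊛ ((p ⊛ w) ^ t₂ ⊛ i₂) ⊛ (P.denom p t₃ ⊛ (P.denom 𝟙 t₄ ⊛ 𝟙))) ∎
  where
  i₁ = invPoch t₁
  i₂ = invPoch t₂
  i₃ = invPoch t₃
  i₄ = invPoch t₄
  v : Series
  v = va ⊛ vb ⊛ vc ⊛ vd ⊕ va ⊛ vb ⊛ vc ⊛ vd ⊛ ve
  v≈ : v S.≈ p ⊛ w
  v≈ = solve 3 (λ p d e → p :* d :+ p :* d :* e := p :* (d :+ d :* e)) (λ _ → ≡.refl) p vd ve

sum0≈sumQ : ∀ N → sum0 N S.≈ P.sumQ u (p ⊛ w) p N
sum0≈sumQ N = sum≈sumQ u (λ T → t₁of T C 2 ℕ.+ t₂of T C 2) N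
  (λ { (t₁ ∷ t₂ ∷ t₃ ∷ t₄ ∷ []) → FT-factors (t₁ C 2) (t₂ C 2) t₁ t₂ t₃ t₄ })

-- From C(n + 1, 2) = C(n, 2) + n, the extra R^n is absorbed into x^n. So the change of exponent
-- between the two sums over T is the replacement of u by uR.
numer-shift : ∀ x n → vR ^ (suc n C 2) ⊛ (x ^ n ⊛ invPoch n) S.≈ P.numer (x ⊛ vR) n
numer-shift x n = begin
  vR ^ (suc n C 2) ⊛ (x ^ n ⊛ i)           ≈⟨ S.*-congʳ {x ^ n ⊛ i} {vR ^ (suc n C 2)} (P.R^[1+n]C2 n) ⟩
  vR ^ n ⊛ vR ^ (n C 2) ⊛ (x ^ n ⊛ i)
    ≈⟨ solve 4 (λ r s x i → r :* s :* (x :* i) := s :* (x :* r :* i)) (λ _ → ≡.refl) (vR ^ n) (vR ^ (n C 2)) (x ^ n) i ⟩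
  vR ^ (n C 2) ⊛ (x ^ n ⊛ vR ^ n ⊛ i)
    ≈⟨ S.*-congˡ {vR ^ (n C 2)} (S.*-congʳ {i} {(x ⊛ vR) ^ n} {x ^ n ⊛ vR ^ n} (^-distrib-* x vR n)) ⟨
  P.numer (x ⊛ vR) n                       ∎
  where i = invPoch n

sum2≈sumQ : ∀ N → sum2 N S.≈ P.sumQ (u ⊛ vR) (p ⊛ w) p N
sum2≈sumQ N = sum≈sumQ (u ⊛ vR) (λ T → suc (t₁of T) C 2 ℕ.+ t₂of T C 2) N
  (λ { (t₁ ∷ t₂ ∷ t₃ ∷ t₄ ∷ []) → S.trans
    {vR ^ˢ (suc t₁ C 2 ℕ.+ t₂ C 2) ⊛ FT (t₁ ∷ t₂ ∷ t₃ ∷ t₄ ∷ [])}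
    {vR ^ (suc t₁ C 2) ⊛ (u ^ t₁ ⊛ invPoch t₁) ⊛ rest t₂ t₃ t₄}
    (FT-factors (suc t₁ C 2) (t₂ C 2) t₁ t₂ t₃ t₄)
    (S.*-congʳ {rest t₂ t₃ t₄} {vR ^ (suc t₁ C 2) ⊛ (u ^ t₁ ⊛ invPoch t₁)} (numer-shift u t₁)) })
  where
  rest : ℕ → ℕ → ℕ → Series
  rest t₂ t₃ t₄ = P.numer (p ⊛ w) t₂ ⊛ (P.denom p t₃ ⊛ (P.denom 𝟙 t₄ ⊛ 𝟙))

-- The four identities

S3≈sum0 : ∀ N → S3 (3[ N ]+ 0) S.≈ sum0 N
S3≈sum0 N = begin
  S3 (3[ N ]+ 0)               ≈⟨ S3-closed N zero ⟩
  invPoch N ⊛ distinct N true  ≈⟨ strict≈sumQ N ⟩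
  P.sumQ u (p ⊛ w) p N         ≈⟨ sum0≈sumQ N ⟨
  sum0 N                       ∎

S3≈sum2 : ∀ N → S3 (3[ N ]+ 2) S.≈ (𝟙 ⊕ va ⊕ va ⊛ vb) ⊛ sum2 N
S3≈sum2 N = begin
  S3 (3[ N ]+ 2)                                          ≈⟨ S3-closed N (suc (suc zero)) ⟩
  invPoch N ⊛ lower (3[ N ]+ 0) (distinct N) true
    ≈⟨ S.*-congˡ {invPoch N} (lower≈ true N (distinct N)) ⟩
  invPoch N ⊛ D.E N                                       ≈⟨ strict₂≈sumQ N ⟩
  (𝟙 ⊕ u) ⊛ P.sumQ (u ⊛ vR) (p ⊛ w) p N
    ≈⟨ S.*-cong {𝟙 ⊕ u} {𝟙 ⊕ va ⊕ va ⊛ vb} (λ e → ≡.sym (S.+-assoc 𝟙 va (va ⊛ vb) e)) (λ e → ≡.sym (sum2≈sumQ N e)) ⟩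
  (𝟙 ⊕ va ⊕ va ⊛ vb) ⊛ sum2 N                             ∎

S3-one : ∀ N → S3 (3[ N ]+ 1) S.≈ S3 (3[ N ]+ 0) ⊕ va ⊛ p ^ˢ N ⊛ subst-defabc (S3 (3[ N ]+ 0))
S3-one N = begin
  S3 (3[ N ]+ 1)                                          ≈⟨ S3-closed N (suc zero) ⟩
  i ⊛ (f ⊕ r true (1 ℕ.+ (3[ N ]+ 0)) ⊛ g)
    ≈⟨ S.*-congˡ {i} (S.+-congˡ {f} (S.*-congʳ {g} {r true (1 ℕ.+ (3[ N ]+ 0))} (r-1+ true N))) ⟩
  i ⊛ (f ⊕ p ^ N ⊛ va ⊛ g)                                ≡⟨ ≡.cong (λ ρ → i ⊛ (f ⊕ ρ ⊛ va ⊛ g)) (^ˢ≡^ p N) ⟨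
  i ⊛ (f ⊕ p ^ˢ N ⊛ va ⊛ g)
    ≈⟨ solve 5 (λ i f ρ a g → i :* (f :+ ρ :* a :* g) := i :* f :+ a :* ρ :* (i :* g)) (λ _ → ≡.refl) i f (p ^ˢ N) va g ⟩
  i ⊛ f ⊕ va ⊛ p ^ˢ N ⊛ (i ⊛ g)
    ≈⟨ S.+-cong {S3 (3[ N ]+ 0)} {i ⊛ f} (S3-closed N zero) (S.*-congˡ {va ⊛ p ^ˢ N} (S3-swap-closed N)) ⟨
  S3 (3[ N ]+ 0) ⊕ va ⊛ p ^ˢ N ⊛ subst-defabc (S3 (3[ N ]+ 0)) ∎
  where
  i = invPoch N
  f = distinct N true
  g = distinct N false

DS3≈ : ∀ N μ → DS3 (3[ N ]+ toℕ μ) S.≈ poch N ⊛ S3 (3[ N ]+ toℕ μ)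
DS3≈ N μ = begin
  DS3 (3[ N ]+ toℕ μ)                ≈⟨ DS3-closed N μ ⟩
  f                                  ≈⟨ S.*-identityˡ f ⟨
  𝟙 ⊛ f                              ≈⟨ S.*-congʳ {f} {invPoch N ⊛ poch N} {𝟙} (P.inv-poch N) ⟨
  invPoch N ⊛ poch N ⊛ f
    ≈⟨ solve 3 (λ i p f → i :* p :* f := p :* (i :* f)) (λ _ → ≡.refl) (invPoch N) (poch N) f ⟩
  poch N ⊛ (invPoch N ⊛ f)           ≈⟨ S.*-congˡ {poch N} (S3-closed N μ) ⟨
  poch N ⊛ S3 (3[ N ]+ toℕ μ)        ∎
  where f = remainder μ (3[ N ]+ 0) (distinct N) true

open import Data.Nat using (_+_; _*_)

theorem3p8 : (N : ℕ) →
    ((e : Vec ℕ 6) → S3 (3 * N) e ≡ sum0 N e)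
    × ((e : Vec ℕ 6) → S3 (3 * N + 2) e ≡ ((𝟙 ⊕ va ⊕ va ⊛ vb) ⊛ sum2 N) e)
    × ((e : Vec ℕ 6) → S3 (3 * N + 1) e
         ≡ (S3 (3 * N) ⊕ va ⊛ (va ⊛ vb ⊛ vc) ^ˢ N ⊛ subst-defabc (S3 (3 * N))) e)
    × ((μ : Fin 3) (e : Vec ℕ 6) → DS3 (3 * N + toℕ μ) e ≡ (poch N ⊛ S3 (3 * N + toℕ μ)) e)
theorem3p8 N =
  ≡.subst (λ M → S3 M S.≈ sum0 N) 3N≡ (S3≈sum0 N) ,
  ≡.subst (λ M → S3 M S.≈ (𝟙 ⊕ va ⊕ va ⊛ vb) ⊛ sum2 N) (3[]+≡ N 2) (S3≈sum2 N) ,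
  ≡.subst₂ (λ M M′ → S3 M S.≈ S3 M′ ⊕ va ⊛ p ^ˢ N ⊛ subst-defabc (S3 M′)) (3[]+≡ N 1) 3N≡ (S3-one N) ,
  (λ μ → ≡.subst (λ M → DS3 M S.≈ poch N ⊛ S3 M) (3[]+≡ N (toℕ μ)) (DS3≈ N μ))
  where
  3N≡ : 3[ N ]+ 0 ≡ 3 * N
  3N≡ = ≡.trans (3[]+≡ N 0) (ℕₚ.+-identityʳ (3 * N))
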